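{- Let $q$ be a prime power, let $s\ge1$ be an integer, let $F$ be a global function field with full constant field $\mathbb{F}_q$ and genus $g$, and let $P_\infty,P_1,\ldots,P_s$ be $s+1$ distinct places of $F$ with $\deg(P_\infty)=1$. Put $e_i=\deg(P_i)$ for $1\le i\le s$ and $\boldsymbol{e}=(e_1,\ldots,e_s)$. Then the matrices $C^{(1)},\ldots,C^{(s)}\in\mathbb{F}_q^{\mathbb{N}\times\mathbb{N}_0}$ given by the refined columnwise construction (described in the context) generate, by the digital method, a $(g,\boldsymbol{e},s)$-sequence in base $q$, and this sequence is also a $(t,s)$-sequence in base $q$ with $t=g+\sum_{i=1}^s(e_i-1)$.
   Context: **Refined columnwise construction.** Let $v=\mathrm{lcm}(e_1,\ldots,e_s)$. For a divisor $D$ of $F$ let $\mathcal{L}(D)=\{f\in F^*:\mathrm{div}(f)+D\ge 0\}\cup\{0\}$ be the Riemann-Roch space and $\ell(D)$ its dimension over $\mathbb{F}_q$. The gap numbers of $P_\infty$ are the $g$ positive integers $n$ with $\ell(nP_\infty)=\ell((n-1)P_\infty)$. Let $n_0<n_1<\cdots$ be the elements of $\mathbb{N}_0$ that are not gap numbers of $P_\infty$, in increasing order (so $n_r=r+g$ for $r\ge g$). Choose elements $y_r\in F$, $r\ge0$, as follows. - For $0\le r\le g$: any $y_r\in\mathcal{L}(n_rP_\infty)\setminus\mathcal{L}((n_r-1)P_\infty)$. - For $r>g$: determine integers $l_s,l_{s-1},\ldots,l_1\ge0$ by successive division with remainder: $w_{s+1}:=r-g$ and, for $i=s,s-1,\ldots,1$,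 $w_{i+1}=iv\,l_i+w_i$ with $w_i\in\{0,\ldots,iv-1\}$. Then choose any $y_r\in\mathcal{L}(D_r)\setminus\mathcal{L}(D_r')$, where $D_r=n_rP_\infty-\sum_{i=1}^s(l_i+l_{i+1}+\cdots+l_s)\frac{v}{e_i}P_i$ and $D_r'=n_{r-1}P_\infty-\sum_{i=1}^s(l_i+l_{i+1}+\cdots+l_s)\frac{v}{e_i}P_i$ (such a $y_r$ exists). For $1\le i\le s$ choose a local parameter $z_i$ at $P_i$ (i.e. $\nu_{P_i}(z_i)=1$) and write the local expansion of $y_r$ at $P_i$ as $y_r=\sum_{k=0}^\infty\beta^{(i)}_{k,r}z_i^k$ with $\beta^{(i)}_{k,r}\in\mathbb{F}_{q^{e_i}}$ (the residue class field of $P_i$; expansion in the completion of $F$ at $P_i$, identified with $\mathbb{F}_{q^{e_i}}((z_i))$). Using a fixed ordered basis of $\mathbb{F}_{q^{e_i}}/\mathbb{F}_q$, identify $\beta^{(i)}_{k,r}$ with a column vector $\boldsymbol{b}^{(i)}_{k,r}\in\mathbb{F}_q^{e_i}$. Column $r$ of $C^{(i)}=(c^{(i)}_{j,r})_{j\ge1,r\ge0}$ is the concatenation of $\boldsymbol{b}^{(i)}_{0,r},\boldsymbol{b}^{(i)}_{1,r},\ldots$; i.e. $c^{(i)}_{ke_i+h,r}$ is the $h$th coordinate of $\boldsymbol{b}^{(i)}_{k,r}$ for $k\ge0$, $1\le h\le e_i$. **Digital method.** Let $Z_q=\{0,1,\ldots,q-1\}\subset\mathbb{Z}$. Choose bijections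 $\psi_r:Z_q\to\mathbb{F}_q$ ($r\ge0$) with $\psi_r(0)=0$ for all sufficiently large $r$, and bijections $\lambda_{i,j}:\mathbb{F}_q\to Z_q$ ($1\le i\le s$, $j\ge1$); these choices are arbitrary. For $n\ge0$ with base-$q$ expansion $n=\sum_{r\ge0}z_r(n)q^r$, put $y^{(i)}_{n,j}=\sum_{r\ge0}c^{(i)}_{j,r}\psi_r(z_r(n))\in\mathbb{F}_q$ and $x^{(i)}_n=\sum_{j\ge1}\lambda_{i,j}(y^{(i)}_{n,j})q^{ -j}$. The sequence generated by $C^{(1)},\ldots,C^{(s)}$ is $\boldsymbol{x}_n=(x_n^{(1)},\ldots,x_n^{(s)})$, $n\ge0$. **Nets and sequences.** Point sets are counted with multiplicity: for a point set $\mathcal{P}$ (finite indexed family), $A(J;\mathcal{P})$ is the number of indices $n$ with $\boldsymbol{x}_n\in J$. Let $b\ge2$, $s\ge1$, $0\le u\le m$ be integers, $\boldsymbol{e}=(e_1,\ldots,e_s)\in\mathbb{N}^s$. A *$(u,m,\boldsymbol{e},s)$-net in base $b$* is a point set $\mathcal{P}$ of $b^m$ points in $[0,1)^s$ such that $A(J;\mathcal{P})=b^m\,\mathrm{Vol}(J)$ for every interval $J=\prod_{i=1}^s[a_ib^{ -d_i},(a_i+1)b^{ -d_i})$ with integers $d_i\ge0$, $0\le a_i<b^{d_i}$, $e_i\mid d_i$ for $1\le i\le s$, and $\mathrm{Vol}(J)\ge b^{u-m}$. For $u\ge0$, a sequence $\boldsymbol{x}_0,\boldsymbol{x}_1,\ldots$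 in $[0,1]^s$ is a *$(u,\boldsymbol{e},s)$-sequence in base $b$* if for all integers $k\ge0$ and $m>u$ the points $[\boldsymbol{x}_n]_{b,m}$, $kb^m\le n<(k+1)b^m$, form a $(u,m,\boldsymbol{e},s)$-net in base $b$. Here $[\boldsymbol{x}_n]_{b,m}$ is the coordinatewise $m$-digit truncation in base $b$, taken with respect to the given digit expansion of each coordinate (for the digital method: $\sum_{j\ge1}\lambda_{i,j}(y^{(i)}_{n,j})q^{ -j}$ is truncated to $\sum_{j=1}^m$). For $0\le t\le m$, a *$(t,m,s)$-net in base $b$* is a point set of $b^m$ points in $[0,1)^s$ such that every interval $\prod_{i=1}^s[a_ib^{ -d_i},(a_i+1)b^{ -d_i})$ with integers $d_i\ge0$, $0\le a_i<b^{d_i}$ and volume $b^{t-m}$ contains exactly $b^t$ of the points; a *$(t,s)$-sequence in base $b$* is a sequence such that for all $k\ge0$, $m>t$ the points $[\boldsymbol{x}_n]_{b,m}$, $kb^m\le n<(k+1)b^m$, form a $(t,m,s)$-net in base $b$. -}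

module Defs where

open import Level using (Level; _⊔_; 0ℓ) renaming (suc to lsuc)
open import Algebra.Bundles using (CommutativeRing)
open import Algebra.Morphism.Structures using (module RingMorphisms)
import Algebra.Properties.Semiring.Exp as Exp
import Algebra.Properties.Semiring.Sum as Sum
import Algebra.Properties.CommutativeMonoid.Sum as MonoidSum
open import Data.Fin using (Fin; zero; suc; toℕ; fromℕ; inject₁)
open import Data.Fin.Properties using (all?)
open import Data.Integer as ℤ using (ℤ; +_)
open import Data.List using (List; []; _∷_; length; filter; allFin; tabulate)
open import Data.Nat as ℕ using (ℕ; zero; suc; NonZero; NonTrivial; nonTrivial⇒nonZero)
open import Data.Nat.Divisibility using (_∣_; quotient; ∣-trans)
open import Data.Nat.DivMod using (_mod_)
open import Data.Nat.LCM using (lcm; m∣lcm[m,n]; n∣lcm[m,n])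
open import Data.Nat.Primality using (Prime)
open import Data.Nat.Properties using (m^n≢0)
open import Data.Product using (Σ; ∃; ∃-syntax; _×_; _,_)
open import Data.Rational.Unnormalised as ℚ using (ℚᵘ; _/_; 0ℚᵘ; 1ℚᵘ; _≃_)
import Data.Rational.Unnormalised.Properties as ℚₚ
open import Data.Vec.Functional using (Vector; foldr; head; tail)
open import Function.Bundles using (Inverse; _⇔_)
open import Relation.Binary.Construct.Add.Supremum.NonStrict ℤ._≤_ using (_≤⁺_)
open import Relation.Binary.PropositionalEquality using (_≡_; setoid)
open import Relation.Nullary using (¬_; Dec)
open import Relation.Nullary.Construct.Add.Supremum using (_⁺; ⊤⁺; [_])
open import Relation.Nullary.Decidable using (_×-dec_)
open import Relation.Unary using (Pred; U)

IsPrimePower : ℕ → Set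
IsPrimePower q = ∃[ p ] ∃[ k ] Prime p × 1 ℕ.≤ k × q ≡ p ℕ.^ k

sumℕ : ∀ {n} → Vector ℕ n → ℕ
sumℕ = foldr ℕ._+_ 0

record Field (c ℓ : Level) : Set (lsuc (c ⊔ ℓ)) where
  field
    commutativeRing : CommutativeRing c ℓ
  open CommutativeRing commutativeRing public
  field
    0≉1     : ¬ 0# ≈ 1#
    inverse : ∀ x → ¬ x ≈ 0# → ∃[ y ] x * y ≈ 1#
  open Exp semiring public using (_^_)
  open Sum semiring public using (sum; sum-syntax)

HasCardinality : ∀ {c ℓ} → Field c ℓ → ℕ → Set (c ⊔ ℓ)
HasCardinality K n = Inverse (setoid (Fin n)) (Field.setoid K)

record Extension {c ℓ} (K L : Field c ℓ) : Set (c ⊔ ℓ) where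
  private
    module K = Field K
    module L = Field L
  field
    embed : K.Carrier → L.Carrier
    isRingHomomorphism :
      RingMorphisms.IsRingHomomorphism K.rawRing L.rawRing embed

module _ {c ℓ} {K L : Field c ℓ} (E : Extension K L) where
  private module K = Field K
  open Field L
  open Extension E

  linComb : ∀ {n} → Vector K.Carrier n → Vector Carrier n → Carrier
  linComb {n} a b = ∑[ i < n ] (embed (a i) * b i)

  -- For K-subspaces W ⊆ V of L: b represents a K-basis of V / W.
  record IsBasisMod {p r} (V : Pred Carrier p) (W : Pred Carrier r)
                    {n} (b : Vector Carrier n) : Set (c ⊔ p ⊔ r ⊔ ℓ) where
    field
      inside      : ∀ i → V (b i)
      spanning    : ∀ x → V x → ∃[ a ] W (x - linComb a b)
      independent : ∀ a → W (linComb a b) → ∀ i → a i K.≈ K.0#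

  HasCodim : ∀ {p r} → Pred Carrier p → Pred Carrier r → ℕ → Set (c ⊔ p ⊔ r ⊔ ℓ)
  HasCodim V W n = Σ (Vector Carrier n) (IsBasisMod V W)

  HasDim : ∀ {p} → Pred Carrier p → ℕ → Set (c ⊔ p ⊔ ℓ)
  HasDim V = HasCodim V (_≈ 0#)

  IsBasis : ∀ {n} → Vector Carrier n → Set (c ⊔ ℓ)
  IsBasis = IsBasisMod U (_≈ 0#)

  -- The value at x of the polynomial ∑ aᵢ Xⁱ.
  evalPoly : ∀ {n} → Vector K.Carrier n → Carrier → Carrier
  evalPoly a x = linComb a (λ i → x ^ toℕ i)

  IsAlgebraic : Carrier → Set (c ⊔ ℓ)
  IsAlgebraic x = ∃[ n ] Σ (Vector K.Carrier n) λ a →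
    (∃[ i ] ¬ a i K.≈ K.0#) × evalPoly a x ≈ 0#

  InRationalSubfield : Carrier → Carrier → Set (c ⊔ ℓ)
  InRationalSubfield x f =
    ∃[ m ] ∃[ n ] Σ (Vector K.Carrier m) λ p → Σ (Vector K.Carrier n) λ r →
      ¬ evalPoly r x ≈ 0# × f * evalPoly r x ≈ evalPoly p x

  -- L is spanned by finitely many elements over K(x) for some x transcendental over K.
  IsFunctionField : Set (c ⊔ ℓ)
  IsFunctionField = ∃[ x ] ¬ IsAlgebraic x ×
    (∃[ n ] Σ (Vector Carrier n) λ b → ∀ f →
      Σ (Vector Carrier n) λ u →
        (∀ j → InRationalSubfield x (u j)) × f ≈ ∑[ j < n ] (u j * b j))

  IsFullConstantField : Set (c ⊔ ℓ)
  IsFullConstantField = ∀ x → IsAlgebraic x → ∃[ a ] embed a ≈ x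

ℤ∞ : Set
ℤ∞ = ℤ ⁺

infixl 6 _+∞_
_+∞_ : ℤ∞ → ℤ∞ → ℤ∞
[ m ] +∞ [ n ] = [ m ℤ.+ n ]
[ m ] +∞ ⊤⁺    = ⊤⁺
⊤⁺    +∞ _     = ⊤⁺

_⊓∞_ : ℤ∞ → ℤ∞ → ℤ∞
[ m ] ⊓∞ [ n ] = [ m ℤ.⊓ n ]
[ m ] ⊓∞ ⊤⁺    = [ m ]
⊤⁺    ⊓∞ y     = y

record Valuation {c ℓ} (L : Field c ℓ) : Set (c ⊔ ℓ) where
  open Field L
  field
    ν          : Carrier → ℤ∞
    ν-cong     : ∀ {x y} → x ≈ y → ν x ≡ ν y
    ν-∞        : ∀ x → ν x ≡ ⊤⁺ ⇔ x ≈ 0#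
    ν-*        : ∀ x y → ν (x * y) ≡ ν x +∞ ν y
    ν-+        : ∀ x y → (ν x ⊓∞ ν y) ≤⁺ ν (x + y)
    normalized : ∃[ z ] ν z ≡ [ + 1 ]

module _ {c ℓ} {K L : Field c ℓ} (E : Extension K L) where
  private module K = Field K
  open Field L
  open Extension E

  -- A place is given by its normalized valuation.
  record Place : Set (c ⊔ ℓ) where
    field
      valuation : Valuation L
    open Valuation valuation public
    field
      trivialOnConstants : ∀ a → ¬ a K.≈ K.0# → ν (embed a) ≡ [ + 0 ]

  infix 4 _≈ₚ_
  _≈ₚ_ : Place → Place → Set c
  P ≈ₚ Q = ∀ f → Place.ν P f ≡ Place.ν Q f

  ord≥ : Place → ℤ → Pred Carrier 0ℓ
  ord≥ P n f = [ n ] ≤⁺ Place.ν P f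

  -- deg P is the K-dimension of the residue class field of P.
  HasDegree : Place → ℕ → Set (c ⊔ ℓ)
  HasDegree P = HasCodim E (ord≥ P (+ 0)) (ord≥ P (+ 1))

  -- Formal sums of places; a place may be listed several times.
  Divisor : Set (c ⊔ ℓ)
  Divisor = List (ℤ × Place)

  -- The coefficient and the degree of a divisor are given as (functional)
  -- relations since equality of places is not decidable.
  data HasCoefficient (P : Place) : Divisor → ℤ → Set (c ⊔ ℓ) where
    []   : HasCoefficient P [] (+ 0)
    same : ∀ {n Q D a} → P ≈ₚ Q → HasCoefficient P D a →
           HasCoefficient P ((n , Q) ∷ D) (n ℤ.+ a)
    skip : ∀ {n Q D a} → ¬ P ≈ₚ Q → HasCoefficient P D a →
           HasCoefficient P ((n , Q) ∷ D) a

  data HasDivisorDegree : Divisor → ℤ → Set (c ⊔ ℓ) where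
    []  : HasDivisorDegree [] (+ 0)
    _∷_ : ∀ {n Q e D d} → HasDegree Q e → HasDivisorDegree D d →
          HasDivisorDegree ((n , Q) ∷ D) (n ℤ.* + e ℤ.+ d)

  -- The Riemann-Roch space of D; it contains 0 because ν 0 = ∞.
  𝓛 : Divisor → Pred Carrier (c ⊔ ℓ)
  𝓛 D f = ∀ P a → HasCoefficient P D a → [ + 0 ] ≤⁺ (Place.ν P f +∞ [ a ])

  -- The genus is the maximum of deg D + 1 - ℓ(D) over all divisors D.
  record IsGenus (g : ℕ) : Set (c ⊔ ℓ) where
    field
      bound    : ∀ D d n → HasDivisorDegree D d → HasDim E (𝓛 D) n →
                 d ℤ.+ + 1 ℤ.- + n ℤ.≤ + g
      attained : ∃[ D ] ∃[ d ] ∃[ n ]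
                 HasDivisorDegree D d × HasDim E (𝓛 D) n ×
                 d ℤ.+ + 1 ℤ.- + n ≡ + g

  IsGapNumber : Place → ℕ → Set (c ⊔ ℓ)
  IsGapNumber P n = 1 ℕ.≤ n × (∃[ d ]
    HasDim E (𝓛 ((+ n , P) ∷ [])) d × HasDim E (𝓛 ((+ n ℤ.- + 1 , P) ∷ [])) d)

  record EnumeratesNonGaps (P : Place) (n : ℕ → ℕ) : Set (c ⊔ ℓ) where
    field
      increasing : ∀ r → n r ℕ.< n (suc r)
      nonGap     : ∀ r → ¬ IsGapNumber P (n r)
      complete   : ∀ m → ¬ IsGapNumber P m → ∃[ r ] n r ≡ m

  -- The completion F̂ of L at P together with the copy in F̂ of the residue
  -- class field R of P, i.e. the identification of F̂ with R((z)) for any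
  -- local parameter z at P.
  record Completion (P : Place) : Set (lsuc (c ⊔ ℓ)) where
    field
      F̂         : Field c ℓ
      ι         : Extension L F̂
      valuation : Valuation F̂
    module F̂ = Field F̂
    open Valuation valuation public using () renaming (ν to ν̂)
    field
      extends-ν : ∀ f → ν̂ (Extension.embed ι f) ≡ Place.ν P f
      dense     : ∀ x N → ∃[ f ] [ N ] ≤⁺ ν̂ (x F̂.- Extension.embed ι f)
      complete  : ∀ (u : ℕ → F̂.Carrier) →
        (∀ N → ∃[ k ] ∀ i j → k ℕ.≤ i → k ℕ.≤ j → [ N ] ≤⁺ ν̂ (u i F̂.- u j)) →
        ∃[ x ] ∀ N → ∃[ k ] ∀ i → k ℕ.≤ i → [ N ] ≤⁺ ν̂ (u i F̂.- x)
      R         : Field c ℓ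
      κ         : Extension K R
      ρ         : Extension R F̂
      commutes  : ∀ a → Extension.embed ρ (Extension.embed κ a) F̂.≈
                        Extension.embed ι (embed a)
      residue   : ∀ x → [ + 0 ] ≤⁺ ν̂ x →
                  ∃[ a ] [ + 1 ] ≤⁺ ν̂ (x F̂.- Extension.embed ρ a)
    module R = Field R

    -- y = ∑_{k ≥ 0} β k z^k in F̂
    IsExpansion : Carrier → Carrier → (ℕ → R.Carrier) → Set
    IsExpansion z y β = ∀ n →
      [ + n ] ≤⁺ ν̂ (Extension.embed ι y F̂.-
                    linComb ρ {n} (λ k → β (toℕ k))
                                  (λ k → Extension.embed ι z F̂.^ toℕ k))

lcmOf : ∀ {s} → Vector ℕ s → ℕ
lcmOf = foldr lcm 1

∣lcmOf : ∀ {s} (e : Vector ℕ s) i → e i ∣ lcmOf e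
∣lcmOf {suc s} e zero    = m∣lcm[m,n] (head e) (lcmOf (tail e))
∣lcmOf {suc s} e (suc i) =
  ∣-trans (∣lcmOf (tail e) i) (n∣lcm[m,n] (head e) (lcmOf (tail e)))

-- suffixSum l i = ∑_{j ≥ i} l j
suffixSum : ∀ {s} → Vector ℕ s → Vector ℕ s
suffixSum {suc s} l zero    = sumℕ l
suffixSum {suc s} l (suc i) = suffixSum (tail l) i

-- Successive division of N by sv, (s-1)v, …, 1v.  The index i : Fin s stands
-- for suc (toℕ i) ∈ {1,…,s}, so that w (suc i) is the dividend and
-- w (inject₁ i) the remainder belonging to l i.
record IsSuccessiveDivision {s} (v N : ℕ) (l : Vector ℕ s) : Set where
  field
    w         : Vector ℕ (suc s)
    start     : w (fromℕ s) ≡ N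
    division  : ∀ i → w (suc i) ≡ suc (toℕ i) ℕ.* v ℕ.* l i ℕ.+ w (inject₁ i)
    remainder : ∀ i → w (inject₁ i) ℕ.< suc (toℕ i) ℕ.* v

module _ {c ℓ} {K L : Field c ℓ} (E : Extension K L) where
  private module K = Field K
  open Field L

  -- The divisor n P∞ - ∑ᵢ (lᵢ + … + lₛ) (v / eᵢ) Pᵢ with v = lcm(e₁,…,eₛ).
  shiftedDivisor : ∀ {s} → Place E → Vector (Place E) s → Vector ℕ s →
                   Vector ℕ s → ℕ → Divisor E
  shiftedDivisor P∞ P e l n =
    (+ n , P∞) ∷
    tabulate (λ i → ℤ.- + (suffixSum l i ℕ.* quotient (∣lcmOf e i)) , P i)

  -- Rows are numbered from 0: C i j is row j + 1 of the matrix C⁽ⁱ⁾.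
  record RefinedColumnwise (g : ℕ) {s : ℕ} (P∞ : Place E)
                           (P : Vector (Place E) s) (e : Vector ℕ s)
                           (C : Fin s → ℕ → ℕ → K.Carrier) :
                           Set (lsuc (c ⊔ ℓ)) where
    field
      n         : ℕ → ℕ
      enumerate : EnumeratesNonGaps E P∞ n

      y         : ℕ → Carrier
      y-low     : ∀ r → r ℕ.≤ g →
                  𝓛 E ((+ n r , P∞) ∷ []) (y r) ×
                  ¬ 𝓛 E ((+ n r ℤ.- + 1 , P∞) ∷ []) (y r)

      l         : ℕ → Vector ℕ s
      l-spec    : ∀ r → g ℕ.< r →
                  IsSuccessiveDivision (lcmOf e) (r ℕ.∸ g) (l r)
      y-high    : ∀ r → g ℕ.< r →
                  𝓛 E (shiftedDivisor P∞ P e (l r) (n r)) (y r) ×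
                  ¬ 𝓛 E (shiftedDivisor P∞ P e (l r) (n (ℕ.pred r))) (y r)

      z         : Vector Carrier s
      z-local   : ∀ i → Place.ν (P i) (z i) ≡ [ + 1 ]

      completion : ∀ i → Completion E (P i)
    open module Comp i = Completion (completion i) using (R; κ; IsExpansion)
    field
      β         : ∀ i (k r : ℕ) → Field.Carrier (R i)
      expansion : ∀ i r → IsExpansion i (z i) (y r) (λ k → β i k r)

      basis     : ∀ i → Vector (Field.Carrier (R i)) (e i)
      isBasis   : ∀ i → IsBasis (κ i) (basis i)

      columns   : ∀ i k r →
        Field._≈_ (R i) (β i k r)
          (linComb (κ i) (λ h → C i (k ℕ.* e i ℕ.+ toℕ h) r) (basis i))

module _ (b : ℕ) .{{_ : NonTrivial b}} where

  private instance
    b≢0 : NonZero b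
    b≢0 = nonTrivial⇒nonZero b

  b^≢0 : ∀ n → NonZero (b ℕ.^ n)
  b^≢0 n = m^n≢0 b n

  invPow : ℕ → ℚᵘ
  invPow n = _/_ (+ 1) (b ℕ.^ n) {{b^≢0 n}}

  -- The coefficient of b^r in the base-b expansion of n.
  digit : ℕ → ℕ → Fin b
  digit r n = ℕ._/_ n (b ℕ.^ r) {{b^≢0 r}} mod b

  record ElementaryInterval (s : ℕ) : Set where
    field
      d a : Vector ℕ s
      a<  : ∀ i → a i ℕ.< b ℕ.^ d i

    lower upper : Vector ℚᵘ s
    lower i = (+ a i / 1) ℚ.* invPow (d i)
    upper i = (+ suc (a i) / 1) ℚ.* invPow (d i)

    vol : ℚᵘ
    vol = MonoidSum.sum ℚₚ.*-1-commutativeMonoid (λ i → upper i ℚ.- lower i)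

    Contains : Vector ℚᵘ s → Set
    Contains x = ∀ i → lower i ℚ.≤ x i × x i ℚ.< upper i

    contains? : ∀ x → Dec (Contains x)
    contains? x = all? λ i → (lower i ℚₚ.≤? x i) ×-dec (x i ℚₚ.<? upper i)

  open ElementaryInterval

  count : ∀ {s N} → ElementaryInterval s → (Fin N → Vector ℚᵘ s) → ℕ
  count {N = N} J x = length (filter (λ n → contains? J (x n)) (allFin N))

  InHalfOpenCube : ∀ {s N} → (Fin N → Vector ℚᵘ s) → Set
  InHalfOpenCube x = ∀ n i → 0ℚᵘ ℚ.≤ x n i × x n i ℚ.< 1ℚᵘ

  record IsUMESNet (u m : ℕ) {s} (e : Vector ℕ s)
                   (x : Fin (b ℕ.^ m) → Vector ℚᵘ s) : Set where
    field
      u≤m     : u ℕ.≤ m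
      inCube  : InHalfOpenCube x
      uniform : ∀ J → (∀ i → e i ∣ d J i) → invPow (m ℕ.∸ u) ℚ.≤ vol J →
                (+ count J x / 1) ≃ (+ (b ℕ.^ m) / 1) ℚ.* vol J

  record IsTMSNet (t m : ℕ) {s} (x : Fin (b ℕ.^ m) → Vector ℚᵘ s) : Set where
    field
      t≤m     : t ℕ.≤ m
      inCube  : InHalfOpenCube x
      uniform : ∀ J → vol J ≃ invPow (m ℕ.∸ t) → count J x ≡ b ℕ.^ t

  -- A sequence in [0,1]^s with prescribed base-b expansions of all
  -- coordinates: x n i j is the coefficient of b^(-(j+1)) in coordinate i of
  -- the nth point.  Nets only involve the rational truncations.
  DigitSequence : ℕ → Set
  DigitSequence s = ℕ → Fin s → ℕ → Fin b

  truncate : ∀ {s} → ℕ → (Fin s → ℕ → Fin b) → Vector ℚᵘ s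
  truncate m x i = MonoidSum.sum ℚₚ.+-0-commutativeMonoid {m} λ j →
    (+ toℕ (x i (toℕ j)) / 1) ℚ.* invPow (suc (toℕ j))

  block : ∀ {s} → DigitSequence s → (k m : ℕ) → Fin (b ℕ.^ m) → Vector ℚᵘ s
  block x k m n = truncate m (x (k ℕ.* b ℕ.^ m ℕ.+ toℕ n))

  IsUESSequence : ∀ {s} → ℕ → Vector ℕ s → DigitSequence s → Set
  IsUESSequence u e x = ∀ k m → u ℕ.< m → IsUMESNet u m e (block x k m)

  IsTSSequence : ∀ {s} → ℕ → DigitSequence s → Set
  IsTSSequence t x = ∀ k m → t ℕ.< m → IsTMSNet t m (block x k m)

module _ {c ℓ} (q : ℕ) .{{_ : NonTrivial q}} (K : Field c ℓ) where
  open Field K using (Carrier; _≈_; 0#; _*_; sum-syntax) renaming (setoid to Kₛ)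

  -- The series ∑_{r ≥ 0} t r has only finitely many nonzero terms and sum y.
  HasFiniteSum : (ℕ → Carrier) → Carrier → Set ℓ
  HasFiniteSum t y = ∃[ N ]
    (∀ r → N ℕ.≤ r → t r ≈ 0#) × y ≈ ∑[ r < N ] t (toℕ r)

  -- λ′ i j is the bijection for digit j + 1 of coordinate i.
  record DigitalChoices (s : ℕ) : Set (c ⊔ ℓ) where
    field
      ψ      : ℕ → Inverse (setoid (Fin q)) Kₛ
      ψ-zero : ∃[ N ] ∀ r → N ℕ.≤ r →
               ∀ (o : Fin q) → toℕ o ≡ 0 → Inverse.to (ψ r) o ≈ 0#
      λ′     : Fin s → ℕ → Inverse Kₛ (setoid (Fin q))

  module _ {s} (C : Fin s → ℕ → ℕ → Carrier) (ch : DigitalChoices s) where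
    open DigitalChoices ch

    record Generates (x : DigitSequence q s) : Set (c ⊔ ℓ) where
      field
        Y      : ℕ → Fin s → ℕ → Carrier
        Y-sum  : ∀ n i j →
          HasFiniteSum (λ r → C i j r * Inverse.to (ψ r) (digit q r n)) (Y n i j)
        output : ∀ n i j → x n i j ≡ Inverse.to (λ′ i j) (Y n i j)

{-# OPTIONS --safe #-}

-- For g + ∑ kᵢ eᵢ ≤ m the first ∑ kᵢ eᵢ rows have to map the first m columns onto
-- everything; counting the fibres of an affine map then gives the nets.  Since
-- the pole orders of y₀, y₁, … at P∞ run through its non-gaps, this means that the
-- first m of them span all values modulo ∏ Pᵢ^kᵢ.
--
-- Two facts replace the full Riemann-Roch theorem.  (1) The functions regular away
-- from P∞ take all values modulo ∏ Pᵢ^kᵢ.  Choose h ≠ 0 among them with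
-- κᵢ = ν(h) ≥ kᵢ at Pᵢ.  Multiplication by hᵗ embeds
-- 𝓛(t ∑ κᵢ Pᵢ) / 𝓛((t-1) ∑ κᵢ Pᵢ) into the image of these functions modulo ∏ Pᵢ^κᵢ; if
-- that image were not everything, every step t = 1, …, g + 1 would lose a dimension
-- and 𝓛((g+1) ∑ κᵢ Pᵢ) would violate Riemann's inequality.  (2) For r ≥ m some
-- function vanishing to order kᵢ at every Pᵢ has pole order exactly nᵣ at P∞, so yᵣ is
-- redundant modulo ∏ Pᵢ^kᵢ.  Otherwise, for every pole order a < nᵣ of such a function,
-- nᵣ - a is a gap, and by Riemann's inequality there are more than g of those.
--
-- Membership in 𝓛(D) is not decidable, so dimensions and pole orders exist only up to
-- double negation; the final counts are equations between naturals, hence stable.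

module Submission where

open import Defs
open import Algebra.Bundles using (AbelianGroup)
open import Algebra.Morphism.Structures using (module RingMorphisms)
import Algebra.Properties.CommutativeMonoid.Sum
import Algebra.Properties.Group
import Algebra.Properties.Monoid.Sum
import Algebra.Properties.Ring
import Algebra.Properties.Semiring.Sum
open import Data.Bool using (if_then_else_)
open import Data.Fin as Fin
  using (Fin; zero; suc; toℕ; fromℕ; fromℕ<; inject₁; inject≤; splitAt; _↑ˡ_; _↑ʳ_; punchOut; funToFin; finToFun; combine)
open import Data.Fin.Permutation using (Permutation; permutation; _⟨$⟩ʳ_)
open import Data.Fin.Properties as Finₚ
  using (any?; _≟_; injective⇒≤; pigeonhole; punchOut-injective; splitAt-↑ˡ; splitAt-↑ʳ; splitAt⁻¹-↑ˡ; splitAt⁻¹-↑ʳ;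
         finToFun-funToFin; funToFin-finToFin; ¬∀⟶∃¬; sequence)
open import Data.Integer as ℤ using (ℤ; +_; -[1+_])
import Data.Integer.Properties as ℤₚ
open import Data.Integer.Tactic.RingSolver using (solve-∀)
open import Data.List as List using (length; filter; tabulate; allFin)
open import Data.Nat as ℕ using (ℕ; zero; suc; NonTrivial; NonZero; z≤n; s≤s)
open import Data.Nat.DivMod as DivMod using (_/_; _%_)
open import Data.Nat.Divisibility as Divisibility using (_∣_; quotient; divides)
import Data.Nat.Properties as ℕₚ
import Data.Nat.Tactic.RingSolver as ℕSolver
open import Data.Product using (Σ; ∃-syntax; _×_; _,_; proj₁; proj₂)
open import Data.Rational.Unnormalised as ℚ using (ℚᵘ; 0ℚᵘ; 1ℚᵘ; _≃_; *≡*; *≤*; *<*)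
import Data.Rational.Unnormalised.Properties as ℚₚ
open import Data.Sum using (_⊎_; inj₁; inj₂; [_,_]′)
open import Data.Vec.Functional as Vec using (Vector; _++_)
open import Effect.Monad using (RawMonad)
open import Function using (_∘_; id; Injective; Inverse; _⇔_; mk⇔; Equivalence)
open import Level using (Level; _⊔_)
open import Relation.Binary.Construct.Add.Supremum.NonStrict ℤ._≤_ as Sup using (_≤⁺_; _≤⊤⁺; [≤]-injective)
open import Relation.Binary.Definitions using (tri<; tri≈; tri>)
open import Relation.Binary.PropositionalEquality as ≡ using (_≡_; _≗_; cong; cong₂; subst; subst₂)
open import Relation.Nullary using (¬_; Dec; yes; no; does; contradiction)
open import Relation.Nullary.Construct.Add.Supremum using (⊤⁺; [_]; []-injective; ≡-dec)
open import Relation.Nullary.Decidable using (map′; decidable-stable; ¬¬-excluded-middle)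
open import Relation.Nullary.Negation using (¬¬-Monad)
open import Relation.Unary using (Pred; Decidable; _⊆_)

-- The matrices are never inverted directly. Fact (1) supplies ∑ kᵢ eᵢ functions that are
-- independent modulo ∏ Pᵢ^kᵢ, and fact (2) writes each of them as a combination of the first m
-- functions yᵣ up to something vanishing to order kᵢ at every Pᵢ. The coefficients of these
-- combinations times the chosen rows form a square matrix. Its kernel is trivial: a combination of
-- the yᵣ killed by the first kᵢ eᵢ rows has no term below zᵢ^kᵢ in its expansion at Pᵢ. Being
-- square, the matrix is onto, and so are the rows. Expansions are thus read in one direction only,
-- from zero rows to order of vanishing.
--
-- Codimensions are bounded above by linear forms and below by independent families.

private
  module ℤ+ = Algebra.Properties.Group (AbelianGroup.group ℤₚ.+-0-abelianGroup)
  module ℕΣ = Algebra.Properties.Semiring.Sum ℕₚ.+-*-semiring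
  module ℚΣ = Algebra.Properties.Monoid.Sum ℚₚ.+-0-monoid
  module ℚΠ = Algebra.Properties.CommutativeMonoid.Sum ℚₚ.*-1-commutativeMonoid

-- Double negation and finite counting

infixl 1 _>>=_
_>>=_ : ∀ {a b} {A : Set a} {B : Set b} → ¬ ¬ A → (A → ¬ ¬ B) → ¬ ¬ B
(m >>= f) ¬b = m λ x → f x ¬b

return : ∀ {a} {A : Set a} → A → ¬ ¬ A
return = contradiction

¬¬-sequence : ∀ {p n} {P : Pred (Fin n) p} → (∀ i → ¬ ¬ P i) → ¬ ¬ (∀ i → P i)
¬¬-sequence = sequence (RawMonad.rawApplicative ¬¬-Monad)

injective⇒surjective : ∀ {n} {f : Fin n → Fin n} → Injective _≡_ _≡_ f →
                       ∀ y → ∃[ x ] f x ≡ y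
injective⇒surjective {n = suc n} {f} inj y with any? (λ x → f x ≟ y)
... | yes hit = hit
... | no miss = contradiction (injective⇒≤ avoid-injective) ℕₚ.1+n≰n
  where
  y≢f : ∀ x → ¬ y ≡ f x
  y≢f x y≡fx = miss (x , ≡.sym y≡fx)
  avoid-injective : Injective _≡_ _≡_ (λ x → punchOut (y≢f x))
  avoid-injective eq = inj (punchOut-injective (y≢f _) (y≢f _) eq)

-- Flattens the pairs of a coordinate i and a row j below `d i` to a single index, so that the
-- chosen rows of all matrices together become one matrix with `sumℕ d` rows.
locate : ∀ {s} (d : Vector ℕ s) → Fin (sumℕ d) → Σ (Fin s) (Fin ∘ d)
locate {suc s} d k = [ (λ j → zero , j)
                     , (λ k′ → suc (proj₁ (locate (d ∘ suc) k′)) , proj₂ (locate (d ∘ suc) k′))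
                     ]′ (splitAt (d zero) k)

unlocate : ∀ {s} (d : Vector ℕ s) i → Fin (d i) → Fin (sumℕ d)
unlocate d zero    j = j ↑ˡ _
unlocate d (suc i) j = d zero ↑ʳ unlocate (d ∘ suc) i j

locate-unlocate : ∀ {s} (d : Vector ℕ s) i j → locate d (unlocate d i j) ≡ (i , j)
locate-unlocate d zero    j rewrite splitAt-↑ˡ (d zero) j (sumℕ (d ∘ suc)) = ≡.refl
locate-unlocate d (suc i) j
  rewrite splitAt-↑ʳ (d zero) (sumℕ (d ∘ suc)) (unlocate (d ∘ suc) i j)
        | locate-unlocate (d ∘ suc) i j = ≡.refl

unlocate-locate : ∀ {s} (d : Vector ℕ s) k → unlocate d (proj₁ (locate d k)) (proj₂ (locate d k)) ≡ k
unlocate-locate {suc s} d k with splitAt (d zero) k in eq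
... | inj₁ j  = splitAt⁻¹-↑ˡ eq
... | inj₂ k′ = ≡.trans (cong (d zero ↑ʳ_) (unlocate-locate (d ∘ suc) k′)) (splitAt⁻¹-↑ʳ eq)

locate-surjective : ∀ {s} (d : Vector ℕ s) i j → ∃[ k ] locate d k ≡ (i , j)
locate-surjective d i j = unlocate d i j , locate-unlocate d i j

-- Cardinalities become sums of indicators, to which interchange of summation and reindexing by
-- permutations apply.
indicator : ∀ {p} {P : Set p} → Dec P → ℕ
indicator P? = if does P? then 1 else 0

indicator-cong : ∀ {p q} {P : Set p} {Q : Set q} (P? : Dec P) (Q? : Dec Q) →
                 (P → Q) → (Q → P) → indicator P? ≡ indicator Q?
indicator-cong (yes _) (yes _) _ _ = ≡.refl
indicator-cong (yes p) (no ¬q) f _ = contradiction (f p) ¬q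
indicator-cong (no ¬p) (yes q) _ g = contradiction (g q) ¬p
indicator-cong (no _)  (no _)  _ _ = ≡.refl

length-filter-tabulate : ∀ {a p} {A : Set a} {P : Pred A p} (P? : Decidable P) {n} (f : Fin n → A) →
                         length (filter P? (tabulate f)) ≡ sumℕ (λ i → indicator (P? (f i)))
length-filter-tabulate P? {zero}  f = ≡.refl
length-filter-tabulate P? {suc n} f with P? (f zero)
... | yes _ = cong suc (length-filter-tabulate P? (f ∘ suc))
... | no  _ = length-filter-tabulate P? (f ∘ suc)

sumℕ-replicate : ∀ n c → sumℕ {n} (λ _ → c) ≡ n ℕ.* c
sumℕ-replicate zero    c = ≡.refl
sumℕ-replicate (suc n) c = cong (c ℕ.+_) (sumℕ-replicate n c)

sumℕ-mono : ∀ {n} {f g : Vector ℕ n} → (∀ i → f i ℕ.≤ g i) → sumℕ f ℕ.≤ sumℕ g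
sumℕ-mono {zero}  _   = z≤n
sumℕ-mono {suc n} f≤g = ℕₚ.+-mono-≤ (f≤g zero) (sumℕ-mono (f≤g ∘ suc))

fibreSize : ∀ {m n} → (Fin m → Fin n) → Fin n → ℕ
fibreSize f w = sumℕ (λ x → indicator (f x ≟ w))

sum-indicator : ∀ {n} (x : Fin n) → sumℕ (λ w → indicator (x ≟ w)) ≡ 1
sum-indicator {suc n} zero    = cong suc (≡.trans (sumℕ-replicate n 0) (ℕₚ.*-zeroʳ n))
sum-indicator {suc n} (suc x) = ≡.trans (ℕΣ.sum-cong-≗ {n} λ w → indicator-cong (suc x ≟ suc w) (x ≟ w)
                                        Finₚ.suc-injective (cong suc))
                                      (sum-indicator x)

sum-fibreSize : ∀ {m n} (f : Fin m → Fin n) → sumℕ (fibreSize f) ≡ m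
sum-fibreSize {m} {n} f = begin
  sumℕ (fibreSize f)                              ≡⟨ ℕΣ.∑-comm {n} {m} (λ w x → indicator (f x ≟ w)) ⟩
  sumℕ (λ x → sumℕ (λ w → indicator (f x ≟ w)))   ≡⟨ ℕΣ.sum-cong-≗ {m} (λ x → sum-indicator (f x)) ⟩
  sumℕ {m} (λ _ → 1)                              ≡⟨ sumℕ-replicate m 1 ⟩
  m ℕ.* 1                                           ≡⟨ ℕₚ.*-identityʳ m ⟩
  m                                               ∎
  where open ≡.≡-Reasoning

-- Each permutation carries the fibre over `w′` onto the fibre over `w`, so all `n` fibres have the
-- same size, and together they exhaust the domain.
equal-fibres : ∀ {m n} (f : Fin m → Fin n) (w : Fin n) →
               (∀ w′ → ∃[ π ] ∀ x → f (π ⟨$⟩ʳ x) ≡ w ⇔ f x ≡ w′) →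
               n ℕ.* fibreSize f w ≡ m
equal-fibres {m} {n} f w translate = begin
  n ℕ.* fibreSize f w                  ≡⟨ sumℕ-replicate n (fibreSize f w) ⟨
  sumℕ {n} (λ _ → fibreSize f w)     ≡⟨ ℕΣ.sum-cong-≗ {n} equal ⟩
  sumℕ (fibreSize f)                 ≡⟨ sum-fibreSize f ⟩
  m                                  ∎
  where
  open ≡.≡-Reasoning
  equal : ∀ w′ → fibreSize f w ≡ fibreSize f w′
  equal w′ with π , iff ← translate w′ =
    ≡.trans (ℕΣ.sum-permute (λ x → indicator (f x ≟ w)) π)
          (ℕΣ.sum-cong-≗ {m} λ x → indicator-cong (f (π ⟨$⟩ʳ x) ≟ w) (f x ≟ w′)
                                  (Equivalence.to (iff x)) (Equivalence.from (iff x)))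

funToFin-cong : ∀ {m n} {f g : Fin m → Fin n} → f ≗ g → funToFin f ≡ funToFin g
funToFin-cong {zero}  f≗g = ≡.refl
funToFin-cong {suc m} f≗g = cong₂ combine (f≗g zero) (funToFin-cong (f≗g ∘ suc))

-- Linear algebra over a finite field

module FieldLemmas {c ℓ} (L : Field c ℓ) where
  open Field L hiding (zero)
  open import Algebra.Properties.Semiring.Sum semiring public
    using (sum-cong-≋; sum-replicate-zero; ∑-distrib-+; ∑-comm; *-distribˡ-sum; *-distribʳ-sum)
  open import Algebra.Solver.Ring.NaturalCoefficients.Default commutativeSemiring public
    using (solve; _:+_; _:*_; _:=_)
  open Algebra.Properties.Ring ring public using (-1*x≈-x)
  open import Relation.Binary.Reasoning.Setoid setoid

  +-cancel-difference : ∀ x y → x ≈ y + (x - y)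
  +-cancel-difference x y = sym (begin
    y + (x - y)     ≈⟨ solve 3 (λ y x n → y :+ (x :+ n) := x :+ (y :+ n)) refl y x (- y) ⟩
    x + (y - y)     ≈⟨ +-congˡ (-‿inverseʳ y) ⟩
    x + 0#          ≈⟨ +-identityʳ x ⟩
    x               ∎)

  -- Identities with a difference are proved by semiring reasoning in the form `x ≈ y + w` and
  -- turned round here.
  difference : ∀ {x y w} → x ≈ y + w → x - y ≈ w
  difference {x} {y} {w} x≈y+w = begin
    x - y           ≈⟨ +-congʳ x≈y+w ⟩
    y + w - y       ≈⟨ solve 3 (λ y w n → (y :+ w) :+ n := w :+ (y :+ n)) refl y w (- y) ⟩
    w + (y - y)     ≈⟨ +-congˡ (-‿inverseʳ y) ⟩
    w + 0#          ≈⟨ +-identityʳ w ⟩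
    w               ∎

  difference-zero : ∀ {x y} → x - y ≈ 0# → x ≈ y
  difference-zero {x} {y} eq =
    trans (+-cancel-difference x y) (trans (+-congˡ eq) (+-identityʳ y))

  inverse-nonzero : ∀ {x y} → x * y ≈ 1# → ¬ y ≈ 0#
  inverse-nonzero {x} xy≈1 y≈0 = 0≉1 (trans (sym (trans (*-congˡ y≈0) (zeroʳ x))) xy≈1)

  sum-zero : ∀ {n} {t : Vector Carrier n} → (∀ i → t i ≈ 0#) → sum t ≈ 0#
  sum-zero {n} t≈0 = trans (sum-cong-≋ t≈0) (sum-replicate-zero n)

  sum-difference : ∀ {n} (x y a : Vector Carrier n) →
                   ∑[ i < n ] (x i * a i) ≈ ∑[ i < n ] (y i * a i) →
                   ∑[ i < n ] ((x i - y i) * a i) ≈ 0#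
  sum-difference {n} x y a eq = begin
    ∑[ i < n ] ((x i - y i) * a i)                       ≈⟨ sum-cong-≋ (λ i → distribʳ (a i) (x i) (- y i)) ⟩
    ∑[ i < n ] (x i * a i + (- y i) * a i)               ≈⟨ ∑-distrib-+ (λ i → x i * a i) _ ⟩
    ∑[ i < n ] (x i * a i) + ∑[ i < n ] ((- y i) * a i)  ≈⟨ +-congʳ eq ⟩
    ∑[ i < n ] (y i * a i) + ∑[ i < n ] ((- y i) * a i)  ≈⟨ ∑-distrib-+ (λ i → y i * a i) _ ⟨
    ∑[ i < n ] (y i * a i + (- y i) * a i)               ≈⟨ sum-cong-≋ (λ i → distribʳ (a i) (y i) (- y i)) ⟨
    ∑[ i < n ] ((y i - y i) * a i)                       ≈⟨ sum-zero (λ i → trans (*-congʳ (-‿inverseʳ (y i))) (zeroˡ (a i))) ⟩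
    0#                                                   ∎

  sum-assoc : ∀ {m n} (x : Vector Carrier m) (A : Fin m → Vector Carrier n) (y : Vector Carrier n) →
              ∑[ j < m ] (x j * ∑[ l < n ] (A j l * y l)) ≈ ∑[ l < n ] (∑[ j < m ] (x j * A j l) * y l)
  sum-assoc {m} {n} x A y = begin
    ∑[ j < m ] (x j * ∑[ l < n ] (A j l * y l))
      ≈⟨ sum-cong-≋ (λ j → *-distribˡ-sum (x j) (λ l → A j l * y l)) ⟩
    ∑[ j < m ] ∑[ l < n ] (x j * (A j l * y l))
      ≈⟨ ∑-comm (λ j l → x j * (A j l * y l)) ⟩
    ∑[ l < n ] ∑[ j < m ] (x j * (A j l * y l))
      ≈⟨ sum-cong-≋ (λ l → sum-cong-≋ (λ j → *-assoc (x j) (A j l) (y l))) ⟨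
    ∑[ l < n ] ∑[ j < m ] (x j * A j l * y l)
      ≈⟨ sum-cong-≋ (λ l → *-distribʳ-sum (y l) (λ j → x j * A j l)) ⟨
    ∑[ l < n ] (∑[ j < m ] (x j * A j l) * y l) ∎

module FiniteField {c ℓ} (K : Field c ℓ) (q : ℕ) .{{_ : NonTrivial q}} (card : HasCardinality K q) where
  open Field K hiding (zero)
  open FieldLemmas K
  open Inverse card renaming (to to elem; from to index)

  infix 4 _≈?_
  _≈?_ : ∀ x y → Dec (x ≈ y)
  x ≈? y = map′ (λ eq → trans (sym (strictlyInverseˡ x)) (trans (to-cong eq) (strictlyInverseˡ y)))
                from-cong (index x Finₚ.≟ index y)

  decode : ∀ {n} → Fin (q ℕ.^ n) → Vector Carrier n
  decode k = elem ∘ finToFun k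

  encode : ∀ {n} → Vector Carrier n → Fin (q ℕ.^ n)
  encode a = funToFin (index ∘ a)

  decode-encode : ∀ {n} (a : Vector Carrier n) i → decode (encode a) i ≈ a i
  decode-encode a i = trans (to-cong (finToFun-funToFin (index ∘ a) i)) (strictlyInverseˡ (a i))

  encode-decode : ∀ {n} (k : Fin (q ℕ.^ n)) → encode {n} (decode k) ≡ k
  encode-decode {n} k = ≡.trans (funToFin-cong {n} (strictlyInverseʳ ∘ finToFun {q} {n} k)) (funToFin-finToFin {n} k)

  encode-cong : ∀ {n} {a b : Vector Carrier n} → (∀ i → a i ≈ b i) → encode a ≡ encode b
  encode-cong a≈b = funToFin-cong (from-cong ∘ a≈b)

  encode-injective : ∀ {n} {a b : Vector Carrier n} → encode a ≡ encode b → ∀ i → a i ≈ b i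
  encode-injective {a = a} {b} eq i =
    trans (sym (decode-encode a i)) (trans (reflexive (cong (λ k → decode k i) eq)) (decode-encode b i))

  -- A search through the q^n coefficient vectors; it decides whether an element is spanned by a
  -- given family.
  anyVector? : ∀ {n p} {P : Pred (Vector Carrier n) p} →
               (∀ {a b} → (∀ i → a i ≈ b i) → P a → P b) → (∀ a → Dec (P a)) → Dec (∃[ a ] P a)
  anyVector? resp P? = map′ (λ (k , p) → decode k , p)
                            (λ (a , p) → encode a , resp (λ i → sym (decode-encode a i)) p)
                            (any? (P? ∘ decode))

  -- Pigeonhole instead of elimination: two of the q^m coefficient vectors have the same image among
  -- q^n, and their difference is the relation.
  dependent-rows : ∀ {m n} → n ℕ.< m → (A : Fin m → Vector Carrier n) →
                   ∃[ a ] (∃[ j ] ¬ a j ≈ 0#) × (∀ l → ∑[ j < m ] (a j * A j l) ≈ 0#)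
  dependent-rows {m} {n} n<m A
    with k , k′ , k<k′ , eq ← pigeonhole (ℕₚ.^-monoʳ-< q (ℕ.nonTrivial⇒n>1 q) n<m)
           (λ (k : Fin (q ℕ.^ m)) → encode (λ l → ∑[ j < m ] (decode k j * A j l)))
    = (λ j → decode k j - decode k′ j)
    , ¬∀⟶∃¬ m _ (λ j → (decode k j - decode k′ j) ≈? 0#)
        (λ all → ℕₚ.<⇒≢ k<k′ (cong toℕ (agree λ j → difference-zero (all j))))
    , λ l → sum-difference (decode k) (decode k′) (λ j → A j l) (encode-injective eq l)
    where
    agree : ∀ {k k′ : Fin (q ℕ.^ m)} → (∀ j → decode k j ≈ decode k′ j) → k ≡ k′
    agree all = ≡.trans (≡.sym (encode-decode {m} _)) (≡.trans (encode-cong {m} all) (encode-decode {m} _))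

  -- A trivial kernel makes the map injective, and an injective self-map of a finite set is
  -- surjective.
  rows-span : ∀ {n} (A : Fin n → Vector Carrier n) →
              (∀ a → (∀ l → ∑[ j < n ] (a j * A j l) ≈ 0#) → ∀ j → a j ≈ 0#) →
              ∀ w → ∃[ a ] ∀ l → ∑[ j < n ] (a j * A j l) ≈ w l
  rows-span {n} A trivial-kernel w =
    decode (proj₁ preimage) , λ l → encode-injective (proj₂ preimage) l
    where
    f : Fin (q ℕ.^ n) → Fin (q ℕ.^ n)
    f k = encode (λ l → ∑[ j < n ] (decode k j * A j l))
    f-injective : Injective _≡_ _≡_ f
    f-injective {k} {k′} eq =
      ≡.trans (≡.sym (encode-decode {n} k)) (≡.trans (encode-cong {n} agree) (encode-decode {n} k′))
      where
      agree : ∀ j → decode k j ≈ decode k′ j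
      agree j = difference-zero (trivial-kernel (λ j → decode k j - decode k′ j)
        (λ l → sum-difference (decode k) (decode k′) (λ j → A j l) (encode-injective eq l)) j)
    preimage : ∃[ k ] f k ≡ encode w
    preimage = injective⇒surjective f-injective (encode w)

module LinComb {c ℓ} {K L : Field c ℓ} (E : Extension K L) where
  private module K where
    open Field K public hiding (zero)
    open FieldLemmas K public
  open Field L hiding (zero)
  open FieldLemmas L
  open Extension E
  private module hom = RingMorphisms.IsRingHomomorphism isRingHomomorphism
  open import Relation.Binary.Reasoning.Setoid setoid

  lin : ∀ {n} → Vector K.Carrier n → Vector Carrier n → Carrier
  lin = linComb E

  lin-congˡ : ∀ {n} {a a′ : Vector K.Carrier n} (b : Vector Carrier n) →
              (∀ i → a i K.≈ a′ i) → lin a b ≈ lin a′ b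
  lin-congˡ b eq = sum-cong-≋ (λ i → *-congʳ (hom.⟦⟧-cong (eq i)))

  lin-congʳ : ∀ {n} (a : Vector K.Carrier n) {b b′ : Vector Carrier n} →
              (∀ i → b i ≈ b′ i) → lin a b ≈ lin a b′
  lin-congʳ a eq = sum-cong-≋ (λ i → *-congˡ (eq i))

  lin-zero : ∀ {n} {a : Vector K.Carrier n} (b : Vector Carrier n) →
             (∀ i → a i K.≈ K.0#) → lin a b ≈ 0#
  lin-zero b a≈0 = sum-zero (λ i → trans (*-congʳ (trans (hom.⟦⟧-cong (a≈0 i)) hom.0#-homo)) (zeroˡ (b i)))

  lin-+ˡ : ∀ {n} (a a′ : Vector K.Carrier n) (b : Vector Carrier n) →
           lin (λ i → a i K.+ a′ i) b ≈ lin a b + lin a′ b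
  lin-+ˡ a a′ b = trans
    (sum-cong-≋ (λ i → trans (*-congʳ (hom.+-homo (a i) (a′ i))) (distribʳ (b i) _ _)))
    (∑-distrib-+ (λ i → embed (a i) * b i) _)

  lin-+ʳ : ∀ {n} (a : Vector K.Carrier n) (b b′ : Vector Carrier n) →
           lin a (λ i → b i + b′ i) ≈ lin a b + lin a b′
  lin-+ʳ a b b′ = trans (sum-cong-≋ (λ i → distribˡ _ (b i) (b′ i)))
                        (∑-distrib-+ (λ i → embed (a i) * b i) _)

  lin-scaleˡ : ∀ {n} c (a : Vector K.Carrier n) (b : Vector Carrier n) →
               lin (λ i → c K.* a i) b ≈ embed c * lin a b
  lin-scaleˡ c a b = trans
    (sum-cong-≋ (λ i → trans (*-congʳ (hom.*-homo c (a i))) (*-assoc _ _ _)))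
    (sym (*-distribˡ-sum (embed c) (λ i → embed (a i) * b i)))

  lin-scaleʳ : ∀ {n} (a : Vector K.Carrier n) x (b : Vector Carrier n) →
               lin a (λ i → x * b i) ≈ x * lin a b
  lin-scaleʳ a x b = trans
    (sum-cong-≋ (λ i → solve 3 (λ a x b → a :* (x :* b) := x :* (a :* b)) refl (embed (a i)) x (b i)))
    (sym (*-distribˡ-sum x (λ i → embed (a i) * b i)))

  embed-sum : ∀ {n} (t : Vector K.Carrier n) → embed (K.sum t) ≈ sum (embed ∘ t)
  embed-sum {zero}  t = hom.0#-homo
  embed-sum {suc n} t = trans (hom.+-homo _ _) (+-congˡ (embed-sum (t ∘ suc)))

  lin-assoc : ∀ {m n} (c : Vector K.Carrier m) (A : Fin m → Vector K.Carrier n) (b : Vector Carrier n) →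
              lin c (λ j → lin (A j) b) ≈ lin (λ l → K.sum (λ j → c j K.* A j l)) b
  lin-assoc {m} {n} c A b = trans (sum-assoc (embed ∘ c) (λ j → embed ∘ A j) b)
    (sum-cong-≋ (λ l → *-congʳ (sym (trans (embed-sum (λ j → c j K.* A j l))
                                           (sum-cong-≋ (λ j → hom.*-homo (c j) (A j l)))))))

  δ : ∀ {n} → Fin n → Vector K.Carrier n
  δ zero    = K.1# Vec.∷ λ _ → K.0#
  δ (suc i) = K.0# Vec.∷ δ i

  lin-δ : ∀ {n} (i : Fin n) (b : Vector Carrier n) → lin (δ i) b ≈ b i
  lin-δ zero    b = trans (+-cong (trans (*-congʳ hom.1#-homo) (*-identityˡ _)) (lin-zero (b ∘ suc) (λ _ → K.refl)))
                          (+-identityʳ _)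
  lin-δ (suc i) b = trans (+-cong (trans (*-congʳ hom.0#-homo) (zeroˡ _)) (lin-δ i (b ∘ suc))) (+-identityˡ _)

  lin-++ : ∀ {m n} (a : Vector K.Carrier (m ℕ.+ n)) (b : Vector Carrier m) (b′ : Vector Carrier n) →
           lin a (b ++ b′) ≈ lin (a ∘ (_↑ˡ n)) b + lin (a ∘ (m ↑ʳ_)) b′
  lin-++ {zero}  a b b′ = sym (+-identityˡ _)
  lin-++ {suc m} {n} a b b′ = begin
    embed (a zero) * b zero + lin (a ∘ suc) (λ i → (b ++ b′) (suc i))
      ≈⟨ +-congˡ (lin-congʳ (a ∘ suc) (λ i → reflexive (tail-++ i))) ⟩
    embed (a zero) * b zero + lin (a ∘ suc) ((b ∘ suc) ++ b′)
      ≈⟨ +-congˡ (lin-++ (a ∘ suc) (b ∘ suc) b′) ⟩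
    embed (a zero) * b zero + (lin (a ∘ suc ∘ (_↑ˡ n)) (b ∘ suc) + lin (a ∘ suc ∘ (m ↑ʳ_)) b′)
      ≈⟨ +-assoc _ _ _ ⟨
    lin (a ∘ (_↑ˡ n)) b + lin (a ∘ (suc m ↑ʳ_)) b′ ∎
    where
    tail-++ : ∀ i → (b ++ b′) (suc i) ≡ ((b ∘ suc) ++ b′) i
    tail-++ i with splitAt m i
    ... | inj₁ _ = ≡.refl
    ... | inj₂ _ = ≡.refl

  record IsSubspace {p} (V : Pred Carrier p) : Set (c ⊔ ℓ ⊔ p) where
    field
      resp  : ∀ {x y} → x ≈ y → V x → V y
      zero∈ : V 0#
      +∈    : ∀ {x y} → V x → V y → V (x + y)
      scale : ∀ a {x} → V x → V (embed a * x)

    ≈0⊆ : (_≈ 0#) ⊆ V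
    ≈0⊆ x≈0 = resp (sym x≈0) zero∈

    neg : ∀ {x} → V x → V (- x)
    neg {x} v = resp (trans (*-congʳ (trans (hom.-‿homo K.1#) (-‿cong hom.1#-homo))) (-1*x≈-x x))
                     (scale (K.- K.1#) v)

    -∈ : ∀ {x y} → V x → V y → V (x - y)
    -∈ v w = +∈ v (neg w)

    lin∈ : ∀ {n} (a : Vector K.Carrier n) {b} → (∀ i → V (b i)) → V (lin a b)
    lin∈ {zero}  a b∈ = zero∈
    lin∈ {suc n} a b∈ = +∈ (scale (a zero) (b∈ zero)) (lin∈ (a ∘ suc) (b∈ ∘ suc))

    unsubtract : ∀ {x y} → V (x - y) → V y → V x
    unsubtract {x} {y} d v = resp (sym (+-cancel-difference x y)) (+∈ v d)

module Codimension {c ℓ} {K L : Field c ℓ} (E : Extension K L)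
                   (q : ℕ) .{{_ : NonTrivial q}} (card : HasCardinality K q) where
  private module K where
    open Field K public hiding (zero)
    open FieldLemmas K public
    open FiniteField K q card public
  open Field L hiding (zero)
  open FieldLemmas L
  open Extension E
  open LinComb E
  private module hom = RingMorphisms.IsRingHomomorphism isRingHomomorphism
  open import Relation.Binary.Reasoning.Setoid setoid

  private variable
    p r t : Level

  Independent : ∀ {n} → Pred Carrier p → Vector Carrier n → Set _
  Independent W b = ∀ a → W (lin a b) → ∀ i → a i K.≈ K.0#

  -- n linear forms on V whose common kernel lies in W, given on finite
  -- families only: the coordinates need not be functions on V.
  record Coordinates (V : Pred Carrier p) (W : Pred Carrier r) (n : ℕ) : Set (c ⊔ ℓ ⊔ p ⊔ r) where
    constructor coordinates
    field
      forms : ∀ {m} (x : Vector Carrier m) → (∀ j → V (x j)) →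
              Σ (Fin m → Vector K.Carrier n) λ A →
                ∀ a → (∀ l → K.sum (λ j → a j K.* A j l) K.≈ K.0#) → W (lin a x)
  open Coordinates

  -- With more vectors than forms the rows of values are dependent, so a nontrivial combination is
  -- killed by all forms and falls into `W`.
  independent≤ : ∀ {V : Pred Carrier p} {W : Pred Carrier r} {m n} {x : Vector Carrier m} →
                 Coordinates V W n → (∀ j → V (x j)) → Independent W x → m ℕ.≤ n
  independent≤ {m = m} {n} {x} coords x∈V independent with m ℕ.≤? n
  ... | yes m≤n = m≤n
  ... | no  m≰n with A , kernel ← forms coords x x∈V
                with a , (j , aj≉0) , a∈kernel ← K.dependent-rows (ℕₚ.≰⇒> m≰n) A =
    contradiction (independent a (kernel a a∈kernel) j) aj≉0

  spanning⇒coordinates : ∀ {V : Pred Carrier p} {W : Pred Carrier r} {n} (b : Vector Carrier n) →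
                         IsSubspace W → (∀ x → V x → ∃[ a ] W (x - lin a b)) → Coordinates V W n
  spanning⇒coordinates {W = W} {n} b W-subspace span =
    coordinates λ x x∈V → (λ j → proj₁ (span (x j) (x∈V j))) , kernel x x∈V
    where
    module W = IsSubspace W-subspace
    kernel : ∀ {m} (x : Vector Carrier m) x∈V (let A = λ j → proj₁ (span (x j) (x∈V j))) →
             ∀ a → (∀ l → K.sum (λ j → a j K.* A j l) K.≈ K.0#) → W (lin a x)
    kernel x x∈V a a∈kernel = let A = λ j → proj₁ (span (x j) (x∈V j)) in W.resp (sym (begin
      lin a x
        ≈⟨ lin-congʳ a (λ j → +-cancel-difference (x j) (lin (A j) b)) ⟩
      lin a (λ j → lin (A j) b + (x j - lin (A j) b))
        ≈⟨ lin-+ʳ a _ _ ⟩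
      lin a (λ j → lin (A j) b) + lin a (λ j → x j - lin (A j) b)
        ≈⟨ +-congʳ (lin-assoc a A b) ⟩
      lin (λ l → K.sum (λ j → a j K.* A j l)) b + lin a (λ j → x j - lin (A j) b)
        ≈⟨ +-congʳ (lin-zero b a∈kernel) ⟩
      0# + lin a (λ j → x j - lin (A j) b)
        ≈⟨ +-identityˡ _ ⟩
      lin a (λ j → x j - lin (A j) b) ∎))
      (W.lin∈ a (λ j → proj₂ (span (x j) (x∈V j))))

  -- Subadditivity of codimension under intersection: the forms for the single `W i` are put side by
  -- side.
  coordinates-⋂ : ∀ {V : Pred Carrier p} {s} {W : Fin s → Pred Carrier r} {n : Vector ℕ s} →
                  (∀ i → Coordinates V (W i) (n i)) → Coordinates V (λ x → ∀ i → W i x) (sumℕ n)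
  coordinates-⋂ {n = n} coords = coordinates λ x x∈V →
    (λ j k → let (i , l) = locate n k in proj₁ (forms (coords i) x x∈V) j l) ,
    λ a a∈kernel i → proj₂ (forms (coords i) x x∈V) a λ l →
      let (k , eq) = locate-surjective n i l in
      ≡.subst (λ (i , l) → K.sum (λ j → a j K.* proj₁ (forms (coords i) x x∈V) j l) K.≈ K.0#)
              eq (a∈kernel k)

  -- The inclusion of `W` in `W′` is asked for on `V′` only. This lets a local condition at one
  -- place cut out a subspace of a Riemann-Roch space.
  coordinates-map : ∀ {V : Pred Carrier p} {W : Pred Carrier r} {p′ r′} {V′ : Pred Carrier p′} {W′ : Pred Carrier r′} {n} →
                    IsSubspace V′ → V′ ⊆ V → (∀ {x} → V′ x → W x → W′ x) →
                    Coordinates V W n → Coordinates V′ W′ n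
  coordinates-map V′-subspace V′⊆V W⊆W′ coords = coordinates λ x x∈V′ →
    let (A , kernel) = forms coords x (V′⊆V ∘ x∈V′)
    in A , λ a a∈kernel → W⊆W′ (IsSubspace.lin∈ V′-subspace a x∈V′) (kernel a a∈kernel)

  independent-head∉ : ∀ {W : Pred Carrier r} {n} {b : Vector Carrier (suc n)} →
                      IsSubspace W → Independent W b → ¬ W (b zero)
  independent-head∉ {b = b} W-subspace independent b₀∈W = K.0≉1 (K.sym
    (independent (δ zero) (IsSubspace.resp W-subspace (sym (lin-δ zero b)) b₀∈W) zero))

  codim≤ : ∀ {V : Pred Carrier p} {W : Pred Carrier r} {m n} →
                      Coordinates V W n → HasCodim E V W m → m ℕ.≤ n
  codim≤ coords (b , isBasis) = independent≤ coords inside independent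
    where open IsBasisMod isBasis

  basis-coordinates : ∀ {V : Pred Carrier p} {W : Pred Carrier r} {n} →
                      IsSubspace W → HasCodim E V W n → Coordinates V W n
  basis-coordinates W-subspace (b , isBasis) = spanning⇒coordinates b W-subspace spanning
    where open IsBasisMod isBasis

  span-++ : ∀ {V : Pred Carrier p} {W : Pred Carrier r} {X : Pred Carrier t} {m n} →
          IsSubspace X → (b : Vector Carrier m) (b′ : Vector Carrier n) →
          (∀ x → V x → ∃[ a ] W (x - lin a b)) → (∀ x → W x → ∃[ a ] X (x - lin a b′)) →
          ∀ x → V x → ∃[ a ] X (x - lin a (b ++ b′))
  span-++ {m = m} {n} X-subspace b b′ span span′ x x∈V
    with a , y∈W ← span x x∈V
    with a′ , z∈X ← span′ _ y∈W = a ++ a′ , IsSubspace.resp X-subspace (sym (difference (begin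
    x
      ≈⟨ +-cancel-difference x (lin a b) ⟩
    lin a b + y
      ≈⟨ +-congˡ (+-cancel-difference y (lin a′ b′)) ⟩
    lin a b + (lin a′ b′ + (y - lin a′ b′))
      ≈⟨ +-assoc _ _ _ ⟨
    lin a b + lin a′ b′ + (y - lin a′ b′)
      ≈⟨ +-congʳ (+-cong (lin-congˡ b (λ i → K.reflexive (≡.cong [ a , a′ ]′ (splitAt-↑ˡ m i n))))
                         (lin-congˡ b′ (λ i → K.reflexive (≡.cong [ a , a′ ]′ (splitAt-↑ʳ m n i))))) ⟨
    lin ((a ++ a′) ∘ (_↑ˡ n)) b + lin ((a ++ a′) ∘ (m ↑ʳ_)) b′ + (y - lin a′ b′)
      ≈⟨ +-congʳ (lin-++ (a ++ a′) b b′) ⟨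
    lin (a ++ a′) (b ++ b′) + (y - lin a′ b′) ∎))) z∈X
    where y = x - lin a b

  -- For independence the relation is first read modulo `W`, where the second family disappears;
  -- once the first coefficients are zero, what remains is a relation of the second family modulo
  -- `X`.
  codim-+ : ∀ {V : Pred Carrier p} {W : Pred Carrier r} {X : Pred Carrier t} {m n} →
            IsSubspace W → IsSubspace X → W ⊆ V → X ⊆ W →
            HasCodim E V W m → HasCodim E W X n → HasCodim E V X (m ℕ.+ n)
  codim-+ {V = V} {W} {X} {m} {n} W-subspace X-subspace W⊆V X⊆W (b , isBasis) (b′ , isBasis′) =
    b ++ b′ , record { inside = inside ; spanning = spanning ; independent = independent }
    where
    module W = IsSubspace W-subspace
    module X = IsSubspace X-subspace
    module B = IsBasisMod isBasis
    module B′ = IsBasisMod isBasis′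
    inside : ∀ i → V ((b ++ b′) i)
    inside i with splitAt m i
    ... | inj₁ j = B.inside j
    ... | inj₂ j = W⊆V (B′.inside j)
    spanning : ∀ x → V x → ∃[ a ] X (x - lin a (b ++ b′))
    spanning = span-++ X-subspace b b′ B.spanning B′.spanning
    independent : Independent X (b ++ b′)
    independent a x∈X k = conclude (splitAt m k) (Finₚ.join-splitAt m n k)
      where
      split : lin a (b ++ b′) ≈ lin (a ∘ (_↑ˡ n)) b + lin (a ∘ (m ↑ʳ_)) b′
      split = lin-++ a b b′
      left : ∀ i → a (i ↑ˡ n) K.≈ K.0#
      left = B.independent _ (W.resp (difference (trans split (+-comm _ _)))
                                     (W.-∈ (X⊆W x∈X) (W.lin∈ _ B′.inside)))
      right : ∀ i → a (m ↑ʳ i) K.≈ K.0#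
      right = B′.independent _ (X.resp (trans split (trans (+-congʳ (lin-zero b left)) (+-identityˡ _))) x∈X)
      conclude : ∀ s → Fin.join m n s ≡ k → a k K.≈ K.0#
      conclude (inj₁ i) ≡.refl = left i
      conclude (inj₂ i) ≡.refl = right i

  -- Independent families have bounded length, so a maximal one exists
  -- classically; it spans because membership in W is decidable on V and
  -- there are finitely many candidate coefficient vectors.
  codim-exists : ∀ {V : Pred Carrier p} {W : Pred Carrier r} {n} →
                 IsSubspace V → IsSubspace W → (∀ x → V x → Dec (W x)) → Coordinates V W n →
                 ¬ ¬ (∃[ m ] m ℕ.≤ n × HasCodim E V W m)
  codim-exists {V = V} {W} {n} V-subspace W-subspace W? coords =
    extend n Vec.[] (λ ()) (λ _ _ ()) ℕₚ.≤-refl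
    where
    module V = IsSubspace V-subspace
    module W = IsSubspace W-subspace
    maximal⇒spanning : ∀ {m} (b : Vector Carrier m) → (∀ i → V (b i)) → Independent W b →
                       ¬ (∃[ x ] V x × Independent W (x Vec.∷ b)) → ∀ x → V x → ∃[ a ] W (x - lin a b)
    maximal⇒spanning b b∈V b-independent maximal x x∈V = decidable-stable
      (K.anyVector? (λ a≈a′ → W.resp (+-congˡ (-‿cong (lin-congˡ b a≈a′))))
                    (λ a → W? _ (V.-∈ x∈V (V.lin∈ a b∈V))))
      λ unspanned → maximal (x , x∈V , x∷b-independent unspanned)
      where
      x∷b-independent : ¬ (∃[ a ] W (x - lin a b)) → Independent W (x Vec.∷ b)
      x∷b-independent unspanned a w with a zero K.≈? K.0#
      -- Division by `a zero` turns the relation into a representation of `x` by `b` modulo `W`.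
      ... | no a₀≉0 with u , a₀u≈1 ← K.inverse (a zero) a₀≉0 = contradiction
        ( (λ i → K.- (u K.* a (suc i)))
        , W.resp (begin
            embed u * (embed (a zero) * x + lin (a ∘ suc) b)
              ≈⟨ solve 4 (λ u a x y → u :* (a :* x :+ y) := (a :* u) :* x :+ u :* y) refl
                   (embed u) (embed (a zero)) x (lin (a ∘ suc) b) ⟩
            embed (a zero) * embed u * x + embed u * lin (a ∘ suc) b
              ≈⟨ +-cong (trans (*-congʳ (trans (sym (hom.*-homo _ _)) (trans (hom.⟦⟧-cong a₀u≈1) hom.1#-homo)))
                               (*-identityˡ x))
                        (sym (lin-scaleˡ u (a ∘ suc) b)) ⟩
            x + lin (λ i → u K.* a (suc i)) b
              ≈⟨ difference (begin
                   x
                     ≈⟨ +-identityˡ x ⟨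
                   0# + x
                     ≈⟨ +-congʳ (lin-zero b (λ i → K.-‿inverseˡ (u K.* a (suc i)))) ⟨
                   lin (λ i → K.- (u K.* a (suc i)) K.+ u K.* a (suc i)) b + x
                     ≈⟨ +-congʳ (lin-+ˡ _ _ b) ⟩
                   lin (λ i → K.- (u K.* a (suc i))) b + lin (λ i → u K.* a (suc i)) b + x
                     ≈⟨ solve 3 (λ y z x → y :+ z :+ x := y :+ (x :+ z)) refl _ _ x ⟩
                   lin (λ i → K.- (u K.* a (suc i))) b + (x + lin (λ i → u K.* a (suc i)) b) ∎) ⟨
            x - lin (λ i → K.- (u K.* a (suc i))) b ∎)
            (W.scale u w) )
        unspanned
      ... | yes a₀≈0 = λ where
          zero    → a₀≈0
          (suc i) → b-independent (a ∘ suc) (W.resp (begin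
            embed (a zero) * x + lin (a ∘ suc) b
              ≈⟨ +-congʳ (trans (*-congʳ (trans (hom.⟦⟧-cong a₀≈0) hom.0#-homo)) (zeroˡ x)) ⟩
            0# + lin (a ∘ suc) b
              ≈⟨ +-identityˡ _ ⟩
            lin (a ∘ suc) b ∎) w) i

    extend : ∀ fuel {m} (b : Vector Carrier m) → (∀ i → V (b i)) → Independent W b →
             n ℕ.≤ m ℕ.+ fuel → ¬ ¬ (∃[ m ] m ℕ.≤ n × HasCodim E V W m)
    extend fuel {m} b b∈V b-independent n≤m+fuel = ¬¬-excluded-middle >>= decide fuel n≤m+fuel
      where
      decide : ∀ fuel → n ℕ.≤ m ℕ.+ fuel → Dec (∃[ x ] V x × Independent W (x Vec.∷ b)) →
               ¬ ¬ (∃[ m ] m ℕ.≤ n × HasCodim E V W m)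
      decide _ _ (no maximal) = return (m , independent≤ coords b∈V b-independent , b , record
        { inside = b∈V ; spanning = maximal⇒spanning b b∈V b-independent maximal ; independent = b-independent })
      -- Without fuel `m` has reached `n`, and one more independent vector would exceed the number
      -- of forms.
      decide zero n≤m+0 (yes (x , x∈V , x∷b-independent)) = contradiction
        (ℕₚ.≤-trans (independent≤ {x = x Vec.∷ b} coords (λ { zero → x∈V ; (suc i) → b∈V i }) x∷b-independent)
                    (ℕₚ.≤-trans n≤m+0 (ℕₚ.≤-reflexive (ℕₚ.+-identityʳ m))))
        ℕₚ.1+n≰n
      decide (suc fuel) n≤m+fuel (yes (x , x∈V , x∷b-independent)) =
        extend fuel (x Vec.∷ b) (λ { zero → x∈V ; (suc i) → b∈V i }) x∷b-independent
               (ℕₚ.≤-trans n≤m+fuel (ℕₚ.≤-reflexive (ℕₚ.+-suc m fuel)))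

-- Valuations and places

≤-⊓∞ : ∀ {n} x y → [ n ] ≤⁺ x → [ n ] ≤⁺ y → [ n ] ≤⁺ (x ⊓∞ y)
≤-⊓∞ [ _ ] [ _ ] Sup.[ p ] Sup.[ q ] = Sup.[ ℤₚ.⊓-glb p q ]
≤-⊓∞ [ _ ] ⊤⁺    p     q     = p
≤-⊓∞ ⊤⁺    y     p     q     = q

+∞-mono : ∀ {m n} {x y} → [ m ] ≤⁺ x → [ n ] ≤⁺ y → [ m ℤ.+ n ] ≤⁺ (x +∞ y)
+∞-mono {x = [ _ ]} {[ _ ]} Sup.[ p ] Sup.[ q ] = Sup.[ ℤₚ.+-mono-≤ p q ]
+∞-mono {x = [ _ ]} {⊤⁺}    p     q     = _ ≤⊤⁺
+∞-mono {x = ⊤⁺}            p     q     = _ ≤⊤⁺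

1+n≰n : ∀ {n} → ¬ ℤ.suc n ℤ.≤ n
1+n≰n = ℤₚ.<⇒≱ (ℤₚ.≤-<-trans ℤₚ.≤-refl (ℤₚ.suc[i]≤j⇒i<j ℤₚ.≤-refl))

module ValuationLemmas {c ℓ} {L : Field c ℓ} (valuation : Valuation L) where
  open Field L hiding (zero)
  open FieldLemmas L
  open Valuation valuation

  weaken : ∀ {m n x} → m ℤ.≤ n → [ n ] ≤⁺ ν x → [ m ] ≤⁺ ν x
  weaken m≤n = Sup.≤⁺-trans ℤₚ.≤-trans Sup.[ m≤n ]

  exactly⇒≥ : ∀ {a x} → ν x ≡ [ a ] → [ a ] ≤⁺ ν x
  exactly⇒≥ eq = Sup.≤⁺-reflexive-≡ ℤₚ.≤-reflexive (≡.sym eq)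

  ≥⇒≤ : ∀ {n a x} → ν x ≡ [ a ] → [ n ] ≤⁺ ν x → n ℤ.≤ a
  ≥⇒≤ eq n≤ = [≤]-injective (subst ([ _ ] ≤⁺_) eq n≤)

  ≤⇒≥ : ∀ {n a x} → ν x ≡ [ a ] → n ℤ.≤ a → [ n ] ≤⁺ ν x
  ≤⇒≥ eq n≤a = weaken n≤a (exactly⇒≥ eq)

  ν≥-resp : ∀ {n x y} → x ≈ y → [ n ] ≤⁺ ν x → [ n ] ≤⁺ ν y
  ν≥-resp x≈y = subst ([ _ ] ≤⁺_) (ν-cong x≈y)

  ν≥-0 : ∀ n → [ n ] ≤⁺ ν 0#
  ν≥-0 n = subst ([ n ] ≤⁺_) (≡.sym (Equivalence.from (ν-∞ 0#) refl)) ([ n ] ≤⊤⁺)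

  ν≥-+ : ∀ {n x y} → [ n ] ≤⁺ ν x → [ n ] ≤⁺ ν y → [ n ] ≤⁺ ν (x + y)
  ν≥-+ {x = x} {y} p q = Sup.≤⁺-trans ℤₚ.≤-trans (≤-⊓∞ (ν x) (ν y) p q) (ν-+ x y)

  ν≥-* : ∀ {m n x y} → [ m ] ≤⁺ ν x → [ n ] ≤⁺ ν y → [ m ℤ.+ n ] ≤⁺ ν (x * y)
  ν≥-* {x = x} {y} p q = subst ([ _ ] ≤⁺_) (≡.sym (ν-* x y)) (+∞-mono p q)

  ν-*-exactly : ∀ {x y a b} → ν x ≡ [ a ] → ν y ≡ [ b ] → ν (x * y) ≡ [ a ℤ.+ b ]
  ν-*-exactly {x} {y} p q = ≡.trans (ν-* x y) (cong₂ _+∞_ p q)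

  ν≥? : ∀ n x → Dec ([ n ] ≤⁺ ν x)
  ν≥? n x = Sup.≤⁺-dec ℤ._≤?_ [ n ] (ν x)

  zero? : ∀ x → Dec (x ≈ 0#)
  zero? x = map′ (Equivalence.to (ν-∞ x)) (Equivalence.from (ν-∞ x)) (≡-dec ℤ._≟_ (ν x) ⊤⁺)

  finite : ∀ {x} → ¬ x ≈ 0# → ∃[ a ] ν x ≡ [ a ]
  finite {x} x≉0 with ν x in eq
  ... | [ a ] = a , ≡.refl
  ... | ⊤⁺    = contradiction (Equivalence.to (ν-∞ x) eq) x≉0

  exactly⇒nonzero : ∀ {x a} → ν x ≡ [ a ] → ¬ x ≈ 0#
  exactly⇒nonzero {x} eq x≈0 with () ← ≡.trans (≡.sym eq) (Equivalence.from (ν-∞ x) x≈0)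

  ν-1 : ν 1# ≡ [ + 0 ]
  ν-1 with a , eq ← finite (λ 1≈0 → 0≉1 (sym 1≈0)) = ≡.trans eq (cong [_]
    (ℤ+.∙-cancelˡ a a (+ 0) (≡.trans
      ([]-injective (≡.trans (≡.sym (ν-*-exactly eq eq)) (≡.trans (ν-cong (*-identityˡ 1#)) eq)))
      (≡.sym (ℤₚ.+-identityʳ a)))))

  ν-inverse : ∀ {x y a} → x * y ≈ 1# → ν x ≡ [ a ] → ν y ≡ [ ℤ.- a ]
  ν-inverse {x} {y} {a} xy≈1 eq with b , eq′ ← finite (inverse-nonzero xy≈1) = ≡.trans eq′ (cong [_]
    (ℤ+.∙-cancelˡ a b (ℤ.- a) (≡.trans
      ([]-injective (≡.trans (≡.sym (ν-*-exactly eq eq′)) (≡.trans (ν-cong xy≈1) ν-1)))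
      (≡.sym (ℤₚ.+-inverseʳ a)))))

  ν-^ : ∀ {x a} n → ν x ≡ [ a ] → ν (x ^ n) ≡ [ + n ℤ.* a ]
  ν-^ {a = a} zero    eq = ν-1
  ν-^ {a = a} (suc n) eq = ≡.trans (ν-*-exactly eq (ν-^ n eq)) (cong [_] (≡.sym (ℤₚ.suc-* (+ n) a)))

  ν≥-^ : ∀ {x a} n → [ a ] ≤⁺ ν x → [ + n ℤ.* a ] ≤⁺ ν (x ^ n)
  ν≥-^ zero    p = exactly⇒≥ ν-1
  ν≥-^ {a = a} (suc n) p = subst (λ k → [ k ] ≤⁺ ν (_ ^ suc n)) (≡.sym (ℤₚ.suc-* (+ n) a)) (ν≥-* p (ν≥-^ n p))

  ν≥-cancel : ∀ {x y a n} → ν x ≡ [ a ] → [ n ] ≤⁺ ν (x * y) → [ n ℤ.- a ] ≤⁺ ν y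
  ν≥-cancel {x} {y} {a} eq xy≥n with u , xu≈1 ← inverse x (exactly⇒nonzero eq) =
    ν≥-resp (trans (solve 3 (λ x y u → x :* y :* u := x :* u :* y) refl x y u)
                   (trans (*-congʳ xu≈1) (*-identityˡ y)))
            (ν≥-* xy≥n (exactly⇒≥ (ν-inverse xu≈1 eq)))

  not-greater⇒exactly : ∀ {n x} → [ n ] ≤⁺ ν x → ¬ [ ℤ.suc n ] ≤⁺ ν x → ν x ≡ [ n ]
  not-greater⇒exactly {n} {x} p ¬p with ν x
  ... | [ a ] = cong [_] (ℤₚ.≤-antisym
                  (ℤₚ.≮⇒≥ (λ n<a → ¬p Sup.[ ℤₚ.i<j⇒suc[i]≤j n<a ])) ([≤]-injective p))
  ... | ⊤⁺    = contradiction (_ ≤⊤⁺) ¬p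

  -- A power of a uniformizer together with its inverse: multiplication by the two moves between a
  -- step of the filtration by order and the residue class field.
  unit-of-value : ∀ a → ∃[ x ] ∃[ y ] x * y ≈ 1# × ν x ≡ [ a ] × ν y ≡ [ ℤ.- a ]
  unit-of-value (+ n) = z ^ n , y , zy≈1 , νzⁿ , ν-inverse zy≈1 νzⁿ
    where
    z = proj₁ normalized
    νzⁿ = ≡.trans (ν-^ n (proj₂ normalized)) (cong [_] (ℤₚ.*-identityʳ (+ n)))
    y = proj₁ (inverse (z ^ n) (exactly⇒nonzero νzⁿ))
    zy≈1 = proj₂ (inverse (z ^ n) (exactly⇒nonzero νzⁿ))
  unit-of-value -[1+ n ] =
    let (x , y , xy≈1 , νx , νy) = unit-of-value (+ suc n) in y , x , trans (*-comm y x) xy≈1 , νy , νx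

module PlaceLemmas {c ℓ} {K L : Field c ℓ} (E : Extension K L)
                   (q : ℕ) .{{_ : NonTrivial q}} (card : HasCardinality K q) where
  private module K where
    open Field K public hiding (zero)
    open FieldLemmas K public
    open FiniteField K q card public
  open Field L hiding (zero)
  open FieldLemmas L
  open Extension E
  open LinComb E
  open Codimension E q card
  private module hom = RingMorphisms.IsRingHomomorphism isRingHomomorphism
  open import Relation.Binary.Reasoning.Setoid setoid

  module _ (P : Place E) where
    open Place P
    open ValuationLemmas valuation

    ν≥-constant : ∀ a → [ + 0 ] ≤⁺ ν (embed a)
    ν≥-constant a with a K.≈? K.0#
    ... | yes a≈0 = ν≥-resp (sym (trans (hom.⟦⟧-cong a≈0) hom.0#-homo)) (ν≥-0 _)
    ... | no  a≉0 = exactly⇒≥ (trivialOnConstants a a≉0)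

    ord≥-subspace : ∀ n → IsSubspace (ord≥ E P n)
    ord≥-subspace n = record
      { resp  = ν≥-resp
      ; zero∈ = ν≥-0 n
      ; +∈    = ν≥-+
      ; scale = λ a x≥n → weaken (ℤₚ.≤-reflexive (≡.sym (ℤₚ.+-identityˡ n))) (ν≥-* (ν≥-constant a) x≥n)
      }

    ν-scale : ∀ {a x n} → ¬ a K.≈ K.0# → ν x ≡ [ n ] → ν (embed a * x) ≡ [ n ]
    ν-scale a≉0 eq = ≡.trans (ν-*-exactly (trivialOnConstants _ a≉0) eq) (cong [_] (ℤₚ.+-identityˡ _))

    -- The constant 1 has order 0 and is therefore nonzero in the residue class field.
    degree-positive : ∀ {e} → HasDegree E P e → 1 ℕ.≤ e
    degree-positive {suc _} _ = s≤s z≤n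
    degree-positive {zero}  (b , isBasis) with _ , 1≥1 ← IsBasisMod.spanning isBasis 1# (exactly⇒≥ ν-1) =
      contradiction (≥⇒≤ ν-1 (ν≥-resp (difference (sym (+-identityˡ 1#))) 1≥1)) λ { (ℤ.+≤+ ()) }

    module _ {e} (degree : HasDegree E P e) where
      open IsBasisMod (proj₂ degree)

      -- Multiplication by an element of value `n` carries a residue basis to a spanning family of
      -- the functions of order at least n modulo those of order at least n + 1.
      graded-piece : ∀ n → ∃[ b ] ∀ x → ord≥ E P n x → ∃[ a ] ord≥ E P (ℤ.suc n) (x - lin {e} a b)
      graded-piece n with u , w , uw≈1 , νu , νw ← unit-of-value n =
        (λ i → u * proj₁ degree i) , λ x x≥n →
        let (a , r≥1) = spanning (w * x)
              (weaken (ℤₚ.≤-reflexive (≡.sym (ℤₚ.+-inverseˡ n))) (ν≥-* (exactly⇒≥ νw) x≥n))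
            y = lin a (proj₁ degree)
        in a , ν≥-resp (sym (difference (begin
             x                               ≈⟨ *-identityˡ x ⟨
             1# * x                          ≈⟨ *-congʳ uw≈1 ⟨
             u * w * x                       ≈⟨ *-assoc u w x ⟩
             u * (w * x)                     ≈⟨ *-congˡ (+-cancel-difference (w * x) y) ⟩
             u * (y + (w * x - y))           ≈⟨ distribˡ u _ _ ⟩
             u * y + u * (w * x - y)         ≈⟨ +-congʳ (lin-scaleʳ a u _) ⟨
             lin a (λ i → u * proj₁ degree i) + u * (w * x - y) ∎)))
             (weaken (ℤₚ.≤-reflexive (ℤₚ.+-comm (+ 1) n)) (ν≥-* (exactly⇒≥ νu) r≥1))

      ord-span : ∀ N n → Σ (Vector Carrier (N ℕ.* e)) λ b →
                 ∀ x → ord≥ E P n x → ∃[ a ] ord≥ E P (n ℤ.+ + N) (x - lin a b)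
      ord-span zero    n = Vec.[] , λ x x≥n →
        Vec.[] , ν≥-resp (sym (difference (sym (+-identityˡ x)))) (weaken (ℤₚ.≤-reflexive (ℤₚ.+-identityʳ n)) x≥n)
      ord-span (suc N) n = b ++ b′ , λ x x≥n →
        let (a , p) = span-++ {V = ord≥ E P n} {ord≥ E P (ℤ.suc n)} (ord≥-subspace _) b b′
                        (proj₂ (graded-piece n)) (proj₂ (ord-span N (ℤ.suc n))) x x≥n
        in a , weaken (ℤₚ.≤-reflexive (≡.trans (≡.sym (ℤₚ.+-assoc n (+ 1) (+ N)))
                                               (cong (ℤ._+ + N) (ℤₚ.+-comm n (+ 1))))) p
        where
        b = proj₁ (graded-piece n)
        b′ = proj₁ (ord-span N (ℤ.suc n))

      ord-coordinates : ∀ N n → Coordinates (ord≥ E P n) (ord≥ E P (n ℤ.+ + N)) (N ℕ.* e)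
      ord-coordinates N n =
        spanning⇒coordinates (proj₁ (ord-span N n)) (ord≥-subspace _) (proj₂ (ord-span N n))

    -- At a place of degree 1 the graded piece is spanned by one element `y`. Since `f` has order
    -- exactly `n`, its coefficient at `y` is not zero, so `f` spans the piece as well.
    leading-coefficient : HasDegree E P 1 → ∀ {f n} → ν f ≡ [ n ] →
                          ∀ x → ord≥ E P n x → ∃[ a ] ord≥ E P (ℤ.suc n) (x - embed a * f)
    leading-coefficient degree {f} {n} νf≡n x x≥n = conclude (d zero K.≈? K.0#)
      where
      b = proj₁ (graded-piece degree n)
      span = proj₂ (graded-piece degree n)
      a = proj₁ (span x x≥n)
      x′ = proj₂ (span x x≥n)
      d = proj₁ (span f (exactly⇒≥ νf≡n))
      f′ = proj₂ (span f (exactly⇒≥ νf≡n))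
      y = b zero
      S = ord≥-subspace (ℤ.suc n)
      single : ∀ (a : Vector K.Carrier 1) → lin a b ≈ embed (a zero) * y
      single a = +-identityʳ _
      conclude : Dec (d zero K.≈ K.0#) → ∃[ a ] ord≥ E P (ℤ.suc n) (x - embed a * f)
      conclude (yes d≈0) = contradiction
        (≥⇒≤ νf≡n (IsSubspace.unsubtract S f′ (ν≥-resp (sym (lin-zero {a = d} b λ { zero → d≈0 })) (ν≥-0 _)))) 1+n≰n
      -- Relative to `y` the leading coefficients of `x` and `f` are `a zero` and `d zero`; their
      -- quotient is the constant.
      conclude (no d≉0) with u , du≈1 ← K.inverse (d zero) d≉0 = a zero K.* u ,
        IsSubspace.resp S (sym (difference (begin
          x
            ≈⟨ +-cancel-difference x (lin a b) ⟩
          lin a b + x-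
            ≈⟨ +-congʳ (single a) ⟩
          A * y + x-
            ≈⟨ +-congʳ (*-congʳ (*-identityʳ A)) ⟨
          A * 1# * y + x-
            ≈⟨ +-congʳ (*-congʳ (*-congˡ (trans (sym (hom.*-homo _ _)) (trans (hom.⟦⟧-cong du≈1) hom.1#-homo)))) ⟨
          A * (D * U) * y + x-
            ≈⟨ +-congʳ (solve 4 (λ A D U y → A :* (D :* U) :* y := (A :* U) :* (D :* y)) refl A D U y) ⟩
          A * U * (D * y) + x-
            ≈⟨ +-congˡ (trans (+-congˡ (-‿inverseˡ _)) (+-identityʳ x-)) ⟨
          A * U * (D * y) + (x- + (- (A * U * f-) + A * U * f-))
            ≈⟨ solve 5 (λ s r x n f → s :* r :+ (x :+ (n :+ s :* f)) := s :* (r :+ f) :+ (x :+ n)) refl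
                 (A * U) (D * y) x- (- (A * U * f-)) f- ⟩
          A * U * (D * y + f-) + (x- - A * U * f-)
            ≈⟨ +-congʳ (*-cong (sym (hom.*-homo _ _))
                 (trans (+-congʳ (sym (single d))) (sym (+-cancel-difference f (lin d b))))) ⟩
          embed (a zero K.* u) * f + (x- - A * U * f-) ∎)))
        (IsSubspace.-∈ S x′ (IsSubspace.resp S (*-congʳ (hom.*-homo _ _)) (IsSubspace.scale S (a zero K.* u) f′)))
        where
        A = embed (a zero)
        D = embed (d zero)
        U = embed u
        x- = x - lin a b
        f- = f - lin d b

    -- The first term has the strictly smallest value, so the others cannot cancel it; its
    -- coefficient is 0 and the rest follows by induction.
    distinct-values-independent :
      ∀ {n} (x : Vector Carrier n) (a : Vector ℤ n) → (∀ i → ν (x i) ≡ [ a i ]) →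
      (∀ i j → i Fin.< j → a i ℤ.< a j) → Independent (_≈ 0#) x
    distinct-values-independent {suc n} x a νx≡a increasing k lin≈0 = result
      where
      rest : Carrier
      rest = lin (k ∘ suc) (x ∘ suc)
      rest≥ : ord≥ E P (ℤ.suc (a zero)) rest
      rest≥ = IsSubspace.lin∈ (ord≥-subspace _) (k ∘ suc) (λ i →
        ≤⇒≥ (νx≡a (suc i)) (ℤₚ.i<j⇒suc[i]≤j (increasing zero (suc i) (s≤s z≤n))))
      k₀≈0 : k zero K.≈ K.0#
      k₀≈0 = decidable-stable (k zero K.≈? K.0#) λ k₀≉0 → 1+n≰n
        (≥⇒≤ (ν-scale k₀≉0 (νx≡a zero))
             (IsSubspace.resp (ord≥-subspace _) (difference (trans (sym lin≈0) (+-comm _ _)))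
                              (IsSubspace.-∈ (ord≥-subspace _) (ν≥-0 _) rest≥)))
      rest≈0 : rest ≈ 0#
      rest≈0 = trans (sym (trans (+-congʳ (trans (*-congʳ (trans (hom.⟦⟧-cong k₀≈0) hom.0#-homo)) (zeroˡ _)))
                                 (+-identityˡ rest))) lin≈0
      result : ∀ i → k i K.≈ K.0#
      result zero    = k₀≈0
      result (suc i) = distinct-values-independent (x ∘ suc) (a ∘ suc) (νx≡a ∘ suc)
                         (λ i j i<j → increasing (suc i) (suc j) (s≤s i<j)) (k ∘ suc) rest≈0 i

-- Riemann-Roch spaces

0≤+⇒-≤ : ∀ {x a} → [ + 0 ] ≤⁺ (x +∞ [ a ]) → [ ℤ.- a ] ≤⁺ x
0≤+⇒-≤ {[ n ]} {a} Sup.[ p ] =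
  Sup.[ subst₂ ℤ._≤_ (ℤₚ.+-identityˡ (ℤ.- a)) (cancel n a) (ℤₚ.+-monoˡ-≤ (ℤ.- a) p) ]
  where
  cancel : ∀ n a → n ℤ.+ a ℤ.- a ≡ n
  cancel = solve-∀
0≤+⇒-≤ {⊤⁺} _ = _ ≤⊤⁺

-≤⇒0≤+ : ∀ {x a} → [ ℤ.- a ] ≤⁺ x → [ + 0 ] ≤⁺ (x +∞ [ a ])
-≤⇒0≤+ {[ n ]} {a} Sup.[ p ] =
  Sup.[ ℤₚ.≤-trans (ℤₚ.≤-reflexive (≡.sym (ℤₚ.+-inverseˡ a))) (ℤₚ.+-monoˡ-≤ a p) ]
-≤⇒0≤+ {⊤⁺} _ = _ ≤⊤⁺

module Divisors {c ℓ} {K L : Field c ℓ} (E : Extension K L)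
                (q : ℕ) .{{_ : NonTrivial q}} (card : HasCardinality K q) where
  open Field L hiding (zero)
  open FieldLemmas L
  open LinComb E
  open Codimension E q card
  open PlaceLemmas E q card

  ≈ₚ-sym : ∀ {P Q} → _≈ₚ_ E P Q → _≈ₚ_ E Q P
  ≈ₚ-sym P≈Q f = ≡.sym (P≈Q f)

  ≈ₚ-trans : ∀ {P Q R} → _≈ₚ_ E P Q → _≈ₚ_ E Q R → _≈ₚ_ E P R
  ≈ₚ-trans P≈Q Q≈R f = ≡.trans (P≈Q f) (Q≈R f)

  ord≥-≈ₚ : ∀ {P Q n f} → _≈ₚ_ E P Q → ord≥ E P n f → ord≥ E Q n f
  ord≥-≈ₚ {f = f} P≈Q = subst (_ ≤⁺_) (P≈Q f)

  ord≥-weaken : ∀ P {m n f} → m ℤ.≤ n → ord≥ E P n f → ord≥ E P m f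
  ord≥-weaken P = ValuationLemmas.weaken (Place.valuation P)

  ord≥? : ∀ P n f → Dec (ord≥ E P n f)
  ord≥? P = ValuationLemmas.ν≥? (Place.valuation P)

  coefficient-unique : ∀ {P D a b} → HasCoefficient E P D a → HasCoefficient E P D b → a ≡ b
  coefficient-unique []              []              = ≡.refl
  coefficient-unique (same {n = n} _ h) (same _ h′)    = cong (λ a → n ℤ.+ a) (coefficient-unique h h′)
  coefficient-unique (skip _ h)      (skip _ h′)     = coefficient-unique h h′
  coefficient-unique (same P≈Q _)    (skip ¬P≈Q _)   = contradiction P≈Q ¬P≈Q
  coefficient-unique (skip ¬P≈Q _)   (same P≈Q _)    = contradiction P≈Q ¬P≈Q

  coefficient-≈ₚ : ∀ {P P′ D a} → _≈ₚ_ E P P′ → HasCoefficient E P D a → HasCoefficient E P′ D a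
  coefficient-≈ₚ {P} {P′} P≈P′ []                 = []
  coefficient-≈ₚ {P} {P′} P≈P′ (same {Q = Q} P≈Q h)  =
    same (≈ₚ-trans {P′} {P} {Q} (≈ₚ-sym {P} {P′} P≈P′) P≈Q) (coefficient-≈ₚ P≈P′ h)
  coefficient-≈ₚ {P} {P′} P≈P′ (skip {Q = Q} ¬P≈Q h) =
    skip (λ P′≈Q → ¬P≈Q (≈ₚ-trans {P} {P′} {Q} P≈P′ P′≈Q)) (coefficient-≈ₚ P≈P′ h)

  coefficient-exists : ∀ P D → ¬ ¬ (∃[ a ] HasCoefficient E P D a)
  coefficient-exists P List.[]            = return (+ 0 , [])
  coefficient-exists P ((n , Q) List.∷ D) = do
    P≈Q? ← ¬¬-excluded-middle {A = _≈ₚ_ E P Q}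
    (a , h) ← coefficient-exists P D
    return (extend P≈Q? h)
    where
    extend : ∀ {a} → Dec (_≈ₚ_ E P Q) → HasCoefficient E P D a → ∃[ b ] HasCoefficient E P ((n , Q) List.∷ D) b
    extend (yes P≈Q) h = _ , same P≈Q h
    extend (no ¬P≈Q) h = _ , skip ¬P≈Q h

  𝓛-subspace : ∀ D → IsSubspace (𝓛 E D)
  𝓛-subspace D = record
    { resp  = λ x≈y x∈𝓛 P a h → -≤⇒0≤+ (resp (S P a) x≈y (0≤+⇒-≤ (x∈𝓛 P a h)))
    ; zero∈ = λ P a h → -≤⇒0≤+ (zero∈ (S P a))
    ; +∈    = λ x∈𝓛 y∈𝓛 P a h → -≤⇒0≤+ (+∈ (S P a) (0≤+⇒-≤ (x∈𝓛 P a h)) (0≤+⇒-≤ (y∈𝓛 P a h)))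
    ; scale = λ k x∈𝓛 P a h → -≤⇒0≤+ (scale (S P a) k (0≤+⇒-≤ (x∈𝓛 P a h)))
    }
    where
    open IsSubspace
    S : ∀ P a → IsSubspace (ord≥ E P (ℤ.- a))
    S P a = ord≥-subspace P (ℤ.- a)

  ≈0-subspace : IsSubspace (_≈ 0#)
  ≈0-subspace = record
    { resp  = λ x≈y x≈0 → trans (sym x≈y) x≈0
    ; zero∈ = refl
    ; +∈    = λ x≈0 y≈0 → trans (+-cong x≈0 y≈0) (+-identityʳ 0#)
    ; scale = λ k x≈0 → trans (*-congˡ x≈0) (zeroʳ _)
    }

  module _ (P : Place E) (degree : HasDegree E P 1) where
    open Place P
    open ValuationLemmas valuation

    𝓛-∷⁺ : ∀ {n D} → + 0 ℤ.≤ n → 𝓛 E D ⊆ 𝓛 E ((n , P) List.∷ D)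
    𝓛-∷⁺ 0≤n f∈𝓛 Q _ (same _ h) = -≤⇒0≤+ (ord≥-weaken Q
      (ℤₚ.≤-trans (ℤₚ.neg-mono-≤ (ℤₚ.≤-trans (ℤₚ.≤-reflexive (≡.sym (ℤₚ.+-identityˡ _)))
                                                (ℤₚ.+-monoˡ-≤ _ 0≤n))) ℤₚ.≤-refl)
      (0≤+⇒-≤ (f∈𝓛 Q _ h)))
    𝓛-∷⁺ 0≤n f∈𝓛 Q a (skip _ h) = f∈𝓛 Q a h

    -- The two divisors differ at places equal to `P` only. Whether a place equals `P` is asked
    -- classically, which is harmless because the bound on the order to be shown is decidable.
    𝓛-∷⁻ : ∀ {n D a f} → HasCoefficient E P D a → ord≥ E P (ℤ.- a) f →
           𝓛 E ((n , P) List.∷ D) f → 𝓛 E D f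
    𝓛-∷⁻ {n} {D} {a} {f} h f≥ f∈𝓛 Q b h′ = -≤⇒0≤+ (decidable-stable (ord≥? Q (ℤ.- b) f)
      (¬¬-excluded-middle {A = _≈ₚ_ E Q P} >>= λ where
        (yes Q≈P) → return (ord≥-≈ₚ {P} {Q} (≈ₚ-sym {Q} {P} Q≈P)
          (subst (λ b → ord≥ E P (ℤ.- b) f) (coefficient-unique h (coefficient-≈ₚ Q≈P h′)) f≥))
        (no ¬Q≈P) → return (0≤+⇒-≤ (f∈𝓛 Q b (skip ¬Q≈P h′)))))

    -- Adding a place of degree 1 relaxes a single linear condition. Inside the larger space
    -- membership in `𝓛 E D` is decided by the order at `P`.
    codim-𝓛-∷ : ∀ D → ¬ ¬ (∃[ m ] m ℕ.≤ 1 × HasCodim E (𝓛 E ((+ 1 , P) List.∷ D)) (𝓛 E D) m)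
    codim-𝓛-∷ D = do
      (a , h) ← coefficient-exists P D
      codim-exists (𝓛-subspace D₁) (𝓛-subspace D)
        (λ x x∈𝓛 → map′ (λ x≥ → 𝓛-∷⁻ h x≥ x∈𝓛) (λ x∈𝓛′ → 0≤+⇒-≤ (x∈𝓛′ P a h)) (ν≥? (ℤ.- a) x))
        (coordinates-map (𝓛-subspace D₁) (λ x∈𝓛 → 0≤+⇒-≤ (x∈𝓛 P _ (same (λ _ → ≡.refl) h)))
          (λ x∈𝓛 x≥ → 𝓛-∷⁻ h (weaken (ℤₚ.≤-reflexive (lemma a)) x≥) x∈𝓛)
          (ord-coordinates P degree 1 (ℤ.- (+ 1 ℤ.+ a))))
      where
      D₁ = (+ 1 , P) List.∷ D
      lemma : ∀ a → ℤ.- a ≡ ℤ.- (+ 1 ℤ.+ a) ℤ.+ + 1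
      lemma = solve-∀

    -- Multiplying by the powers of such an f would make 𝓛 (D + P) infinite
    -- dimensional, where D is a divisor at which the genus is attained.
    regular-with-zero⇒zero : ∀ {g} → IsGenus E g →
      ∀ {f} → (∀ Q → ord≥ E Q (+ 0) f) → ord≥ E P (+ 1) f → f ≈ 0#
    regular-with-zero⇒zero {g} genus {f} regular f≥1 = decidable-stable (zero? f) impossible
      where
      open IsGenus genus
      D = proj₁ attained
      d = proj₁ (proj₂ attained)
      n = proj₁ (proj₂ (proj₂ attained))
      degree-D = proj₁ (proj₂ (proj₂ (proj₂ attained)))
      dim-D = proj₁ (proj₂ (proj₂ (proj₂ (proj₂ attained))))
      g-attained = proj₂ (proj₂ (proj₂ (proj₂ (proj₂ attained))))
      D₁ = (+ 1 , P) List.∷ D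

      -- If the codimension `m` were 0, then `D₁` would have the dimension of `D` and a degree
      -- larger by 1, so deg + 1 - ℓ would be g + 1 for `D₁`.
      positive : ∀ m → HasDim E (𝓛 E D₁) (m ℕ.+ n) → 1 ℕ.≤ m ℕ.+ n
      positive (suc m) _   = s≤s z≤n
      positive zero    dim = contradiction
        (subst₂ ℤ._≤_ (shape d (+ n)) (≡.sym g-attained) (bound D₁ _ n (degree ∷ degree-D) dim)) 1+n≰n
        where
        shape : ∀ d n → + 1 ℤ.* + 1 ℤ.+ d ℤ.+ + 1 ℤ.- n ≡ + 1 ℤ.+ (d ℤ.+ + 1 ℤ.- n)
        shape = solve-∀

      infinite-dimensional : ¬ f ≈ 0# → ∀ {m} → 1 ℕ.≤ m → ¬ HasDim E (𝓛 E D₁) m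
      infinite-dimensional f≉0 {suc m} _ dim@(b , isBasis) =
        ℕₚ.1+n≰n (independent≤ (basis-coordinates ≈0-subspace dim) powers∈𝓛
          (distinct-values-independent P powers values (λ t → ≡.trans
             (ν-*-exactly νh (ν-^ (toℕ t) νf)) ≡.refl) increasing))
        where
        open IsBasisMod isBasis
        h = b zero
        h≉0 : ¬ h ≈ 0#
        h≉0 = independent-head∉ {b = b} ≈0-subspace independent
        νh = proj₂ (finite h≉0)
        νf = proj₂ (finite f≉0)
        powers : Vector Carrier (suc (suc m))
        powers t = h * f ^ toℕ t
        values : Vector ℤ (suc (suc m))
        values t = proj₁ (finite h≉0) ℤ.+ + toℕ t ℤ.* proj₁ (finite f≉0)
        powers∈𝓛 : ∀ t → 𝓛 E D₁ (powers t)
        powers∈𝓛 t Q a h∈ = -≤⇒0≤+ (ord≥-weaken Q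
          (ℤₚ.≤-reflexive (≡.sym (≡.trans (cong (λ k → ℤ.- a ℤ.+ k) (ℤₚ.*-zeroʳ (+ toℕ t))) (ℤₚ.+-identityʳ (ℤ.- a)))))
          (ValuationLemmas.ν≥-* (Place.valuation Q) (0≤+⇒-≤ (inside zero Q a h∈))
             (ValuationLemmas.ν≥-^ (Place.valuation Q) (toℕ t) (regular Q))))
        increasing : ∀ i j → i Fin.< j → values i ℤ.< values j
        increasing i j i<j = ℤₚ.+-monoʳ-< (proj₁ (finite h≉0))
          (ℤₚ.*-monoʳ-<-pos (proj₁ (finite f≉0)) {{ℤ.positive (ℤₚ.<-≤-trans (ℤ.+<+ (s≤s z≤n)) (≥⇒≤ νf f≥1))}} (ℤ.+<+ i<j))

      impossible : ¬ ¬ f ≈ 0#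
      impossible f≉0 = codim-𝓛-∷ D λ (m , _ , codim) →
        let dim = codim-+ (𝓛-subspace D) ≈0-subspace (𝓛-∷⁺ (ℤ.+≤+ z≤n))
                    (IsSubspace.≈0⊆ (𝓛-subspace D))
                    codim dim-D
        in infinite-dimensional f≉0 (positive m dim) dim

module Family {c ℓ} {K L : Field c ℓ} (E : Extension K L)
              (q : ℕ) .{{_ : NonTrivial q}} (card : HasCardinality K q)
              {n : ℕ} (Q : Vector (Place E) n) (distinct : ∀ i j → ¬ i ≡ j → ¬ _≈ₚ_ E (Q i) (Q j)) where
  open Field L hiding (zero)
  open LinComb E
  open Codimension E q card
  open PlaceLemmas E q card
  open Divisors E q card

  -- The Riemann-Roch space of the divisor - ∑ kᵢ Qᵢ: note the sign, k bounds the
  -- valuations from below.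
  record H (k : Vector ℤ n) (f : Carrier) : Set (c ⊔ ℓ) where
    constructor mkH
    field
      at        : ∀ i → ord≥ E (Q i) (k i) f
      elsewhere : ∀ R → (∀ i → ¬ _≈ₚ_ E R (Q i)) → ord≥ E R (+ 0) f
  open H public

  H-subspace : ∀ k → IsSubspace (H k)
  H-subspace k = record
    { resp  = λ x≈y x∈H → mkH (λ i → resp (S i) x≈y (at x∈H i))
                              (λ R R∉Q → resp (ord≥-subspace R _) x≈y (elsewhere x∈H R R∉Q))
    ; zero∈ = mkH (λ i → zero∈ (S i)) (λ R _ → zero∈ (ord≥-subspace R _))
    ; +∈    = λ x∈H y∈H → mkH (λ i → +∈ (S i) (at x∈H i) (at y∈H i))
                              (λ R R∉Q → +∈ (ord≥-subspace R _) (elsewhere x∈H R R∉Q) (elsewhere y∈H R R∉Q))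
    ; scale = λ a x∈H → mkH (λ i → scale (S i) a (at x∈H i))
                            (λ R R∉Q → scale (ord≥-subspace R _) a (elsewhere x∈H R R∉Q))
    }
    where
    open IsSubspace
    S : ∀ i → IsSubspace (ord≥ E (Q i) (k i))
    S i = ord≥-subspace (Q i) (k i)

  H-mono : ∀ {k k′} → (∀ i → k′ i ℤ.≤ k i) → H k ⊆ H k′
  H-mono k′≤k x∈H = mkH (λ i → ord≥-weaken (Q i) (k′≤k i) (at x∈H i)) (elsewhere x∈H)

  H-* : ∀ {k k′ x y} → H k x → H k′ y → H (λ i → k i ℤ.+ k′ i) (x * y)
  H-* x∈H y∈H = mkH (λ i → ValuationLemmas.ν≥-* (Place.valuation (Q i)) (at x∈H i) (at y∈H i))
    (λ R R∉Q → ValuationLemmas.ν≥-* (Place.valuation R) (elsewhere x∈H R R∉Q) (elsewhere y∈H R R∉Q))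

  H-^ : ∀ {k x} t → H k x → H (λ i → + t ℤ.* k i) (x ^ t)
  H-^ t x∈H = mkH (λ i → ValuationLemmas.ν≥-^ (Place.valuation (Q i)) t (at x∈H i))
    (λ R R∉Q → ord≥-weaken R (ℤₚ.≤-reflexive (≡.sym (ℤₚ.*-zeroʳ (+ t))))
                  (ValuationLemmas.ν≥-^ (Place.valuation R) t (elsewhere x∈H R R∉Q)))

  -- Inside `H k` only the finitely many `Q i` remain to be tested; this is the decidability that
  -- `codim-exists` asks for.
  H? : ∀ {k} k′ x → H k x → Dec (H k′ x)
  H? k′ x x∈H = map′ (λ x≥ → mkH x≥ (elsewhere x∈H)) at (Finₚ.all? (λ i → ord≥? (Q i) (k′ i) x))

  -- A place is classically one of the Q i or none of them.
  H-regular : ∀ {f} → H (λ _ → + 0) f → ∀ R → ord≥ E R (+ 0) f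
  H-regular {f} f∈H R = decidable-stable (ord≥? R (+ 0) f)
    (¬¬-excluded-middle {A = ∃[ i ] _≈ₚ_ E R (Q i)} >>= λ where
      (yes (i , R≈Qᵢ)) → return (ord≥-≈ₚ {Q i} {R} (≈ₚ-sym {R} {Q i} R≈Qᵢ) (at f∈H i))
      (no  R∉Q)        → return (elsewhere f∈H R (λ i R≈Qᵢ → R∉Q (i , R≈Qᵢ))))

module _ {c ℓ} {K L : Field c ℓ} (E : Extension K L)
         (q : ℕ) .{{_ : NonTrivial q}} (card : HasCardinality K q) where
  open Divisors E q card

  coefficient-none : ∀ {n R} (Q : Vector (Place E) n) (a : Vector ℤ n) → (∀ i → ¬ _≈ₚ_ E R (Q i)) →
                     HasCoefficient E R (tabulate (λ i → (a i , Q i))) (+ 0)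
  coefficient-none {zero}  Q a R∉Q = []
  coefficient-none {suc n} Q a R∉Q = skip (R∉Q zero) (coefficient-none (Q ∘ suc) (a ∘ suc) (R∉Q ∘ suc))

  coefficient-at : ∀ {n} (Q : Vector (Place E) n) (a : Vector ℤ n) →
                   (∀ i j → ¬ i ≡ j → ¬ _≈ₚ_ E (Q i) (Q j)) →
                   ∀ i → HasCoefficient E (Q i) (tabulate (λ i → (a i , Q i))) (a i)
  coefficient-at {suc n} Q a distinct zero = subst (HasCoefficient E (Q zero) _) (ℤₚ.+-identityʳ (a zero))
    (same (λ _ → ≡.refl) (coefficient-none (Q ∘ suc) (a ∘ suc) (λ i → distinct zero (suc i) (λ ()))))
  coefficient-at {suc n} Q a distinct (suc i) = skip (distinct (suc i) zero (λ ()))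
    (coefficient-at (Q ∘ suc) (a ∘ suc) (λ i j i≢j → distinct (suc i) (suc j) (i≢j ∘ Finₚ.suc-injective)) i)

  coefficient-cases : ∀ {n R b} (Q : Vector (Place E) n) (a : Vector ℤ n) →
                      (∀ i j → ¬ i ≡ j → ¬ _≈ₚ_ E (Q i) (Q j)) →
                      HasCoefficient E R (tabulate (λ i → (a i , Q i))) b →
                      (∃[ i ] _≈ₚ_ E R (Q i) × b ≡ a i) ⊎ ((∀ i → ¬ _≈ₚ_ E R (Q i)) × b ≡ + 0)
  coefficient-cases {zero} Q a distinct [] = inj₂ ((λ ()) , ≡.refl)
  coefficient-cases {suc n} {R} Q a distinct (same R≈Q₀ h) = inj₁ (zero , R≈Q₀ , ≡.trans
    (cong (λ b → a zero ℤ.+ b) (coefficient-unique h (coefficient-none (Q ∘ suc) (a ∘ suc) λ i R≈Qᵢ →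
      distinct zero (suc i) (λ ()) (≈ₚ-trans {Q zero} {R} {Q (suc i)} (≈ₚ-sym {R} {Q zero} R≈Q₀) R≈Qᵢ))))
    (ℤₚ.+-identityʳ (a zero)))
  coefficient-cases {suc n} Q a distinct (skip ¬R≈Q₀ h)
    with coefficient-cases (Q ∘ suc) (a ∘ suc) (λ i j i≢j → distinct (suc i) (suc j) (i≢j ∘ Finₚ.suc-injective)) h
  ... | inj₁ (i , R≈Qᵢ , eq) = inj₁ (suc i , R≈Qᵢ , eq)
  ... | inj₂ (R∉Q , eq)      = inj₂ ((λ { zero → ¬R≈Q₀ ; (suc i) → R∉Q i }) , eq)

  divisor-degree : ∀ {n} (Q : Vector (Place E) n) (e m : Vector ℕ n) → (∀ i → HasDegree E (Q i) (e i)) →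
                   HasDivisorDegree E (tabulate (λ i → (+ m i , Q i))) (+ sumℕ (λ i → m i ℕ.* e i))
  divisor-degree {zero}  Q e m degree = []
  divisor-degree {suc n} Q e m degree = subst (HasDivisorDegree E _)
    (cong (λ a → a ℤ.+ + sumℕ (λ i → m (suc i) ℕ.* e (suc i))) (≡.sym (ℤₚ.pos-* (m zero) (e zero))))
    (degree zero ∷ divisor-degree (Q ∘ suc) (e ∘ suc) (m ∘ suc) (degree ∘ suc))

module RiemannRoch {c ℓ} {K L : Field c ℓ} (E : Extension K L)
                   (q : ℕ) .{{_ : NonTrivial q}} (card : HasCardinality K q)
                   {n : ℕ} (Q : Vector (Place E) n) (distinct : ∀ i j → ¬ i ≡ j → ¬ _≈ₚ_ E (Q i) (Q j)) where
  open LinComb E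
  open Codimension E q card
  open PlaceLemmas E q card
  open Divisors E q card
  open Family E q card Q distinct public

  𝓛⇒H : ∀ {a f} → 𝓛 E (tabulate (λ i → (a i , Q i))) f → H (λ i → ℤ.- a i) f
  𝓛⇒H {a} f∈𝓛 = mkH
    (λ i → 0≤+⇒-≤ (f∈𝓛 (Q i) (a i) (coefficient-at E q card Q a distinct i)))
    (λ R R∉Q → 0≤+⇒-≤ (f∈𝓛 R (+ 0) (coefficient-none E q card Q a R∉Q)))

  H⇒𝓛 : ∀ {a f} → H (λ i → ℤ.- a i) f → 𝓛 E (tabulate (λ i → (a i , Q i))) f
  H⇒𝓛 {a} {f} f∈H R b h with coefficient-cases E q card Q a distinct h
  ... | inj₁ (i , R≈Qᵢ , ≡.refl) = -≤⇒0≤+ (ord≥-≈ₚ {Q i} {R} (≈ₚ-sym {R} {Q i} R≈Qᵢ) (at f∈H i))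
  ... | inj₂ (R∉Q , ≡.refl)      = -≤⇒0≤+ (elsewhere f∈H R R∉Q)

  module _ (e : Vector ℕ n) (degree : ∀ i → HasDegree E (Q i) (e i)) where

    -- The genus bound for the divisor ∑ mᵢ Qᵢ, rearranged so that no subtraction occurs.
    riemann : ∀ {g} → IsGenus E g → ∀ (m : Vector ℕ n) {d} → HasDim E (H (λ i → ℤ.- + m i)) d →
              sumℕ (λ i → m i ℕ.* e i) ℕ.+ 1 ℕ.≤ g ℕ.+ d
    riemann {g} genus m {d} (b , isBasis) = ℤₚ.drop‿+≤+
      (subst (ℤ._≤ + (g ℕ.+ d)) (cancel (+ (sumℕ (λ i → m i ℕ.* e i) ℕ.+ 1)) (+ d))
        (ℤₚ.+-monoˡ-≤ (+ d) (IsGenus.bound genus _ (+ sumℕ (λ i → m i ℕ.* e i)) d (divisor-degree E q card Q e m degree)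
          (b , record { inside = H⇒𝓛 ∘ inside ; spanning = λ x x∈𝓛 → spanning x (𝓛⇒H x∈𝓛) ; independent = independent }))))
      where
      open IsBasisMod isBasis
      cancel : ∀ a d → a ℤ.- d ℤ.+ d ≡ a
      cancel = solve-∀

    -- Raising the order at `Q i` by `N i` costs at most `N i * e i` conditions, and the places are
    -- treated independently.
    H-coordinates : ∀ {k k′} (N : Vector ℕ n) → (∀ i → k i ℤ.+ + N i ≡ k′ i) →
                    Coordinates (H k) (H k′) (sumℕ (λ i → N i ℕ.* e i))
    H-coordinates {k} {k′} N eq = coordinates-map (H-subspace k) (λ x∈H → x∈H) (λ x∈H x≥ → mkH x≥ (elsewhere x∈H))
      (coordinates-⋂ λ i → coordinates-map (H-subspace k) (λ x∈H → at x∈H i)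
        (λ {x} _ → subst (λ k → ord≥ E (Q i) k x) (eq i)) (ord-coordinates (Q i) (degree i) (N i) (k i)))

    H-codim : ∀ {k k′} (N : Vector ℕ n) → (∀ i → k i ℤ.+ + N i ≡ k′ i) →
              ¬ ¬ (∃[ m ] m ℕ.≤ sumℕ (λ i → N i ℕ.* e i) × HasCodim E (H k) (H k′) m)
    H-codim {k} {k′} N eq = codim-exists (H-subspace k) (H-subspace k′) (λ x → H? k′ x) (H-coordinates N eq)

-- Pole orders at P∞ and approximation at the other places

module Approximation
  {c ℓ} {K F : Field c ℓ} (E : Extension K F) (q : ℕ) .{{_ : NonTrivial q}} (card : HasCardinality K q)
  {g : ℕ} (genus : IsGenus E g) {s : ℕ} (P∞ : Place E) (P : Vector (Place E) s)
  (P∞∉P : ∀ i → ¬ _≈ₚ_ E P∞ (P i)) (P-distinct : ∀ i j → ¬ i ≡ j → ¬ _≈ₚ_ E (P i) (P j))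
  (degree∞ : HasDegree E P∞ 1) (e : Vector ℕ s) (degree : ∀ i → HasDegree E (P i) (e i)) where

  private module K where
    open Field K public hiding (zero)
    open FieldLemmas K public
    open FiniteField K q card public
  open Field F hiding (zero)
  open FieldLemmas F
  open Extension E
  open LinComb E
  open Codimension E q card
  open PlaceLemmas E q card
  open Divisors E q card

  places : Vector (Place E) (suc s)
  places = P∞ Vec.∷ P

  places-distinct : ∀ i j → ¬ i ≡ j → ¬ _≈ₚ_ E (places i) (places j)
  places-distinct zero    zero    0≢0 = contradiction ≡.refl 0≢0
  places-distinct zero    (suc j) _   = P∞∉P j
  places-distinct (suc i) zero    _   = λ Pᵢ≈P∞ → P∞∉P i (≈ₚ-sym {P i} {P∞} Pᵢ≈P∞)
  places-distinct (suc i) (suc j) i≢j = P-distinct i j (i≢j ∘ cong suc)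

  degrees : ∀ i → HasDegree E (places i) ((1 Vec.∷ e) i)
  degrees zero    = degree∞
  degrees (suc i) = degree i

  open RiemannRoch E q card places places-distinct public
  open Place P∞ using () renaming (ν to ν∞; valuation to valuation∞) public
  private module V∞ = ValuationLemmas valuation∞

  ∷-mono : ∀ {a b} {k k′ : Vector ℤ s} → a ℤ.≤ b → (∀ i → k i ℤ.≤ k′ i) →
           ∀ i → (a Vec.∷ k) i ℤ.≤ (b Vec.∷ k′) i
  ∷-mono a≤b k≤k′ zero    = a≤b
  ∷-mono a≤b k≤k′ (suc i) = k≤k′ i

  -- pole N is the lower bound for ν∞ that says "pole order less than N".
  pole : ℕ → ℤ
  pole zero    = + 1
  pole (suc N) = ℤ.- + N

  suc-pole : ∀ N → ℤ.suc (pole (suc N)) ≡ pole N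
  suc-pole zero          = ≡.refl
  suc-pole (suc zero)    = ≡.refl
  suc-pole (suc (suc N)) = ≡.refl

  weight : Vector ℕ s → ℕ
  weight k = sumℕ (λ i → k i ℕ.* e i)

  zero-at-∞ : ∀ {k : Vector ℤ s} {f} → (∀ i → + 0 ℤ.≤ k i) → H (+ 1 Vec.∷ k) f → f ≈ 0#
  zero-at-∞ 0≤k f∈H = regular-with-zero⇒zero P∞ degree∞ genus
    (H-regular (H-mono (λ { zero → ℤ.+≤+ z≤n ; (suc i) → 0≤k i }) f∈H)) (at f∈H zero)

  -- For `k = 0` this is the Weierstrass semigroup of `P∞`. For other `k` it is closed under adding
  -- elements of that semigroup, by multiplying functions.
  NonGap : Vector ℤ s → ℕ → Set _
  NonGap k j = ∃[ f ] H (ℤ.- + j Vec.∷ k) f × ν∞ f ≡ [ ℤ.- + j ]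

  next-pole : ∀ {k N x} → H (ℤ.- + N Vec.∷ k) x → ord≥ E P∞ (ℤ.suc (ℤ.- + N)) x → H (pole N Vec.∷ k) x
  next-pole {N = N} x∈H x≥ = mkH
    (λ { zero → ord≥-weaken P∞ (ℤₚ.≤-reflexive (≡.sym (suc-pole N))) x≥ ; (suc i) → at x∈H (suc i) })
    (elsewhere x∈H)

  previous-pole : ∀ {k} N → H (pole N Vec.∷ k) ⊆ H (ℤ.- + N Vec.∷ k)
  previous-pole N = H-mono (∷-mono (ℤₚ.≤-trans (ℤₚ.i≤suc[i] (ℤ.- + N)) (ℤₚ.≤-reflexive (suc-pole N))) (λ _ → ℤₚ.≤-refl))

  eliminate-pole : ∀ {k N f x} → ν∞ f ≡ [ ℤ.- + N ] → H (ℤ.- + N Vec.∷ k) f → H (ℤ.- + N Vec.∷ k) x →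
                   ∃[ a ] H (pole N Vec.∷ k) (x - embed a * f)
  eliminate-pole {k} {N} νf f∈H x∈H =
    let (a , x-af≥) = leading-coefficient P∞ degree∞ νf _ (at x∈H zero)
    in a , next-pole {N = N} (-∈ x∈H (scale a f∈H)) x-af≥
    where open IsSubspace (H-subspace (ℤ.- + N Vec.∷ k))

  codim-nongap : ∀ {k N} → NonGap k N → HasCodim E (H (ℤ.- + N Vec.∷ k)) (H (pole N Vec.∷ k)) 1
  codim-nongap {k} {N} (f , f∈H , νf) = (λ _ → f) , record
    { inside      = λ _ → f∈H
    ; spanning    = λ x x∈H → let (a , y∈H) = eliminate-pole νf f∈H x∈H in
                    (λ _ → a) , IsSubspace.resp (H-subspace _) (+-congˡ (-‿cong (sym (+-identityʳ _)))) y∈H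
    ; independent = λ { a af∈H zero → decidable-stable (a zero K.≈? K.0#) λ a≉0 → 1+n≰n
        (V∞.≥⇒≤ (ν-scale P∞ a≉0 νf)
           (V∞.ν≥-resp (+-identityʳ _) (ord≥-weaken P∞ (ℤₚ.≤-reflexive (suc-pole N)) (at af∈H zero)))) }
    }

  dim-by-nongaps : ∀ (k : Vector ℕ s) N → let H-k = λ a → H (a Vec.∷ (+_ ∘ k)) in
    ¬ ¬ (∃[ p ] HasDim E (H-k (pole N)) p × (Σ (Fin p → ℕ) λ a →
         Injective _≡_ _≡_ a × (∀ i → a i ℕ.< N) × (∀ i → NonGap (+_ ∘ k) (a i))))
  dim-by-nongaps k zero = return (0 , (Vec.[] , record
    { inside      = λ ()
    ; spanning    = λ x x∈H → Vec.[] , difference (trans (zero-at-∞ (λ _ → ℤ.+≤+ z≤n) x∈H) (sym (+-identityˡ 0#)))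
    ; independent = λ _ _ () }) , (λ ()) , (λ { {()} }) , (λ ()) , (λ ()))
  dim-by-nongaps k (suc N) = do
    (p , dim , a , a-injective , a<N , nongap) ← dim-by-nongaps k N
    N? ← ¬¬-excluded-middle {A = NonGap (+_ ∘ k) N}
    return (extend N? p dim a a-injective a<N nongap)
    where
    extend : Dec (NonGap (+_ ∘ k) N) → ∀ p → HasDim E (H (pole N Vec.∷ (+_ ∘ k))) p → (a : Fin p → ℕ) →
             Injective _≡_ _≡_ a → (∀ i → a i ℕ.< N) → (∀ i → NonGap (+_ ∘ k) (a i)) →
             ∃[ p ] HasDim E (H (ℤ.- + N Vec.∷ (+_ ∘ k))) p × (Σ (Fin p → ℕ) λ a →
             Injective _≡_ _≡_ a × (∀ i → a i ℕ.< suc N) × (∀ i → NonGap (+_ ∘ k) (a i)))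
    extend (yes N-nongap) p dim a a-injective a<N nongap =
      suc p
      , codim-+ (H-subspace _) ≈0-subspace (previous-pole N)
          (IsSubspace.≈0⊆ (H-subspace _))
          (codim-nongap N-nongap) dim
      , N Vec.∷ a
      , (λ { {zero} {zero} _ → ≡.refl
           ; {zero} {suc j} N≡aj → contradiction (≡.sym N≡aj) (ℕₚ.<⇒≢ (a<N j))
           ; {suc i} {zero} ai≡N → contradiction ai≡N (ℕₚ.<⇒≢ (a<N i))
           ; {suc i} {suc j} eq → cong suc (a-injective eq) })
      , (λ { zero → ℕₚ.≤-refl ; (suc i) → ℕₚ.m<n⇒m<1+n (a<N i) })
      , (λ { zero → N-nongap ; (suc i) → nongap i })
    extend (no N-gap) p (b , isBasis) a a-injective a<N nongap = p , (b , record
        { inside = previous-pole N ∘ inside ; spanning = λ x x∈H → spanning x (skip-gap x x∈H) ; independent = independent })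
      , a , a-injective , ℕₚ.m<n⇒m<1+n ∘ a<N , nongap
      where
      open IsBasisMod isBasis
      skip-gap : ∀ x → H (ℤ.- + N Vec.∷ (+_ ∘ k)) x → H (pole N Vec.∷ (+_ ∘ k)) x
      skip-gap x x∈H = next-pole {N = N} x∈H (decidable-stable (ord≥? P∞ _ x) λ ¬x≥ →
        N-gap (x , x∈H , V∞.not-greater⇒exactly (at x∈H zero) ¬x≥))

  riemann∞ : ∀ N (m : Vector ℕ s) {d} → HasDim E (H (ℤ.- + N Vec.∷ λ i → ℤ.- + m i)) d →
             N ℕ.+ weight m ℕ.+ 1 ℕ.≤ g ℕ.+ d
  riemann∞ N m {d} (b , isBasis) = subst (λ N → N ℕ.+ weight m ℕ.+ 1 ℕ.≤ g ℕ.+ d) (ℕₚ.*-identityʳ N)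
    (riemann (1 Vec.∷ e) degrees genus (N Vec.∷ m) (b , record
      { inside      = H-mono (λ { zero → ℤₚ.≤-refl ; (suc i) → ℤₚ.≤-refl }) ∘ inside
      ; spanning    = λ x x∈H → spanning x (H-mono (λ { zero → ℤₚ.≤-refl ; (suc i) → ℤₚ.≤-refl }) x∈H)
      ; independent = independent }))
    where open IsBasisMod isBasis

  codim-between : ∀ a {k k′ : Vector ℤ s} (N : Vector ℕ s) → (∀ i → k i ℤ.+ + N i ≡ k′ i) →
                  ¬ ¬ (∃[ m ] m ℕ.≤ weight N × HasCodim E (H (a Vec.∷ k)) (H (a Vec.∷ k′)) m)
  codim-between a N eq = H-codim (1 Vec.∷ e) degrees (0 Vec.∷ N) λ where
    zero    → ℤₚ.+-identityʳ a
    (suc i) → eq i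

  weight-zero : weight (λ _ → 0) ≡ 0
  weight-zero = ℕΣ.sum-replicate-zero s

  weight-* : ∀ t κ → weight (λ i → t ℕ.* κ i) ≡ t ℕ.* weight κ
  weight-* t κ = ≡.trans (ℕΣ.sum-cong-≗ {s} (λ i → ℕₚ.*-assoc t (κ i) (e i)))
                         (≡.sym (ℕΣ.*-distribˡ-sum t (λ i → κ i ℕ.* e i)))

  weight-∸ : ∀ {k κ} → (∀ i → k i ℕ.≤ κ i) → weight k ℕ.+ weight (λ i → κ i ℕ.∸ k i) ≡ weight κ
  weight-∸ {k} {κ} k≤κ = ≡.trans (≡.sym (ℕΣ.∑-distrib-+ (λ i → k i ℕ.* e i) _))
    (ℕΣ.sum-cong-≗ {s} λ i → ≡.trans (≡.sym (ℕₚ.*-distribʳ-+ (e i) (k i) (κ i ℕ.∸ k i)))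
                                     (cong (ℕ._* e i) (ℕₚ.m+[n∸m]≡n (k≤κ i))))

  -- Riemann's inequality at N = g + weight k leaves room for such an h.
  nonzero-multiple : ∀ k → ¬ ¬ (∃[ N ] ∃[ h ] ¬ h ≈ 0# × H (ℤ.- + N Vec.∷ (+_ ∘ k)) h)
  nonzero-multiple k = do
    (p , dim , _) ← dim-by-nongaps k (suc N)
    (m , m≤ , codim) ← codim-between (ℤ.- + N) {λ _ → + 0} {+_ ∘ k} k (λ i → ℤₚ.+-identityˡ (+ k i))
    return (N , nonzero p dim (positive p m m≤ (riemann∞ N (λ _ → 0)
      (codim-+ (H-subspace _) ≈0-subspace
        (H-mono (∷-mono ℤₚ.≤-refl (λ _ → ℤ.+≤+ z≤n)))
        (IsSubspace.≈0⊆ (H-subspace _)) codim dim))))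
    where
    -- By Riemann's inequality the functions with poles at most `N` at `P∞` form a space of
    -- dimension at least `weight k + 1`, while vanishing to the orders `k` costs at most
    -- `weight k`.
    N = g ℕ.+ weight k
    positive : ∀ p m → m ℕ.≤ weight k → N ℕ.+ weight (λ _ → 0) ℕ.+ 1 ℕ.≤ g ℕ.+ (m ℕ.+ p) → 0 ℕ.< p
    positive zero m m≤ le = contradiction (ℕₚ.≤-trans le (ℕₚ.+-monoʳ-≤ g (ℕₚ.+-monoˡ-≤ 0 m≤)))
      (ℕₚ.<⇒≱ (subst₂ ℕ._<_ (≡.trans (ℕₚ.+-assoc g _ 0) ≡.refl) (≡.sym (ℕₚ.+-assoc N (weight λ _ → 0) 1))
        (ℕₚ.+-monoʳ-< N (ℕₚ.≤-trans (s≤s z≤n) (ℕₚ.m≤n+m 1 (weight λ _ → 0))))))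
    positive (suc p) _ _ _ = s≤s z≤n
    nonzero : ∀ p → HasDim E (H (ℤ.- + N Vec.∷ (+_ ∘ k))) p → 0 ℕ.< p →
              ∃[ h ] ¬ h ≈ 0# × H (ℤ.- + N Vec.∷ (+_ ∘ k)) h
    nonzero (suc p) (b , isBasis) _ =
      b zero , independent-head∉ {b = b} ≈0-subspace independent , inside zero
      where open IsBasisMod isBasis

  module _ {N h} (κ : Vector ℕ s) (h∈H : H (ℤ.- + N Vec.∷ (+_ ∘ κ)) h)
           (νh : ∀ i → Place.ν (P i) h ≡ [ + κ i ]) where
    private
      -- Bounds the pole order of all powers of `h` up to g + 1, so that one target space serves all
      -- steps.
      B = suc g ℕ.* N

      X : ℕ → Pred Carrier _
      X t = H (+ 0 Vec.∷ λ i → ℤ.- + (t ℕ.* κ i))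

    -- Multiplication by h ^ t embeds X t / X (t - 1) into H(-B, 0) / H(-B, κ).
    graded-embedding : ∀ {t m ρ} → suc t ℕ.≤ suc g → HasCodim E (X (suc t)) (X t) m →
                       HasCodim E (H (ℤ.- + B Vec.∷ λ _ → + 0)) (H (ℤ.- + B Vec.∷ (+_ ∘ κ))) ρ → m ℕ.≤ ρ
    graded-embedding {t} {m} {ρ} t<g+1 (b , isBasis) codim =
      independent≤ {x = λ j → h ^ T * b j} (basis-coordinates (H-subspace _) codim)
        (λ j → H-mono bounds (H-* (H-^ T h∈H) (inside j)))
        -- Injectivity: as h has order exactly κᵢ at Pᵢ, a product with h^T of order at least κᵢ
        -- comes from a factor of order at least κᵢ - T κᵢ, which is the bound defining `X t`.
        λ a hb∈H → independent a (mkH (λ where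
            zero    → at (combination a) zero
            (suc i) → ord≥-weaken (P i) (ℤₚ.≤-reflexive (shift t (κ i))) (ValuationLemmas.ν≥-cancel (Place.valuation (P i))
                        (ValuationLemmas.ν-^ (Place.valuation (P i)) T (νh i))
                        (IsSubspace.resp (ord≥-subspace (P i) (+ κ i)) (lin-scaleʳ a (h ^ T) b) (at hb∈H (suc i)))))
          (elsewhere (combination a)))
      where
      open IsBasisMod isBasis
      T = suc t
      combination : ∀ a → X T (lin a b)
      combination a = IsSubspace.lin∈ (H-subspace _) a inside
      bounds : ∀ i → (ℤ.- + B Vec.∷ λ _ → + 0) i ℤ.≤
                     + T ℤ.* (ℤ.- + N Vec.∷ (+_ ∘ κ)) i ℤ.+ (+ 0 Vec.∷ λ i → ℤ.- + (T ℕ.* κ i)) i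
      bounds zero = ℤₚ.≤-trans (ℤₚ.neg-mono-≤ (ℤ.+≤+ (ℕₚ.*-monoˡ-≤ N t<g+1))) (ℤₚ.≤-reflexive
        (≡.trans (cong ℤ.-_ (ℤₚ.pos-* T N)) (≡.trans (ℤₚ.neg-distribʳ-* (+ T) (+ N)) (≡.sym (ℤₚ.+-identityʳ _)))))
      bounds (suc i) = ℤₚ.≤-reflexive (≡.sym (≡.trans (cong (λ k → + T ℤ.* + κ i ℤ.- k) (ℤₚ.pos-* T (κ i)))
                                                     (ℤₚ.+-inverseʳ (+ T ℤ.* + κ i))))
      shift : ∀ t k → ℤ.- + (t ℕ.* k) ≡ + k ℤ.- + suc t ℤ.* + k
      shift t k = ≡.trans (cong ℤ.-_ (ℤₚ.pos-* t k)) (expand (+ t) (+ k))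
        where
        expand : ∀ t k → ℤ.- (t ℤ.* k) ≡ k ℤ.- (+ 1 ℤ.+ t) ℤ.* k
        expand = solve-∀

    X-dim : ∀ {ρ} → HasCodim E (H (ℤ.- + B Vec.∷ λ _ → + 0)) (H (ℤ.- + B Vec.∷ (+_ ∘ κ))) ρ →
            ∀ t → t ℕ.≤ suc g → ¬ ¬ (∃[ d ] d ℕ.≤ t ℕ.* ρ ℕ.+ 1 × HasDim E (X t) d)
    X-dim codim zero _ = do
      (d , dim , a , a-injective , a<1 , _) ← dim-by-nongaps (λ _ → 0) 1
      return (d , Finₚ.injective⇒≤ {f = λ i → fromℕ< (a<1 i)}
                    (λ {i} {j} eq → a-injective (Finₚ.fromℕ<-injective (a i) (a j) (a<1 i) (a<1 j) eq)) , dim)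
    X-dim {ρ} codim (suc t) t<g+1 = do
      (d , d≤ , dim) ← X-dim codim t (ℕₚ.<⇒≤ t<g+1)
      (m , _ , codim-X) ← codim-between (+ 0) {λ i → ℤ.- + (suc t ℕ.* κ i)} {λ i → ℤ.- + (t ℕ.* κ i)} κ
                            (λ i → step t (κ i))
      return (m ℕ.+ d
             , ℕₚ.≤-trans (ℕₚ.+-mono-≤ (graded-embedding t<g+1 codim-X codim) d≤)
                          (ℕₚ.≤-reflexive (≡.sym (ℕₚ.+-assoc ρ (t ℕ.* ρ) 1)))
             , codim-+ (H-subspace _) ≈0-subspace
                 (H-mono (∷-mono ℤₚ.≤-refl (λ i →
                   ℤₚ.neg-mono-≤ (ℤ.+≤+ (ℕₚ.m≤n+m (t ℕ.* κ i) (κ i))))))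
                 (IsSubspace.≈0⊆ (H-subspace _))
                 codim-X dim)
      where
      step : ∀ t k → ℤ.- + (suc t ℕ.* k) ℤ.+ + k ≡ ℤ.- + (t ℕ.* k)
      step t k = ≡.trans (cong (λ x → ℤ.- x ℤ.+ + k) (ℤₚ.pos-* (suc t) k))
        (≡.trans (expand (+ t) (+ k)) (cong ℤ.-_ (≡.sym (ℤₚ.pos-* t k))))
        where
        expand : ∀ t k → ℤ.- ((+ 1 ℤ.+ t) ℤ.* k) ℤ.+ k ≡ ℤ.- (t ℤ.* k)
        expand = solve-∀

    -- Otherwise each of the g + 1 steps from X 0 to X (g + 1) would lose a
    -- dimension, against Riemann's inequality.
    full-codim : ∀ {ρ} → HasCodim E (H (ℤ.- + B Vec.∷ λ _ → + 0)) (H (ℤ.- + B Vec.∷ (+_ ∘ κ))) ρ →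
                 weight κ ℕ.≤ ρ
    full-codim {ρ} codim = decidable-stable (weight κ ℕ.≤? ρ) do
      (d , d≤ , dim) ← X-dim codim (suc g) ℕₚ.≤-refl
      -- If ρ + 1 ≤ weight κ, then t steps give t (ρ + 1) + 1 ≤ g + t ρ + 1, that is t ≤ g; hence t
      -- = g + 1 is the first number of steps that contradicts.
      return (ℕₚ.≮⇒≥ λ ρ<κ → ℕₚ.<-irrefl ≡.refl (begin-strict
        suc g ℕ.* ρ ℕ.+ (g ℕ.+ 1)                        ≡⟨ arith g ρ ⟩
        suc g ℕ.* suc ρ                                  ≤⟨ ℕₚ.*-monoʳ-≤ (suc g) ρ<κ ⟩
        suc g ℕ.* weight κ                               ≡⟨ weight-* (suc g) κ ⟨
        weight (λ i → suc g ℕ.* κ i)                     <⟨ ℕₚ.≤-reflexive (ℕₚ.+-comm 1 _) ⟩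
        weight (λ i → suc g ℕ.* κ i) ℕ.+ 1               ≤⟨ riemann∞ 0 (λ i → suc g ℕ.* κ i) dim ⟩
        g ℕ.+ d                                          ≤⟨ ℕₚ.+-monoʳ-≤ g d≤ ⟩
        g ℕ.+ (suc g ℕ.* ρ ℕ.+ 1)                        ≡⟨ arith′ g (suc g ℕ.* ρ) ⟩
        suc g ℕ.* ρ ℕ.+ (g ℕ.+ 1)                        ∎))
      where
      open ℕₚ.≤-Reasoning
      arith : ∀ g ρ → suc g ℕ.* ρ ℕ.+ (g ℕ.+ 1) ≡ suc g ℕ.* suc ρ
      arith = ℕSolver.solve-∀
      arith′ : ∀ g x → g ℕ.+ (x ℕ.+ 1) ≡ x ℕ.+ (g ℕ.+ 1)
      arith′ = ℕSolver.solve-∀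

  -- Strong approximation away from P∞, from Riemann's inequality alone.
  approximation : ∀ k → ¬ ¬ (∃[ B ] HasCodim E (H (ℤ.- + B Vec.∷ λ _ → + 0)) (H (ℤ.- + B Vec.∷ (+_ ∘ k))) (weight k))
  approximation k = do
    (N , h , h≉0 , h∈H) ← nonzero-multiple k
    -- Passing from `k` to the exact orders of `h` makes multiplication by `h` shift the filtrations
    -- by exactly κᵢ.
    let κ = λ i → ℤ.∣ value h≉0 i ∣
        κ-value = λ i → ℤₚ.0≤i⇒+∣i∣≡i (ℤₚ.≤-trans (ℤ.+≤+ z≤n) (k≤value h≉0 h∈H i))
        νh = λ i → ≡.trans (νh≡value h≉0 i) (cong [_] (≡.sym (κ-value i)))
        k≤κ = λ i → ℤₚ.drop‿+≤+ (ℤₚ.≤-trans (k≤value h≉0 h∈H i) (ℤₚ.≤-reflexive (≡.sym (κ-value i))))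
        h∈H′ = mkH (λ { zero → at h∈H zero
                      ; (suc i) → ValuationLemmas.exactly⇒≥ (Place.valuation (P i)) (νh i) }) (elsewhere h∈H)
        B = suc g ℕ.* N
    (ρ , _ , codim-κ) ← codim-between (ℤ.- + B) {λ _ → + 0} {+_ ∘ κ} κ (λ i → ℤₚ.+-identityˡ (+ κ i))
    (m , m≤ , codim-k) ← codim-between (ℤ.- + B) {λ _ → + 0} {+_ ∘ k} k (λ i → ℤₚ.+-identityˡ (+ k i))
    (m′ , m′≤ , codim-kκ) ← codim-between (ℤ.- + B) {+_ ∘ k} {+_ ∘ κ} (λ i → κ i ℕ.∸ k i)
                              (λ i → cong +_ (ℕₚ.m+[n∸m]≡n (k≤κ i)))
    -- Full codimension descends from `κ` to `k`: it splits into two parts, each bounded by its own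
    -- weight, and the weights add up to `weight κ`.
    let codim-κ′ = codim-+ (H-subspace _) (H-subspace _)
                     (H-mono (∷-mono ℤₚ.≤-refl (λ _ → ℤ.+≤+ z≤n)))
                     (H-mono (∷-mono ℤₚ.≤-refl (λ i → ℤ.+≤+ (k≤κ i)))) codim-k codim-kκ
        κ≤m+m′ = ℕₚ.≤-trans (full-codim {N} κ h∈H′ νh codim-κ)
                            (codim≤ (basis-coordinates (H-subspace _) codim-κ′) codim-κ)
        k≤m = ℕₚ.+-cancelʳ-≤ (weight (λ i → κ i ℕ.∸ k i)) (weight k) m
                (ℕₚ.≤-trans (ℕₚ.≤-reflexive (weight-∸ k≤κ)) (ℕₚ.≤-trans κ≤m+m′ (ℕₚ.+-monoʳ-≤ m m′≤)))
    return (B , subst (HasCodim E _ _) (ℕₚ.≤-antisym m≤ k≤m) codim-k)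
    where
    value : ∀ {h} → ¬ h ≈ 0# → Fin s → ℤ
    value h≉0 i = proj₁ (ValuationLemmas.finite (Place.valuation (P i)) h≉0)
    νh≡value : ∀ {h} (h≉0 : ¬ h ≈ 0#) i → Place.ν (P i) h ≡ [ value h≉0 i ]
    νh≡value h≉0 i = proj₂ (ValuationLemmas.finite (Place.valuation (P i)) h≉0)
    k≤value : ∀ {a h} (h≉0 : ¬ h ≈ 0#) → H (a Vec.∷ (+_ ∘ k)) h → ∀ i → + k i ℤ.≤ value h≉0 i
    k≤value h≉0 h∈H i = ValuationLemmas.≥⇒≤ (Place.valuation (P i)) (νh≡value h≉0 i) (at h∈H (suc i))

-- The functions yᵣ and the rows of the matrices

module Construction
  {c ℓ} {K F : Field c ℓ} (E : Extension K F) (q : ℕ) .{{_ : NonTrivial q}} (card : HasCardinality K q)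
  {g : ℕ} (genus : IsGenus E g) {s : ℕ} (P∞ : Place E) (P : Vector (Place E) s)
  (P∞∉P : ∀ i → ¬ _≈ₚ_ E P∞ (P i)) (P-distinct : ∀ i j → ¬ i ≡ j → ¬ _≈ₚ_ E (P i) (P j))
  (degree∞ : HasDegree E P∞ 1) (e : Vector ℕ s) (degree : ∀ i → HasDegree E (P i) (e i))
  (C : Fin s → ℕ → ℕ → Field.Carrier K) (construction : RefinedColumnwise E g P∞ P e C) where

  private module K where
    open Field K public hiding (zero)
    open FieldLemmas K public
    open FiniteField K q card public
  open Field F hiding (zero)
  open FieldLemmas F
  open Extension E
  open LinComb E
  open Codimension E q card
  open PlaceLemmas E q card
  open Divisors E q card
  open Approximation E q card genus P∞ P P∞∉P P-distinct degree∞ e degree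
  open RefinedColumnwise construction
  open EnumeratesNonGaps enumerate
  private
    module V∞ = ValuationLemmas valuation∞
    single-distinct : ∀ (i j : Fin 1) → ¬ i ≡ j → ¬ _≈ₚ_ E P∞ P∞
    single-distinct zero zero 0≢0 = contradiction ≡.refl 0≢0
    module Single = RiemannRoch E q card {1} (λ _ → P∞) single-distinct

  n-mono : ∀ {r r′} → r ℕ.< r′ → n r ℕ.< n r′
  n-mono {r} {suc r′} (s≤s r≤r′) with ℕₚ.m≤n⇒m<n∨m≡n r≤r′
  ... | inj₁ r<r′   = ℕₚ.<-trans (n-mono r<r′) (increasing r′)
  ... | inj₂ ≡.refl = increasing r′

  n-mono⁻¹ : ∀ {r r′} → n r ℕ.< n r′ → r ℕ.< r′
  n-mono⁻¹ {r} {r′} nr<nr′ = ℕₚ.≰⇒> λ r′≤r → ℕₚ.<⇒≱ nr<nr′ (case (ℕₚ.m≤n⇒m<n∨m≡n r′≤r))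
    where
    case : ∀ {r r′} → r′ ℕ.< r ⊎ r′ ≡ r → n r′ ℕ.≤ n r
    case (inj₁ r′<r)   = ℕₚ.<⇒≤ (n-mono r′<r)
    case (inj₂ ≡.refl) = ℕₚ.≤-refl

  n-injective : ∀ {r r′} → n r ≡ n r′ → r ≡ r′
  n-injective {r} {r′} eq with ℕₚ.<-cmp r r′
  ... | tri< r<r′ _ _ = contradiction eq (ℕₚ.<⇒≢ (n-mono r<r′))
  ... | tri≈ _ r≡r′ _ = r≡r′
  ... | tri> _ _ r>r′ = contradiction (≡.sym eq) (ℕₚ.<⇒≢ (n-mono r>r′))

  zeros : Vector ℤ s
  zeros _ = + 0

  𝓛∞⇒H : ∀ {a f} → 𝓛 E ((a , P∞) List.∷ List.[]) f → H (ℤ.- a Vec.∷ zeros) f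
  𝓛∞⇒H {a} f∈𝓛 = mkH
    (λ { zero → Single.at f∈H zero ; (suc i) → Single.elsewhere f∈H (P i) (λ _ Pᵢ≈P∞ → P∞∉P i (≈ₚ-sym {P i} {P∞} Pᵢ≈P∞)) })
    (λ R R∉places → Single.elsewhere f∈H R (λ _ → R∉places zero))
    where f∈H = Single.𝓛⇒H {λ _ → a} f∈𝓛

  H⇒𝓛∞ : ∀ {a f} → H (ℤ.- a Vec.∷ zeros) f → 𝓛 E ((a , P∞) List.∷ List.[]) f
  H⇒𝓛∞ {a} {f} f∈H = Single.H⇒𝓛 {λ _ → a} (Single.mkH (λ { zero → at f∈H zero }) λ R R≉P∞ →
    decidable-stable (ord≥? R (+ 0) f) (¬¬-excluded-middle {A = ∃[ i ] _≈ₚ_ E R (P i)} >>= λ where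
      (yes (i , R≈Pᵢ)) → return (ord≥-≈ₚ {P i} {R} (≈ₚ-sym {R} {P i} R≈Pᵢ) (at f∈H (suc i)))
      (no  R∉P)        → return (elsewhere f∈H R λ { zero → R≉P∞ zero ; (suc i) R≈Pᵢ → R∉P (i , R≈Pᵢ) })))

  -- A function of pole order exactly `j` makes the two dimensions differ by one, whereas a gap
  -- number has them equal.
  nongap⇒¬IsGapNumber : ∀ {j} → NonGap zeros j → ¬ IsGapNumber E P∞ j
  nongap⇒¬IsGapNumber {suc j} nongap (_ , d , dim-j , dim-j-1) = ℕₚ.1+n≰n
    (codim≤ (basis-coordinates ≈0-subspace (transfer dim-j))
      (codim-+ (H-subspace _) ≈0-subspace (previous-pole (suc j))
        (IsSubspace.≈0⊆ (H-subspace _))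
        (codim-nongap nongap) (transfer dim-j-1)))
    where
    transfer : ∀ {a d} → HasDim E (𝓛 E ((a , P∞) List.∷ List.[])) d → HasDim E (H (ℤ.- a Vec.∷ zeros)) d
    transfer (b , isBasis) = b , record
      { inside = 𝓛∞⇒H ∘ inside ; spanning = λ x x∈H → spanning x (H⇒𝓛∞ x∈H) ; independent = independent }
      where open IsBasisMod isBasis

  nongap-index : ∀ {j} → NonGap zeros j → ∃[ r ] n r ≡ j
  nongap-index nongap = EnumeratesNonGaps.complete enumerate _ (nongap⇒¬IsGapNumber nongap)

  -- For r > g, membership in 𝓛(Dᵣ) and not in 𝓛(Dᵣ′) places the pole order above nᵣ₋₁ and not above
  -- nᵣ. It is a non-gap itself, and the enumeration has none strictly between.
  y-nongap : ∀ r → H (ℤ.- + n r Vec.∷ zeros) (y r) × ν∞ (y r) ≡ [ ℤ.- + n r ]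
  y-nongap r with r ℕ.≤? g
  ... | yes r≤g = y∈H , V∞.not-greater⇒exactly (at y∈H zero) λ y> →
    proj₂ (y-low r r≤g) (H⇒𝓛∞ (mkH
      (λ { zero → ord≥-weaken P∞ (ℤₚ.≤-reflexive (shift (+ n r))) y> ; (suc i) → at y∈H (suc i) }) (elsewhere y∈H)))
    where
    y∈H = 𝓛∞⇒H (proj₁ (y-low r r≤g))
    shift : ∀ x → ℤ.- (x ℤ.- + 1) ≡ + 1 ℤ.+ ℤ.- x
    shift = solve-∀
  ... | no r≰g = y∈H , pole-order r (ℕₚ.≤-trans (s≤s z≤n) g<r) ν≡value y∈H ¬y>
    where
    g<r = ℕₚ.≰⇒> r≰g
    vanishing : Vector ℤ s
    vanishing i = ℤ.- + (suffixSum (l r) i ℕ.* quotient (∣lcmOf e i))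
    y∈D : H (λ i → ℤ.- (+ n r Vec.∷ vanishing) i) (y r)
    y∈D = 𝓛⇒H (proj₁ (y-high r g<r))
    y∈H : H (ℤ.- + n r Vec.∷ zeros) (y r)
    y∈H = H-mono (λ { zero → ℤₚ.≤-refl
                    ; (suc i) → ℤₚ.≤-trans (ℤ.+≤+ z≤n) (ℤₚ.≤-reflexive (≡.sym (ℤₚ.neg-involutive (+ _)))) }) y∈D
    ¬y> : ¬ ord≥ E P∞ (ℤ.- + n (ℕ.pred r)) (y r)
    ¬y> y> = proj₂ (y-high r g<r) (H⇒𝓛 {+ n (ℕ.pred r) Vec.∷ vanishing} (mkH (λ { zero → y> ; (suc i) → at y∈D (suc i) }) (elsewhere y∈D)))
    y≉0 : ¬ y r ≈ 0#
    y≉0 y≈0 = ¬y> (V∞.ν≥-resp (sym y≈0) (V∞.ν≥-0 _))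
    ν≡value = proj₂ (V∞.finite y≉0)
    pole-order : ∀ r → 1 ℕ.≤ r → ∀ {b} → ν∞ (y r) ≡ [ b ] → H (ℤ.- + n r Vec.∷ zeros) (y r) →
                 ¬ ord≥ E P∞ (ℤ.- + n (ℕ.pred r)) (y r) → ν∞ (y r) ≡ [ ℤ.- + n r ]
    pole-order (suc r) _ {b} ν≡b y∈H ¬y> = ≡.trans ν≡-j (cong (λ j → [ ℤ.- + j ]) j≡n)
      where
      j = ℤ.∣ b ∣
      b<-n : b ℤ.< ℤ.- + n r
      b<-n = ℤₚ.≰⇒> (λ -n≤b → ¬y> (V∞.≤⇒≥ ν≡b -n≤b))
      b≡-j : b ≡ ℤ.- + j
      b≡-j = ≡.trans (≡.sym (ℤₚ.neg-involutive b)) (cong ℤ.-_ (≡.sym (≡.trans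
        (cong +_ (≡.sym (ℤₚ.∣-i∣≡∣i∣ b)))
        (ℤₚ.0≤i⇒+∣i∣≡i (ℤₚ.neg-mono-≤ (ℤₚ.≤-trans (ℤₚ.<⇒≤ b<-n) (ℤₚ.neg-≤-pos {n r} {0})))))))
      ν≡-j : ν∞ (y (suc r)) ≡ [ ℤ.- + j ]
      ν≡-j = ≡.trans ν≡b (cong [_] b≡-j)
      j≤n : j ℕ.≤ n (suc r)
      j≤n = ℤₚ.drop‿+≤+ (ℤₚ.neg-cancel-≤ (subst (ℤ.- + n (suc r) ℤ.≤_) b≡-j (V∞.≥⇒≤ ν≡b (at y∈H zero))))
      n<j : n r ℕ.< j
      n<j = ℤₚ.drop‿+<+ (ℤₚ.neg-cancel-< (subst (ℤ._< ℤ.- + n r) b≡-j b<-n))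
      index = nongap-index {j} (y (suc r)
        , mkH (λ { zero → V∞.exactly⇒≥ ν≡-j ; (suc i) → at y∈H (suc i) }) (elsewhere y∈H) , ν≡-j)
      j≡n : j ≡ n (suc r)
      j≡n = ≡.trans (≡.sym (proj₂ index)) (cong n (ℕₚ.≤-antisym
        (ℕₚ.≮⇒≥ λ r< → ℕₚ.<⇒≱ (n-mono r<) (subst (ℕ._≤ n (suc r)) (≡.sym (proj₂ index)) j≤n))
        (n-mono⁻¹ (subst (n r ℕ.<_) (≡.sym (proj₂ index)) n<j))))

  -- There are at most g gaps: ℓ(nᵣ P∞) counts non-gaps up to nᵣ, so it is at most r + 1, while
  -- Riemann's inequality makes it at least nᵣ + 1 - g.
  n-bound : ∀ r → n r ℕ.≤ g ℕ.+ r
  n-bound r = decidable-stable (n r ℕ.≤? g ℕ.+ r) do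
    (p , dim , a , a-injective , a≤n , nongap) ← dim-by-nongaps (λ _ → 0) (suc (n r))
    let index = λ i → nongap-index (nongap i)
        index≤r = λ i → s≤s (ℕₚ.≮⇒≥ λ r<i → ℕₚ.<⇒≱ (n-mono r<i)
                    (subst (ℕ._≤ n r) (≡.sym (proj₂ (index i))) (ℕₚ.≤-pred (a≤n i))))
        p≤r+1 = Finₚ.injective⇒≤ {f = λ i → fromℕ< (index≤r i)} λ {i} {j} eq → a-injective
          (≡.trans (≡.sym (proj₂ (index i))) (≡.trans
            (cong n (Finₚ.fromℕ<-injective (proj₁ (index i)) (proj₁ (index j)) (index≤r i) (index≤r j) eq))
            (proj₂ (index j))))
    return (ℕₚ.≤-pred (begin
      suc (n r)                          ≡⟨ ℕₚ.+-comm 1 (n r) ⟩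
      n r ℕ.+ 1                          ≡⟨ cong (ℕ._+ 1) (ℕₚ.+-identityʳ (n r)) ⟨
      n r ℕ.+ 0 ℕ.+ 1                    ≡⟨ cong (λ w → n r ℕ.+ w ℕ.+ 1) weight-zero ⟨
      n r ℕ.+ weight (λ _ → 0) ℕ.+ 1     ≤⟨ riemann∞ (n r) (λ _ → 0) dim ⟩
      g ℕ.+ p                            ≤⟨ ℕₚ.+-monoʳ-≤ g p≤r+1 ⟩
      g ℕ.+ suc r                        ≡⟨ ℕₚ.+-suc g r ⟩
      suc (g ℕ.+ r)                      ∎))
    where open ℕₚ.≤-Reasoning

  ys-dimension : ∀ r {d} → HasDim E (H (ℤ.- + n r Vec.∷ zeros)) d → suc r ℕ.≤ d
  -- The order is reversed because larger pole orders mean smaller valuations, and these have to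
  -- increase with the index.
  ys-dimension r dim = independent≤ {x = λ (i : Fin (suc r)) → y (r ℕ.∸ toℕ i)} (basis-coordinates ≈0-subspace dim)
    (λ i → H-mono (λ { zero → ℤₚ.neg-mono-≤ (ℤ.+≤+ (n-mono-≤ (ℕₚ.m∸n≤m r (toℕ i)))) ; (suc _) → ℤₚ.≤-refl })
                  (proj₁ (y-nongap (r ℕ.∸ toℕ i))))
    (distinct-values-independent P∞ _ (λ i → ℤ.- + n (r ℕ.∸ toℕ i)) (λ i → proj₂ (y-nongap (r ℕ.∸ toℕ i)))
      λ i j i<j → ℤₚ.neg-mono-< (ℤ.+<+ (n-mono (ℕₚ.∸-monoʳ-< i<j (Finₚ.toℕ≤pred[n] j)))))
    where
    n-mono-≤ : ∀ {r r′} → r ℕ.≤ r′ → n r ℕ.≤ n r′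
    n-mono-≤ r≤r′ with ℕₚ.m≤n⇒m<n∨m≡n r≤r′
    ... | inj₁ r<r′   = ℕₚ.<⇒≤ (n-mono r<r′)
    ... | inj₂ ≡.refl = ℕₚ.≤-refl

  -- If n r were a gap of the space attached to k, then j ↦ n r - j would send
  -- the non-gaps of that space below n r to gaps of P∞, and by Riemann's
  -- inequality there are more than g of them.
  conductor : ∀ (k : Vector ℕ s) {m r} → g ℕ.+ weight k ℕ.≤ m → m ℕ.≤ r → ¬ ¬ NonGap (+_ ∘ k) (n r)
  conductor k {m} {r} g+k≤m m≤r gap = dim-by-nongaps k (suc (n r)) λ (p , dim , a , a-injective , a≤n , nongap) →
    codim-between (ℤ.- + n r) {zeros} {+_ ∘ k} k (λ i → ℤₚ.+-identityˡ (+ k i)) λ (d , d≤ , codim) →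
    let dim-0 = codim-+ (H-subspace _) ≈0-subspace
                  (H-mono (∷-mono ℤₚ.≤-refl (λ _ → ℤ.+≤+ z≤n)))
                  (IsSubspace.≈0⊆ (H-subspace _))
                  codim dim
    in ℕₚ.<-irrefl ≡.refl (too-many p d d≤ (ys-dimension r dim-0)
         (Finₚ.injective⇒≤ {f = positions p a a≤n} (positions-injective p a a-injective a≤n nongap)))
    where
    -- The r + 1 non-gaps up to nᵣ and the p numbers nᵣ - a are distinct and at most nᵣ ≤ g + r,
    -- which leaves p ≤ g. But d + p is the dimension of the space with k = 0, hence at least r + 1,
    -- and d ≤ weight k.
    too-many : ∀ p d → d ℕ.≤ weight k → suc r ℕ.≤ d ℕ.+ p → suc r ℕ.+ p ℕ.≤ suc (n r) →
               suc (g ℕ.+ weight k) ℕ.≤ g ℕ.+ weight k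
    too-many p d d≤ r<d+p r+p≤n = begin
      suc (g ℕ.+ weight k)    ≤⟨ s≤s (ℕₚ.≤-trans g+k≤m m≤r) ⟩
      suc r                   ≤⟨ r<d+p ⟩
      d ℕ.+ p                 ≤⟨ ℕₚ.+-mono-≤ d≤ (ℕₚ.+-cancelˡ-≤ (suc r) p g
                                   (ℕₚ.≤-trans r+p≤n (ℕₚ.≤-trans (s≤s (n-bound r)) (ℕₚ.≤-reflexive (cong suc (ℕₚ.+-comm g r)))))) ⟩
      weight k ℕ.+ g          ≡⟨ ℕₚ.+-comm (weight k) g ⟩
      g ℕ.+ weight k          ∎
      where open ℕₚ.≤-Reasoning

    module _ (p : ℕ) (a : Fin p → ℕ) where
      position : Fin (suc r) ⊎ Fin p → ℕ
      position (inj₁ i) = n (toℕ i)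
      position (inj₂ l) = n r ℕ.∸ a l

      position< : (∀ l → a l ℕ.< suc (n r)) → ∀ x → position x ℕ.< suc (n r)
      position< a≤n (inj₁ i) with ℕₚ.m≤n⇒m<n∨m≡n (Finₚ.toℕ≤pred[n] i)
      ... | inj₁ i<r = s≤s (ℕₚ.<⇒≤ (n-mono i<r))
      ... | inj₂ i≡r = s≤s (ℕₚ.≤-reflexive (cong n i≡r))
      position< a≤n (inj₂ l) = s≤s (ℕₚ.m∸n≤m (n r) (a l))

      positions : (∀ l → a l ℕ.< suc (n r)) → Fin (suc r ℕ.+ p) → Fin (suc (n r))
      positions a≤n x = fromℕ< (position< a≤n (Fin.splitAt (suc r) x))

      module _ (a-injective : Injective _≡_ _≡_ a) (a≤n : ∀ l → a l ℕ.< suc (n r))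
               (nongap : ∀ l → NonGap (+_ ∘ k) (a l)) where
        -- Otherwise the product of `y i` with a function of pole order `a l` would have pole order
        -- `n r` and the prescribed zeros, against `gap`.
        product-nongap : ∀ i l → ¬ n i ≡ n r ℕ.∸ a l
        product-nongap i l eq with f , f∈H , νf ← nongap l = gap (y i * f
          , H-mono (λ { zero → ℤₚ.≤-reflexive (≡.sym orders) ; (suc _) → ℤₚ.≤-reflexive (≡.sym (ℤₚ.+-identityˡ _)) })
                   (H-* (proj₁ (y-nongap i)) f∈H)
          , ≡.trans (V∞.ν-*-exactly (proj₂ (y-nongap i)) νf) (cong [_] orders))
          where
          orders : ℤ.- + n i ℤ.+ ℤ.- + a l ≡ ℤ.- + n r
          orders = ≡.trans (≡.sym (ℤₚ.neg-distrib-+ (+ n i) (+ a l)))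
            (cong (λ j → ℤ.- + j) (≡.trans (cong (ℕ._+ a l) eq) (ℕₚ.m∸n+n≡m (ℕₚ.≤-pred (a≤n l)))))

        position-injective : ∀ x x′ → position x ≡ position x′ → x ≡ x′
        position-injective (inj₁ i) (inj₁ i′) eq = cong inj₁ (Finₚ.toℕ-injective (n-injective eq))
        position-injective (inj₁ i) (inj₂ l)  eq = contradiction eq (product-nongap (toℕ i) l)
        position-injective (inj₂ l) (inj₁ i)  eq = contradiction (≡.sym eq) (product-nongap (toℕ i) l)
        position-injective (inj₂ l) (inj₂ l′) eq = cong inj₂ (a-injective
          (ℕₚ.∸-cancelˡ-≡ (ℕₚ.≤-pred (a≤n l)) (ℕₚ.≤-pred (a≤n l′)) eq))

        positions-injective : Injective _≡_ _≡_ (positions a≤n)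
        positions-injective {x} {x′} eq = ≡.trans (≡.sym (Finₚ.join-splitAt (suc r) p x)) (≡.trans
          (cong (Fin.join (suc r) p) (position-injective (Fin.splitAt (suc r) x) (Fin.splitAt (suc r) x′) (Finₚ.fromℕ<-injective _ _ _ _ eq)))
          (Finₚ.join-splitAt (suc r) p x′))

  -- Congruence to 0 modulo ∏ Pᵢ^kᵢ. Unlike `H`, it constrains the function at the places Pᵢ alone.
  Vanishing : Vector ℕ s → Carrier → Set
  Vanishing k f = ∀ i → ord≥ E (P i) (+ k i) f

  vanishing-subspace : ∀ k → IsSubspace (Vanishing k)
  vanishing-subspace k = record
    { resp  = λ x≈y x∈Z i → resp (S i) x≈y (x∈Z i)
    ; zero∈ = λ i → zero∈ (S i)
    ; +∈    = λ x∈Z y∈Z i → +∈ (S i) (x∈Z i) (y∈Z i)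
    ; scale = λ a x∈Z i → scale (S i) a (x∈Z i)
    }
    where
    open IsSubspace
    S : ∀ i → IsSubspace (ord≥ E (P i) (+ k i))
    S i = ord≥-subspace (P i) (+ k i)

  module Reduction (k : Vector ℕ s) {m : ℕ} (g+k≤m : g ℕ.+ weight k ℕ.≤ m) where
    private module Z = IsSubspace (vanishing-subspace k)

    ys : Vector Carrier m
    ys = y ∘ toℕ

    Reducible : Carrier → Set _
    Reducible f = ∃[ a ] Vanishing k (f - lin a ys)

    reducible-combine : ∀ {f f′} c → Reducible (f - embed c * f′) → Reducible f′ → Reducible f
    reducible-combine {f} {f′} c (a , w∈Z) (a′ , w′∈Z) = (λ i → a i K.+ c K.* a′ i) , Z.resp (sym (difference (begin
      f
        ≈⟨ +-cancel-difference f (embed c * f′) ⟩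
      embed c * f′ + v
        ≈⟨ +-cong (*-congˡ (+-cancel-difference f′ (lin a′ ys))) (+-cancel-difference v (lin a ys)) ⟩
      embed c * (lin a′ ys + w′) + (lin a ys + w)
        ≈⟨ solve 5 (λ c u w′ u′ w → c :* (u :+ w′) :+ (u′ :+ w) := (u′ :+ c :* u) :+ (w :+ c :* w′)) refl
             (embed c) (lin a′ ys) w′ (lin a ys) w ⟩
      lin a ys + embed c * lin a′ ys + (w + embed c * w′)
        ≈⟨ +-congʳ (trans (lin-+ˡ a (λ i → c K.* a′ i) ys) (+-congˡ (lin-scaleˡ c a′ ys))) ⟨
      lin (λ i → a i K.+ c K.* a′ i) ys + (w + embed c * w′) ∎)))
      (Z.+∈ w∈Z (Z.scale c w′∈Z))
      where
      open import Relation.Binary.Reasoning.Setoid setoid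
      v  = f - embed c * f′
      w  = v - lin a ys
      w′ = f′ - lin a′ ys

    vanishing⇒reducible : ∀ {f} → Vanishing k f → Reducible f
    vanishing⇒reducible {f} f∈Z = (λ _ → K.0#) , Z.resp
      (sym (difference (sym (trans (+-congʳ (lin-zero ys (λ _ → K.refl))) (+-identityˡ f))))) f∈Z

    y-reducible : ∀ {r} → r ℕ.< m → Reducible (y r)
    y-reducible {r} r<m = δ (fromℕ< r<m) , Z.resp
      (sym (trans (+-congʳ (trans (reflexive (cong y (≡.sym (Finₚ.toℕ-fromℕ< r<m)))) (sym (lin-δ (fromℕ< r<m) ys))))
                  (-‿inverseʳ _))) Z.zero∈

    -- Descent on the pole order at `P∞`. A pole order that occurs is some `n r`: for r < m it is
    -- removed by `y r`, otherwise by the vanishing function from `conductor`. A function without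
    -- pole order left is 0.
    reduce : ∀ N {f} → H (pole N Vec.∷ zeros) f → ¬ ¬ Reducible f
    reduce zero    {f} f∈H = return (vanishing⇒reducible (Z.resp (sym (zero-at-∞ (λ _ → ℤₚ.≤-refl) f∈H)) Z.zero∈))
    reduce (suc N) {f} f∈H = cases (ord≥? P∞ (ℤ.suc (ℤ.- + N)) f)
      where
      eliminate : ∀ {h} → ν∞ h ≡ [ ℤ.- + N ] → H (ℤ.- + N Vec.∷ zeros) h → Reducible h → ¬ ¬ Reducible f
      eliminate νh h∈H h-reducible =
        let (c , rest∈H) = eliminate-pole νh h∈H f∈H
        in reduce N rest∈H >>= λ rest-reducible → return (reducible-combine c rest-reducible h-reducible)
      by-index : ν∞ f ≡ [ ℤ.- + N ] → ∀ r → n r ≡ N → ¬ ¬ Reducible f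
      by-index νf r nr≡N with r ℕ.<? m
      ... | yes r<m =
        let (y∈H , νy) = subst (λ j → H (ℤ.- + j Vec.∷ zeros) (y r) × ν∞ (y r) ≡ [ ℤ.- + j ]) nr≡N (y-nongap r)
        in eliminate νy y∈H (y-reducible r<m)
      ... | no  r≮m = subst (λ j → ¬ ¬ NonGap (+_ ∘ k) j) nr≡N (conductor k g+k≤m (ℕₚ.≮⇒≥ r≮m)) >>= λ (h , h∈H , νh) →
        eliminate νh (H-mono (∷-mono ℤₚ.≤-refl (λ _ → ℤ.+≤+ z≤n)) h∈H)
                  (vanishing⇒reducible (λ i → at h∈H (suc i)))
      cases : Dec (ord≥ E P∞ (ℤ.suc (ℤ.- + N)) f) → ¬ ¬ Reducible f
      cases (yes f>) = reduce N (next-pole {N = N} f∈H f>)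
      cases (no ¬f>) =
        let νf = V∞.not-greater⇒exactly (at f∈H zero) ¬f>
            (r , nr≡N) = nongap-index (f , f∈H , νf)
        in by-index νf r nr≡N

    -- The first kᵢ eᵢ rows hold the coordinates of the first kᵢ expansion coefficients. If they
    -- annihilate `a`, the truncated expansions cancel in the completion, and only the remainders,
    -- of order at least kᵢ, contribute.
    rows-vanish : ∀ a → (∀ i (j : Fin (k i ℕ.* e i)) → K.sum (λ r → a r K.* C i (toℕ j) (toℕ r)) K.≈ K.0#) →
                  Vanishing k (lin a ys)
    rows-vanish a rows≈0 i = subst ([ + k i ] ≤⁺_) (extends-ν (lin a ys)) (V̂.ν≥-resp (F̂.sym expand)
      (constant-combination≥ a (λ r → expansion i (toℕ r) (k i))))
      where
      open Completion (completion i)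
        using (F̂; ι; ρ; κ; R; ν̂; extends-ν; commutes; module F̂; module R) renaming (valuation to valuation̂)
      module F̂ₗ = FieldLemmas F̂
      module V̂ = ValuationLemmas valuation̂
      module ι = LinComb ι
      module ρ = LinComb ρ
      module κ = LinComb κ
      module ι-hom = RingMorphisms.IsRingHomomorphism (Extension.isRingHomomorphism ι)

      powers : Vector F̂.Carrier (k i)
      powers t = Extension.embed ι (z i) F̂.^ toℕ t

      partial : Fin m → F̂.Carrier
      partial r = ρ.lin (λ t → β i (toℕ t) (toℕ r)) powers

      constants : Vector R.Carrier m
      constants = Extension.embed κ ∘ a

      constant-combination≥ : ∀ {m N} (a : Vector K.Carrier m) {x} → (∀ r → [ N ] ≤⁺ ν̂ (x r)) →
                              [ N ] ≤⁺ ν̂ (ρ.lin (Extension.embed κ ∘ a) x)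
      constant-combination≥ {zero}      a x≥ = V̂.ν≥-0 _
      constant-combination≥ {suc _} {N} a x≥ = V̂.ν≥-+
        (V̂.weaken (ℤₚ.≤-reflexive (≡.sym (ℤₚ.+-identityˡ N))) (V̂.ν≥-*
          (V̂.ν≥-resp (F̂.sym (commutes (a zero)))
            (subst ([ + 0 ] ≤⁺_) (≡.sym (extends-ν (embed (a zero)))) (ν≥-constant (P i) (a zero))))
          (x≥ zero)))
        (constant-combination≥ (a ∘ suc) (x≥ ∘ suc))

      coefficient≈0 : ∀ t → R.sum (λ r → constants r R.* β i (toℕ t) (toℕ r)) R.≈ R.0#
      coefficient≈0 t = R.trans (κ.lin-congʳ a (λ r → columns i (toℕ t) (toℕ r))) (R.trans
        (κ.lin-assoc a (λ r h → C i (toℕ t ℕ.* e i ℕ.+ toℕ h) (toℕ r)) (basis i))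
        (κ.lin-zero (basis i) (λ h → subst (λ j → K.sum (λ r → a r K.* C i j (toℕ r)) K.≈ K.0#)
          (≡.trans (Finₚ.toℕ-combine t h) (cong (ℕ._+ toℕ h) (ℕₚ.*-comm (e i) (toℕ t))))
          (rows≈0 i (Fin.combine t h)))))

      expand : Extension.embed ι (lin a ys) F̂.≈
               ρ.lin constants (λ r → Extension.embed ι (ys r) F̂.- partial r)
      expand = begin
        Extension.embed ι (lin a ys)
          ≈⟨ ι.embed-sum (λ r → embed (a r) * ys r) ⟩
        F̂.sum (λ r → Extension.embed ι (embed (a r) * ys r))
          ≈⟨ F̂ₗ.sum-cong-≋ (λ r → F̂.trans (ι-hom.*-homo _ _) (F̂.*-congʳ (F̂.sym (commutes (a r))))) ⟩
        ρ.lin constants (Extension.embed ι ∘ ys)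
          ≈⟨ ρ.lin-congʳ constants (λ r → F̂ₗ.+-cancel-difference (Extension.embed ι (ys r)) (partial r)) ⟩
        ρ.lin constants (λ r → partial r F̂.+ (Extension.embed ι (ys r) F̂.- partial r))
          ≈⟨ ρ.lin-+ʳ constants partial _ ⟩
        ρ.lin constants partial F̂.+ ρ.lin constants (λ r → Extension.embed ι (ys r) F̂.- partial r)
          ≈⟨ F̂.+-congʳ (F̂.trans (ρ.lin-assoc constants (λ r t → β i (toℕ t) (toℕ r)) powers)
                                 (ρ.lin-zero powers coefficient≈0)) ⟩
        F̂.0# F̂.+ ρ.lin constants (λ r → Extension.embed ι (ys r) F̂.- partial r)
          ≈⟨ F̂.+-identityˡ _ ⟩
        ρ.lin constants (λ r → Extension.embed ι (ys r) F̂.- partial r) ∎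
        where open import Relation.Binary.Reasoning.Setoid F̂.setoid

    -- A basis modulo vanishing, as given by `approximation`, is reduced to combinations `A` of the
    -- `ys`. A vector in the kernel of `A` times the rows yields a vanishing combination of the
    -- basis and is therefore 0, so the square product is onto.
    rows-surjective : ¬ ¬ (∀ (w : ∀ i → Fin (k i ℕ.* e i) → K.Carrier) → Σ (Vector K.Carrier m) λ a →
                          ∀ i j → K.sum (λ r → a r K.* C i (toℕ j) (toℕ r)) K.≈ w i j)
    rows-surjective = do
      (B , b , isBasis) ← approximation k
      reducible ← ¬¬-sequence (λ l → reduce (suc B) (IsBasisMod.inside isBasis l))
      return (solve-rows B b isBasis reducible)
      where
      d : Vector ℕ s
      d i = k i ℕ.* e i
      entry : Fin (sumℕ d) → Fin m → K.Carrier
      entry x r = let (i , j) = locate d x in C i (toℕ j) (toℕ r)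
      everywhere : ∀ {p} {T : (i : Fin s) → Fin (d i) → Set p} →
                   (∀ x → T (proj₁ (locate d x)) (proj₂ (locate d x))) → ∀ i j → T i j
      everywhere {T = T} all i j with x , eq ← locate-surjective d i j =
        subst (λ (i , j) → T i j) eq (all x)
      solve-rows : ∀ B b → IsBasisMod E (H (ℤ.- + B Vec.∷ zeros)) (H (ℤ.- + B Vec.∷ (+_ ∘ k))) {sumℕ d} b →
                   (∀ l → Reducible (b l)) →
                   ∀ (w : ∀ i → Fin (d i) → K.Carrier) → Σ (Vector K.Carrier m) λ a →
                   ∀ i j → K.sum (λ r → a r K.* C i (toℕ j) (toℕ r)) K.≈ w i j
      solve-rows B b isBasis reducible w =
        combine-rows (proj₁ solution) ,
        everywhere (λ x → K.trans (K.sym (K.sum-assoc (proj₁ solution) A (entry x))) (proj₂ solution x))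
        where
        open IsBasisMod isBasis
        A : Fin (sumℕ d) → Vector K.Carrier m
        A l = proj₁ (reducible l)
        combine-rows : Vector K.Carrier (sumℕ d) → Vector K.Carrier m
        combine-rows x r = K.sum (λ l → x l K.* A l r)
        kernel-trivial : ∀ x → (∀ p → K.sum (λ l → x l K.* K.sum (λ r → A l r K.* entry p r)) K.≈ K.0#) →
                         ∀ l → x l K.≈ K.0#
        kernel-trivial x vanish = independent x (mkH
          (λ { zero → at x∈H zero ; (suc i) → Z.resp (sym split) (Z.+∈ x-A∈Z A∈Z) i }) (elsewhere x∈H))
          where
          x∈H = IsSubspace.lin∈ (H-subspace _) x inside
          x-A∈Z = Z.lin∈ x (λ l → proj₂ (reducible l))
          A∈Z = Z.resp (sym (lin-assoc x A ys)) (rows-vanish (combine-rows x) (everywhere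
                  (λ p → K.trans (K.sym (K.sum-assoc x A (entry p))) (vanish p))))
          split : lin x b ≈ lin x (λ l → b l - lin (A l) ys) + lin x (λ l → lin (A l) ys)
          split = trans (lin-congʳ x (λ l → trans (+-cancel-difference (b l) (lin (A l) ys)) (+-comm _ _)))
                        (lin-+ʳ x _ _)
        solution = K.rows-span (λ l p → K.sum (λ r → A l r K.* entry p r)) kernel-trivial
                     (λ p → w (proj₁ (locate d p)) (proj₂ (locate d p)))

-- Digits and counting

module Digits (q : ℕ) .{{_ : NonTrivial q}} where
  private instance
    q≢0 : NonZero q
    q≢0 = ℕ.nonTrivial⇒nonZero q

  infixl 7 _/^_
  _/^_ : ℕ → ℕ → ℕ
  N /^ r = _/_ N (q ℕ.^ r) {{b^≢0 q r}}

  toℕ-digit : ∀ r N → toℕ (digit q r N) ≡ N /^ r % q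
  toℕ-digit r N = Finₚ.toℕ-fromℕ< _

  /^-+ : ∀ N r t → N /^ r /^ t ≡ N /^ (r ℕ.+ t)
  /^-+ N r t = ≡.trans
    (DivMod.m/n/o≡m/[n*o] N (q ℕ.^ r) (q ℕ.^ t) {{b^≢0 q r}} {{b^≢0 q t}} {{product≢0}})
    (DivMod./-congʳ {{product≢0}} {{b^≢0 q (r ℕ.+ t)}} (≡.sym (ℕₚ.^-distribˡ-+-* q r t)))
    where
    product≢0 : NonZero (q ℕ.^ r ℕ.* q ℕ.^ t)
    product≢0 = ℕₚ.m*n≢0 _ _ {{b^≢0 q r}} {{b^≢0 q t}}

  digits-injective : ∀ m N N′ → (∀ r → r ℕ.< m → digit q r N ≡ digit q r N′) →
                     N /^ m ≡ N′ /^ m → N ≡ N′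
  digits-injective m N N′ digits quotients =
    ≡.trans (≡.sym (DivMod.n/1≡n N)) (≡.trans (descend m 0 (ℕₚ.+-identityʳ m)) (DivMod.n/1≡n N′))
    where
    step : ∀ M r → M /^ r ≡ M /^ r % q ℕ.+ M /^ suc r ℕ.* q
    step M r = ≡.trans (DivMod.m≡m%n+[m/n]*n (M /^ r) q)
      (cong (λ x → M /^ r % q ℕ.+ x ℕ.* q) (≡.trans
        (DivMod.m/n/o≡m/[n*o] M (q ℕ.^ r) q {{b^≢0 q r}} {{q≢0}} {{product≢0}})
        (DivMod./-congʳ {{product≢0}} {{b^≢0 q (suc r)}} (ℕₚ.*-comm (q ℕ.^ r) q))))
      where
      product≢0 : NonZero (q ℕ.^ r ℕ.* q)
      product≢0 = ℕₚ.m*n≢0 _ q {{b^≢0 q r}}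
    descend : ∀ t r → t ℕ.+ r ≡ m → N /^ r ≡ N′ /^ r
    descend zero    r ≡.refl = quotients
    descend (suc t) r t+r≡m  = ≡.trans (step N r) (≡.trans (cong₂ (λ x y → x ℕ.+ y ℕ.* q)
      (≡.trans (≡.sym (toℕ-digit r N)) (≡.trans (cong toℕ (digits r (ℕₚ.m+n≤o⇒n≤o t
        (ℕₚ.≤-reflexive (≡.trans (ℕₚ.+-suc t r) t+r≡m))))) (toℕ-digit r N′)))
      (descend t (suc r) (≡.trans (ℕₚ.+-suc t r) t+r≡m))) (≡.sym (step N′ r)))

  block-quotient : ∀ k m {n} → n ℕ.< q ℕ.^ m → (k ℕ.* q ℕ.^ m ℕ.+ n) /^ m ≡ k
  block-quotient k m {n} n<q^m = ≡.trans
    (DivMod.+-distrib-/-∣ˡ {k ℕ.* q ℕ.^ m} n {q ℕ.^ m} {{b^≢0 q m}} (divides k ≡.refl))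
    (≡.trans (cong₂ ℕ._+_ (DivMod.m*n/n≡m k (q ℕ.^ m) {{b^≢0 q m}})
                          (DivMod.m<n⇒m/n≡0 {n} {q ℕ.^ m} {{b^≢0 q m}} n<q^m))
             (ℕₚ.+-identityʳ k))

  -- From position m on, the digits are those of the block number `k`, so their contribution is
  -- constant on a block.
  high-digit : ∀ k m {n} → n ℕ.< q ℕ.^ m → ∀ {r} → m ℕ.≤ r →
               digit q r (k ℕ.* q ℕ.^ m ℕ.+ n) ≡ digit q (r ℕ.∸ m) k
  high-digit k m {n} n<q^m {r} m≤r = Finₚ.toℕ-injective (≡.trans (toℕ-digit r N) (≡.trans
    (cong (_% q) (≡.trans (cong (N /^_) (≡.sym (ℕₚ.m+[n∸m]≡n m≤r)))
      (≡.trans (≡.sym (/^-+ N m (r ℕ.∸ m))) (cong (_/^ (r ℕ.∸ m)) (block-quotient k m n<q^m)))))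
    (≡.sym (toℕ-digit (r ℕ.∸ m) k))))
    where N = k ℕ.* q ℕ.^ m ℕ.+ n

module Truncations {c ℓ} (K : Field c ℓ) where
  open Field K hiding (zero)
  open FieldLemmas K
  open import Algebra.Properties.Monoid.Sum +-monoid using (sum-init-last)
  open import Relation.Binary.Reasoning.Setoid setoid

  partialSum : (ℕ → Carrier) → ℕ → Carrier
  partialSum t N = ∑[ r < N ] t (toℕ r)

  partialSum-suc : ∀ t N → partialSum t (suc N) ≈ partialSum t N + t N
  partialSum-suc t N = trans (sum-init-last {N} (t ∘ toℕ))
    (+-cong (sum-cong-≋ {N} (λ i → reflexive (cong t (Finₚ.toℕ-inject₁ i)))) (reflexive (cong t (Finₚ.toℕ-fromℕ N))))

  partialSum-stable : ∀ {t N} → (∀ r → N ℕ.≤ r → t r ≈ 0#) → ∀ {M} → N ℕ.≤ M → partialSum t M ≈ partialSum t N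
  partialSum-stable {t} {N} vanish N≤M = go (ℕₚ.≤⇒≤′ N≤M)
    where
    go : ∀ {M} → N ℕ.≤′ M → partialSum t M ≈ partialSum t N
    go (ℕ.≤′-reflexive ≡.refl)  = refl
    go {suc M} (ℕ.≤′-step N≤M) = trans (partialSum-suc t M)
      (trans (+-cong (go N≤M) (vanish M (ℕₚ.≤′⇒≤ N≤M))) (+-identityʳ _))

  -- Beyond `m` both series gain the same terms; the constancy of the difference of their partial
  -- sums is stated without subtraction.
  partialSum-exchange : ∀ {t t′ m} → (∀ r → m ℕ.≤ r → t r ≈ t′ r) → ∀ {M} → m ℕ.≤ M →
                        partialSum t M + partialSum t′ m ≈ partialSum t m + partialSum t′ M
  partialSum-exchange {t} {t′} {m} agree m≤M = go (ℕₚ.≤⇒≤′ m≤M)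
    where
    go : ∀ {M} → m ℕ.≤′ M → partialSum t M + partialSum t′ m ≈ partialSum t m + partialSum t′ M
    go (ℕ.≤′-reflexive ≡.refl)  = refl
    go {suc M} (ℕ.≤′-step m≤M) = begin
      partialSum t (suc M) + partialSum t′ m      ≈⟨ +-congʳ (partialSum-suc t M) ⟩
      partialSum t M + t M + partialSum t′ m      ≈⟨ solve 3 (λ a b c → a :+ b :+ c := a :+ c :+ b) refl _ _ _ ⟩
      partialSum t M + partialSum t′ m + t M      ≈⟨ +-cong (go m≤M) (agree M (ℕₚ.≤′⇒≤ m≤M)) ⟩
      partialSum t m + partialSum t′ M + t′ M     ≈⟨ +-assoc _ _ _ ⟩
      partialSum t m + (partialSum t′ M + t′ M)   ≈⟨ +-congˡ (partialSum-suc t′ M) ⟨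
      partialSum t m + partialSum t′ (suc M)      ∎

module DigitalMethod {c ℓ} (q : ℕ) .{{_ : NonTrivial q}} (K : Field c ℓ) (card : HasCardinality K q)
  {s : ℕ} (C : Fin s → ℕ → ℕ → Field.Carrier K) (choices : DigitalChoices q K s)
  (x : DigitSequence q s) (generates : Generates q K C choices x) where
  open Field K hiding (zero)
  open FieldLemmas K
  open FiniteField K q card
  open Truncations K
  open Digits q
  open DigitalChoices choices
  open Generates generates
  open import Relation.Binary.Reasoning.Setoid setoid

  module Block (k m : ℕ) where
    point : Fin (q ℕ.^ m) → ℕ
    point n = k ℕ.* q ℕ.^ m ℕ.+ toℕ n

    input : Fin (q ℕ.^ m) → Vector Carrier m
    input n r = Inverse.to (ψ (toℕ r)) (digit q (toℕ r) (point n))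

    input-injective : ∀ {n n′} → (∀ r → input n r ≈ input n′ r) → n ≡ n′
    input-injective {n} {n′} agree = Finₚ.toℕ-injective (ℕₚ.+-cancelˡ-≡ (k ℕ.* q ℕ.^ m) _ _
      (digits-injective m (point n) (point n′) digits-agree
        (≡.trans (block-quotient k m (Finₚ.toℕ<n n)) (≡.sym (block-quotient k m (Finₚ.toℕ<n n′))))))
      where
      digits-agree : ∀ r → r ℕ.< m → digit q r (point n) ≡ digit q r (point n′)
      digits-agree r r<m = subst (λ r → digit q r (point n) ≡ digit q r (point n′)) (Finₚ.toℕ-fromℕ< r<m)
        (≡.trans (≡.sym (Inverse.strictlyInverseʳ (ψ _) _))
          (≡.trans (Inverse.from-cong (ψ _) (agree (fromℕ< r<m))) (Inverse.strictlyInverseʳ (ψ _) _)))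

    -- The first m digits separate the q^m points of a block and each ψᵣ is a bijection, so the
    -- input vectors exhaust all of K^m.
    input-surjective : ∀ a → ∃[ n ] ∀ r → input n r ≈ a r
    input-surjective a =
      let (n , eq) = injective⇒surjective {f = encode {m} ∘ input}
                       (λ eq → input-injective (encode-injective eq)) (encode a)
      in n , encode-injective eq

    -- The contribution of the digits from position m on, read off at the first point of the block.
    constant : Fin s → ℕ → Carrier
    constant i j = Y (k ℕ.* q ℕ.^ m ℕ.+ 0) i j
      - partialSum (λ r → C i j r * Inverse.to (ψ r) (digit q r (k ℕ.* q ℕ.^ m ℕ.+ 0))) m

    affine : ∀ n i j → Y (point n) i j ≈ ∑[ r < m ] (input n r * C i j (toℕ r)) + constant i j
    affine n i j with N , vanish , sum≈ ← Y-sum (point n) i j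
                 with N₀ , vanish₀ , sum₀≈ ← Y-sum (k ℕ.* q ℕ.^ m ℕ.+ 0) i j = sym (begin
      ∑[ r < m ] (input n r * C i j (toℕ r)) + (Y₀ - partialSum t₀ m)
        ≈⟨ +-congʳ (sum-cong-≋ {m} (λ r → *-comm (input n r) _)) ⟩
      partialSum t m + (Y₀ - partialSum t₀ m)
        ≈⟨ +-assoc _ _ _ ⟨
      partialSum t m + Y₀ - partialSum t₀ m
        ≈⟨ +-congʳ (+-congˡ (trans sum₀≈ (sym (partialSum-stable vanish₀ (ℕₚ.m≤n⊔m (m ℕ.⊔ N) N₀))))) ⟩
      partialSum t m + partialSum t₀ M - partialSum t₀ m
        ≈⟨ +-congʳ (partialSum-exchange high (ℕₚ.≤-trans (ℕₚ.m≤m⊔n m N) (ℕₚ.m≤m⊔n (m ℕ.⊔ N) N₀))) ⟨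
      partialSum t M + partialSum t₀ m - partialSum t₀ m
        ≈⟨ difference (+-comm (partialSum t M) (partialSum t₀ m)) ⟩
      partialSum t M
        ≈⟨ partialSum-stable vanish (ℕₚ.≤-trans (ℕₚ.m≤n⊔m m N) (ℕₚ.m≤m⊔n (m ℕ.⊔ N) N₀)) ⟩
      partialSum t N
        ≈⟨ sum≈ ⟨
      Y (point n) i j ∎)
      where
      Y₀ = Y (k ℕ.* q ℕ.^ m ℕ.+ 0) i j
      t t₀ : ℕ → Carrier
      t r = C i j r * Inverse.to (ψ r) (digit q r (point n))
      t₀ r = C i j r * Inverse.to (ψ r) (digit q r (k ℕ.* q ℕ.^ m ℕ.+ 0))
      -- Past the cutoffs of both finite sums, so that both partial sums up to `M` are complete.
      M = m ℕ.⊔ N ℕ.⊔ N₀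
      high : ∀ r → m ℕ.≤ r → t r ≈ t₀ r
      high r m≤r = reflexive (cong (λ o → C i j r * Inverse.to (ψ r) o)
        (≡.trans (high-digit k m (Finₚ.toℕ<n n) m≤r) (≡.sym (high-digit k m (ℕ.>-nonZero⁻¹ _ {{b^≢0 q m}}) m≤r))))

    translation : Vector Carrier m → Fin (q ℕ.^ m) → Fin (q ℕ.^ m)
    translation v n = proj₁ (input-surjective (λ r → input n r + v r))

    input-translation : ∀ v n r → input (translation v n) r ≈ input n r + v r
    input-translation v n = proj₂ (input-surjective (λ r → input n r + v r))

    translation-inverse : ∀ v v′ → (∀ r → v r + v′ r ≈ 0#) → ∀ n → translation v′ (translation v n) ≡ n
    translation-inverse v v′ v+v′≈0 n = input-injective λ r → begin
      input (translation v′ (translation v n)) r  ≈⟨ input-translation v′ _ r ⟩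
      input (translation v n) r + v′ r            ≈⟨ +-congʳ (input-translation v n r) ⟩
      input n r + v r + v′ r                      ≈⟨ +-assoc _ _ _ ⟩
      input n r + (v r + v′ r)                    ≈⟨ +-congˡ (v+v′≈0 r) ⟩
      input n r + 0#                              ≈⟨ +-identityʳ _ ⟩
      input n r                                   ∎

    translate : Vector Carrier m → Permutation (q ℕ.^ m) (q ℕ.^ m)
    translate v = permutation (translation v) (translation (λ r → - v r))
      (translation-inverse _ _ (λ r → -‿inverseˡ (v r))) (translation-inverse _ _ (λ r → -‿inverseʳ (v r)))

    module _ (d : Vector ℕ s)
             (surjective : ∀ (w : ∀ i → Fin (d i) → Carrier) → Σ (Vector Carrier m) λ a →
                           ∀ i j → ∑[ r < m ] (a r * C i (toℕ j) (toℕ r)) ≈ w i j) where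
      output-vector : Fin (q ℕ.^ m) → Vector Carrier (sumℕ d)
      output-vector n p = let (i , j) = locate d p in Y (point n) i (toℕ j)

      -- The rows take every value, so some input shift `v` changes the outputs by exactly `w - w′`
      -- and moves the fibre over `w′` to the one over `w`.
      output-translation : ∀ (w w′ : Vector Carrier (sumℕ d)) → ∃[ v ] ∀ n p →
                           output-vector (translation v n) p ≈ output-vector n p + (w p - w′ p)
      output-translation w w′ = v , λ n p → let (i , j) = locate d p in begin
          Y (point (translation v n)) i (toℕ j)
            ≈⟨ affine (translation v n) i (toℕ j) ⟩
          ∑[ r < m ] (input (translation v n) r * C i (toℕ j) (toℕ r)) + constant i (toℕ j)
            ≈⟨ +-congʳ (sum-cong-≋ {m} (λ r → trans (*-congʳ (input-translation v n r)) (distribʳ _ _ _))) ⟩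
          ∑[ r < m ] (input n r * C i (toℕ j) (toℕ r) + v r * C i (toℕ j) (toℕ r)) + constant i (toℕ j)
            ≈⟨ +-congʳ (∑-distrib-+ {m} (λ r → input n r * C i (toℕ j) (toℕ r)) _) ⟩
          ∑[ r < m ] (input n r * C i (toℕ j) (toℕ r)) + ∑[ r < m ] (v r * C i (toℕ j) (toℕ r)) + constant i (toℕ j)
            ≈⟨ solve 3 (λ a b c → a :+ b :+ c := a :+ c :+ b) refl _ _ _ ⟩
          ∑[ r < m ] (input n r * C i (toℕ j) (toℕ r)) + constant i (toℕ j) + ∑[ r < m ] (v r * C i (toℕ j) (toℕ r))
            ≈⟨ +-cong (sym (affine n i (toℕ j))) (rows i j) ⟩
          Y (point n) i (toℕ j) + (w (unlocate d i j) - w′ (unlocate d i j))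
            ≡⟨ cong (λ p → Y (point n) i (toℕ j) + (w p - w′ p)) (unlocate-locate d p) ⟩
          Y (point n) i (toℕ j) + (w p - w′ p) ∎
        where
        v = proj₁ (surjective (λ i j → w (unlocate d i j) - w′ (unlocate d i j)))
        rows = proj₂ (surjective (λ i j → w (unlocate d i j) - w′ (unlocate d i j)))

      -- The fibres of the affine map from inputs to output digits are
      -- translates of each other.
      count-outputs : ∀ (t : ∀ i → Fin (d i) → Fin q) {p} {Cond : Pred (Fin (q ℕ.^ m)) p} (Cond? : ∀ n → Dec (Cond n)) →
                      (∀ n → Cond n ⇔ (∀ i j → x (point n) i (toℕ j) ≡ t i j)) →
                      q ℕ.^ sumℕ d ℕ.* length (filter Cond? (allFin (q ℕ.^ m))) ≡ q ℕ.^ m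
      count-outputs t {Cond = Cond} Cond? characterization = ≡.trans
        (cong (q ℕ.^ sumℕ d ℕ.*_) (≡.trans (length-filter-tabulate Cond? {q ℕ.^ m} id)
          (ℕΣ.sum-cong-≗ {q ℕ.^ m} λ n → indicator-cong (Cond? n) (encode (output-vector n) Finₚ.≟ encode w)
            (λ cond → encode-cong (λ p → to-w n (Equivalence.to (characterization n) cond) p))
            (λ eq → Equivalence.from (characterization n) (from-w n (encode-injective eq))))))
        (equal-fibres (encode ∘ output-vector) (encode w) λ u →
          let (v , shift) = output-translation w (decode u) in translate v , λ n → mk⇔
            (λ eq → ≡.trans (encode-cong (λ p → begin
               output-vector n p
                 ≈⟨ +-identityʳ _ ⟨
               output-vector n p + 0#
                 ≈⟨ +-congˡ (-‿inverseʳ (w p)) ⟨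
               output-vector n p + (w p - w p)
                 ≈⟨ solve 3 (λ a b c → a :+ (b :+ c) := (a :+ b) :+ c) refl (output-vector n p) (w p) (- w p) ⟩
               output-vector n p + w p - w p
                 ≈⟨ difference (begin
                      output-vector n p + w p
                        ≈⟨ +-congˡ (+-cancel-difference (w p) (decode u p)) ⟩
                      output-vector n p + (decode u p + (w p - decode u p))
                        ≈⟨ solve 3 (λ a b c → a :+ (b :+ c) := (a :+ c) :+ b) refl _ _ _ ⟩
                      output-vector n p + (w p - decode u p) + decode u p
                        ≈⟨ +-congʳ (trans (sym (shift n p)) (encode-injective eq p)) ⟩
                      w p + decode u p ∎) ⟩
               decode u p ∎)) (encode-decode {sumℕ d} u))
            (λ eq → encode-cong (λ p → begin
               output-vector (translation v n) p
                 ≈⟨ shift n p ⟩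
               output-vector n p + (w p - decode u p)
                 ≈⟨ +-congʳ (trans (sym (decode-encode (output-vector n) p))
                                   (reflexive (cong (λ u → decode u p) eq))) ⟩
               decode u p + (w p - decode u p)
                 ≈⟨ +-cancel-difference (w p) (decode u p) ⟨
               w p ∎)))
        where
        w : Vector Carrier (sumℕ d)
        -- The field elements whose images under the bijections λ are the prescribed digits.
        w p = let (i , j) = locate d p in Inverse.from (λ′ i (toℕ j)) (t i j)
        to-w : ∀ n → (∀ i j → x (point n) i (toℕ j) ≡ t i j) → ∀ p → output-vector n p ≈ w p
        to-w n digits p = let (i , j) = locate d p in
          trans (sym (Inverse.strictlyInverseʳ (λ′ i (toℕ j)) _))
            (Inverse.from-cong (λ′ i (toℕ j)) (≡.trans (≡.sym (output (point n) i (toℕ j))) (digits i j)))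
        from-w : ∀ n → (∀ p → output-vector n p ≈ w p) → ∀ i j → x (point n) i (toℕ j) ≡ t i j
        from-w n agree i j = subst (λ (i , j) → x (point n) i (toℕ j) ≡ t i j) (locate-unlocate d i j)
          (let p = unlocate d i j ; (i , j) = locate d p in
           ≡.trans (output (point n) i (toℕ j)) (≡.trans (Inverse.to-cong (λ′ i (toℕ j)) (agree p))
             (Inverse.strictlyInverseˡ (λ′ i (toℕ j)) (t i j))))

-- Elementary intervals

module _ {a c D D′ : ℕ} .{{D≢0 : NonZero D}} .{{D′≢0 : NonZero D′}} where

  -- Division computes on a successor denominator only, and module parameters cannot be split; hence
  -- the generalised copy `go`, here and below.
  fraction-≃ : a ℕ.* D′ ≡ c ℕ.* D → + a ℚ./ D ≃ + c ℚ./ D′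
  fraction-≃ = go D D′
    where
    go : ∀ D D′ .{{_ : NonZero D}} .{{_ : NonZero D′}} → a ℕ.* D′ ≡ c ℕ.* D → + a ℚ./ D ≃ + c ℚ./ D′
    go (suc _) (suc _) eq = *≡* (≡.trans (≡.sym (ℤₚ.pos-* a _)) (≡.trans (cong +_ eq) (ℤₚ.pos-* c _)))

  fraction-≤ : + a ℚ./ D ℚ.≤ + c ℚ./ D′ ⇔ a ℕ.* D′ ℕ.≤ c ℕ.* D
  fraction-≤ = mk⇔ (to D D′) (from D D′)
    where
    to : ∀ D D′ .{{_ : NonZero D}} .{{_ : NonZero D′}} → + a ℚ./ D ℚ.≤ + c ℚ./ D′ → a ℕ.* D′ ℕ.≤ c ℕ.* D
    to (suc _) (suc _) (*≤* le) = ℤₚ.drop‿+≤+ (subst₂ ℤ._≤_ (≡.sym (ℤₚ.pos-* a _)) (≡.sym (ℤₚ.pos-* c _)) le)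
    from : ∀ D D′ .{{_ : NonZero D}} .{{_ : NonZero D′}} → a ℕ.* D′ ℕ.≤ c ℕ.* D → + a ℚ./ D ℚ.≤ + c ℚ./ D′
    from (suc _) (suc _) le = *≤* (subst₂ ℤ._≤_ (ℤₚ.pos-* a _) (ℤₚ.pos-* c _) (ℤ.+≤+ le))

  fraction-< : + a ℚ./ D ℚ.< + c ℚ./ D′ ⇔ a ℕ.* D′ ℕ.< c ℕ.* D
  fraction-< = mk⇔ (to D D′) (from D D′)
    where
    to : ∀ D D′ .{{_ : NonZero D}} .{{_ : NonZero D′}} → + a ℚ./ D ℚ.< + c ℚ./ D′ → a ℕ.* D′ ℕ.< c ℕ.* D
    to (suc _) (suc _) (*<* lt) = ℤₚ.drop‿+<+ (subst₂ ℤ._<_ (≡.sym (ℤₚ.pos-* a _)) (≡.sym (ℤₚ.pos-* c _)) lt)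
    from : ∀ D D′ .{{_ : NonZero D}} .{{_ : NonZero D′}} → a ℕ.* D′ ℕ.< c ℕ.* D → + a ℚ./ D ℚ.< + c ℚ./ D′
    from (suc _) (suc _) lt = *<* (subst₂ ℤ._<_ (ℤₚ.pos-* a _) (ℤₚ.pos-* c _) (ℤ.+<+ lt))

  private instance
    DD′≢0 : NonZero (D ℕ.* D′)
    DD′≢0 = ℕₚ.m*n≢0 D D′

  fraction-* : (+ a ℚ./ D) ℚ.* (+ c ℚ./ D′) ≃ + (a ℕ.* c) ℚ./ (D ℕ.* D′)
  fraction-* = go D D′
    where
    go : ∀ D D′ .{{_ : NonZero D}} .{{_ : NonZero D′}} .{{_ : NonZero (D ℕ.* D′)}} →
         (+ a ℚ./ D) ℚ.* (+ c ℚ./ D′) ≃ + (a ℕ.* c) ℚ./ (D ℕ.* D′)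
    go D@(suc _) D′@(suc _) = *≡* (cong (λ x → x ℤ.* + (D ℕ.* D′)) (≡.sym (ℤₚ.pos-* a c)))

  fraction-+ : (+ a ℚ./ D) ℚ.+ (+ c ℚ./ D′) ≃ + (a ℕ.* D′ ℕ.+ c ℕ.* D) ℚ./ (D ℕ.* D′)
  fraction-+ = go D D′
    where
    go : ∀ D D′ .{{_ : NonZero D}} .{{_ : NonZero D′}} .{{_ : NonZero (D ℕ.* D′)}} →
         (+ a ℚ./ D) ℚ.+ (+ c ℚ./ D′) ≃ + (a ℕ.* D′ ℕ.+ c ℕ.* D) ℚ./ (D ℕ.* D′)
    go D@(suc _) D′@(suc _) = *≡* (cong (λ x → x ℤ.* + (D ℕ.* D′))
      (cong₂ ℤ._+_ (≡.sym (ℤₚ.pos-* a D′)) (≡.sym (ℤₚ.pos-* c D))))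

module Intervals (b : ℕ) .{{_ : NonTrivial b}} where
  private instance
    b≢0 : NonZero b
    b≢0 = ℕ.nonTrivial⇒nonZero b

  open import Relation.Binary.Reasoning.Setoid ℚₚ.≃-setoid

  fraction : ℕ → ℕ → ℚᵘ
  fraction a n = ℚ._/_ (+ a) (b ℕ.^ n) {{b^≢0 b n}}

  scaled-invPow : ∀ a n → (+ a ℚ./ 1) ℚ.* invPow b n ≃ fraction a n
  scaled-invPow a n = begin
    (+ a ℚ./ 1) ℚ.* invPow b n   ≈⟨ fraction-* {a} {1} {1} {b ℕ.^ n} {{_}} {{b^≢0 b n}} ⟩
    ℚ._/_ (+ (a ℕ.* 1)) (1 ℕ.* b ℕ.^ n) {{1*≢0}}
      ≈⟨ fraction-≃ {{1*≢0}} {{b^≢0 b n}} (arith a (b ℕ.^ n)) ⟩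
    fraction a n                 ∎
    where
    1*≢0 : NonZero (1 ℕ.* b ℕ.^ n)
    1*≢0 = ℕₚ.m*n≢0 1 (b ℕ.^ n) {{_}} {{b^≢0 b n}}
    arith : ∀ a D → a ℕ.* 1 ℕ.* D ≡ a ℕ.* (1 ℕ.* D)
    arith = ℕSolver.solve-∀

  invPow-+ : ∀ m n → invPow b m ℚ.* invPow b n ≃ invPow b (m ℕ.+ n)
  invPow-+ m n = begin
    invPow b m ℚ.* invPow b n  ≈⟨ fraction-* {1} {1} {b ℕ.^ m} {b ℕ.^ n} {{b^≢0 b m}} {{b^≢0 b n}} ⟩
    ℚ._/_ (+ 1) (b ℕ.^ m ℕ.* b ℕ.^ n) {{product≢0}}
      ≈⟨ fraction-≃ {1} {1} {{product≢0}} {{b^≢0 b (m ℕ.+ n)}} (cong (1 ℕ.*_) (ℕₚ.^-distribˡ-+-* b m n)) ⟩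
    invPow b (m ℕ.+ n)         ∎
    where
    product≢0 : NonZero (b ℕ.^ m ℕ.* b ℕ.^ n)
    product≢0 = ℕₚ.m*n≢0 _ _ {{b^≢0 b m}} {{b^≢0 b n}}

  invPow-reflects-≤ : ∀ {m n} → invPow b m ℚ.≤ invPow b n → n ℕ.≤ m
  invPow-reflects-≤ {m} {n} le = ℕₚ.≮⇒≥ λ m<n → ℕₚ.<⇒≱ (ℕₚ.^-monoʳ-< b (ℕ.nonTrivial⇒n>1 b) m<n)
    (subst₂ ℕ._≤_ (ℕₚ.*-identityˡ _) (ℕₚ.*-identityˡ _)
      (Equivalence.to (fraction-≤ {1} {1} {{b^≢0 b m}} {{b^≢0 b n}}) le))

  module _ {s} (J : ElementaryInterval b s) where
    open ElementaryInterval J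

    side : ∀ i → upper i ℚ.- lower i ≃ invPow b (d i)
    side i = begin
      upper i ℚ.- l                       ≈⟨ ℚₚ.+-congˡ (ℚ.- l) (begin
        upper i                             ≈⟨ scaled-invPow (suc (a i)) (d i) ⟩
        fraction (suc (a i)) (d i)          ≈⟨ fraction-≃ {{b^≢0 b (d i)}} {{DD≢0}} (arith (a i) (b ℕ.^ d i)) ⟩
        ℚ._/_ (+ (a i ℕ.* b ℕ.^ d i ℕ.+ 1 ℕ.* b ℕ.^ d i)) (b ℕ.^ d i ℕ.* b ℕ.^ d i) {{DD≢0}}
                                            ≈⟨ fraction-+ {a i} {1} {{b^≢0 b (d i)}} {{b^≢0 b (d i)}} ⟨
        fraction (a i) (d i) ℚ.+ p          ≈⟨ ℚₚ.+-congˡ p (ℚₚ.≃-sym (scaled-invPow (a i) (d i))) ⟩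
        l ℚ.+ p                             ∎) ⟩
      l ℚ.+ p ℚ.- l                       ≈⟨ ℚₚ.+-congˡ (ℚ.- l) (ℚₚ.+-comm l p) ⟩
      p ℚ.+ l ℚ.- l                       ≈⟨ ℚₚ.+-assoc p l (ℚ.- l) ⟩
      p ℚ.+ (l ℚ.- l)                     ≈⟨ ℚₚ.+-congʳ p (ℚₚ.+-inverseʳ l) ⟩
      p ℚ.+ 0ℚᵘ                           ≈⟨ ℚₚ.+-identityʳ p ⟩
      p                                   ∎
      where
      l = lower i
      p = invPow b (d i)
      DD≢0 : NonZero (b ℕ.^ d i ℕ.* b ℕ.^ d i)
      DD≢0 = ℕₚ.m*n≢0 _ _ {{b^≢0 b (d i)}} {{b^≢0 b (d i)}}
      arith : ∀ a D → suc a ℕ.* (D ℕ.* D) ≡ (a ℕ.* D ℕ.+ 1 ℕ.* D) ℕ.* D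
      arith = ℕSolver.solve-∀

    vol≃ : vol ≃ invPow b (sumℕ d)
    vol≃ = ℚₚ.≃-trans (ℚΠ.sum-cong-≋ {s} side) (product d)
      where
      product : ∀ {s} (d : Vector ℕ s) → ℚΠ.sum (λ i → invPow b (d i)) ≃ invPow b (sumℕ d)
      product {zero}  d = *≡* ≡.refl
      product {suc s} d = ℚₚ.≃-trans (ℚₚ.*-congˡ {invPow b (d zero)} (product (d ∘ suc))) (invPow-+ (d zero) _)

  -- The integer with base-b digits ξ 0, …, ξ (m - 1), most significant first.
  value : (ℕ → Fin b) → ℕ → ℕ
  value ξ zero    = 0
  value ξ (suc m) = value ξ m ℕ.* b ℕ.+ toℕ (ξ m)

  value-+ : ∀ ξ d t → value ξ (d ℕ.+ t) ≡ value ξ d ℕ.* b ℕ.^ t ℕ.+ value (ξ ∘ (d ℕ.+_)) t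
  value-+ ξ d zero    = ≡.trans (cong (value ξ) (ℕₚ.+-identityʳ d)) (arith (value ξ d))
    where
    arith : ∀ v → v ≡ v ℕ.* 1 ℕ.+ 0
    arith = ℕSolver.solve-∀
  value-+ ξ d (suc t) = ≡.trans (cong (value ξ) (ℕₚ.+-suc d t)) (≡.trans
    (cong (λ v → v ℕ.* b ℕ.+ toℕ (ξ (d ℕ.+ t))) (value-+ ξ d t))
    (arith (value ξ d) (b ℕ.^ t) (value (ξ ∘ (d ℕ.+_)) t) b (toℕ (ξ (d ℕ.+ t)))))
    where
    arith : ∀ v B w b x → (v ℕ.* B ℕ.+ w) ℕ.* b ℕ.+ x ≡ v ℕ.* (b ℕ.* B) ℕ.+ (w ℕ.* b ℕ.+ x)
    arith = ℕSolver.solve-∀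

  value< : ∀ ξ m → value ξ m ℕ.< b ℕ.^ m
  value< ξ zero    = s≤s z≤n
  value< ξ (suc m) = ℕₚ.≤-trans (ℕₚ.≤-trans (ℕₚ.≤-reflexive (≡.sym (ℕₚ.+-suc (value ξ m ℕ.* b) _)))
    (ℕₚ.+-monoʳ-≤ (value ξ m ℕ.* b) (Finₚ.toℕ<n (ξ m))))
    (ℕₚ.≤-trans (ℕₚ.≤-reflexive (ℕₚ.+-comm (value ξ m ℕ.* b) b))
      (ℕₚ.≤-trans (ℕₚ.*-monoˡ-≤ b (value< ξ m)) (ℕₚ.≤-reflexive (ℕₚ.*-comm _ b))))

  -- `funToFin` also puts the first digit in the most significant place, so `finToFun` of an
  -- interval's numerator lists the digits that define the interval.
  value-funToFin : ∀ ξ d → value ξ d ≡ toℕ (funToFin {d} (ξ ∘ toℕ))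
  value-funToFin ξ zero    = ≡.refl
  value-funToFin ξ (suc d) = ≡.trans (value-+ ξ 1 d) (≡.trans
    (cong₂ ℕ._+_ (ℕₚ.*-comm (toℕ (ξ 0)) (b ℕ.^ d)) (value-funToFin (ξ ∘ suc) d))
    (≡.sym (Finₚ.toℕ-combine (ξ 0) _)))

  truncate≃ : ∀ {s} m (ξ : Fin s → ℕ → Fin b) i → truncate b m ξ i ≃ fraction (value (ξ i) m) m
  truncate≃ zero    ξ i = *≡* ≡.refl
  truncate≃ (suc m) ξ i = begin
    truncate b (suc m) ξ i
      ≈⟨ ℚΣ.sum-init-last {m} (λ j → (+ toℕ (ξ i (toℕ j)) ℚ./ 1) ℚ.* invPow b (suc (toℕ j))) ⟩
    ℚΣ.sum {m} (λ j → term (toℕ (inject₁ j))) ℚ.+ term (toℕ (fromℕ m))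
      ≈⟨ ℚₚ.+-cong (ℚΣ.sum-cong-≋ {m} (λ j → ℚₚ.≃-reflexive (cong term (Finₚ.toℕ-inject₁ j))))
                   (ℚₚ.≃-reflexive (cong term (Finₚ.toℕ-fromℕ m))) ⟩
    truncate b m ξ i ℚ.+ term m
      ≈⟨ ℚₚ.+-cong (truncate≃ m ξ i) (scaled-invPow (toℕ (ξ i m)) (suc m)) ⟩
    fraction v m ℚ.+ fraction x (suc m)
      ≈⟨ fraction-+ {v} {x} {{b^≢0 b m}} {{b^≢0 b (suc m)}} ⟩
    ℚ._/_ (+ (v ℕ.* b ℕ.^ suc m ℕ.+ x ℕ.* b ℕ.^ m)) (b ℕ.^ m ℕ.* b ℕ.^ suc m) {{product≢0}}
      ≈⟨ fraction-≃ {{product≢0}} {{b^≢0 b (suc m)}} (arith v x b (b ℕ.^ m)) ⟩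
    fraction (v ℕ.* b ℕ.+ x) (suc m) ∎
    where
    v = value (ξ i) m
    x = toℕ (ξ i m)
    term : ℕ → ℚᵘ
    term j = (+ toℕ (ξ i j) ℚ./ 1) ℚ.* invPow b (suc j)
    product≢0 : NonZero (b ℕ.^ m ℕ.* b ℕ.^ suc m)
    product≢0 = ℕₚ.m*n≢0 _ _ {{b^≢0 b m}} {{b^≢0 b (suc m)}}
    arith : ∀ v x b B → (v ℕ.* (b ℕ.* B) ℕ.+ x ℕ.* B) ℕ.* (b ℕ.* B) ≡ (v ℕ.* b ℕ.+ x) ℕ.* (B ℕ.* (b ℕ.* B))
    arith = ℕSolver.solve-∀

  truncate-in-cube : ∀ {s} m (ξ : Fin s → ℕ → Fin b) i → 0ℚᵘ ℚ.≤ truncate b m ξ i × truncate b m ξ i ℚ.< 1ℚᵘ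
  truncate-in-cube m ξ i =
      ℚₚ.≤-respʳ-≃ (ℚₚ.≃-sym (truncate≃ m ξ i)) (Equivalence.from (fraction-≤ {0} {_} {1} {{_}} {{b^≢0 b m}}) z≤n)
    , ℚₚ.<-respˡ-≃ (ℚₚ.≃-sym (truncate≃ m ξ i)) (Equivalence.from (fraction-< {_} {1} {_} {1} {{b^≢0 b m}})
        (subst₂ ℕ._<_ (≡.sym (ℕₚ.*-identityʳ _)) (≡.sym (ℕₚ.*-identityˡ _)) (value< (ξ i) m)))

  module _ {s} (J : ElementaryInterval b s) {m} (d≤m : ∀ i → ElementaryInterval.d J i ℕ.≤ m)
           (ξ : Fin s → ℕ → Fin b) where
    open ElementaryInterval J

    target : ∀ i → Fin (d i) → Fin b
    target i = finToFun (fromℕ< (a< i))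

    module _ (i : Fin s) where
      private
        t = m ℕ.∸ d i
        v = value (ξ i) (d i)
        w = value (ξ i ∘ (d i ℕ.+_)) t
        B = b ℕ.^ t
        value-m : value (ξ i) m ≡ v ℕ.* B ℕ.+ w
        value-m = ≡.trans (cong (value (ξ i)) (≡.sym (ℕₚ.m+[n∸m]≡n (d≤m i)))) (value-+ (ξ i) (d i) t)
        power-m : b ℕ.^ m ≡ b ℕ.^ d i ℕ.* B
        power-m = ≡.trans (cong (b ℕ.^_) (≡.sym (ℕₚ.m+[n∸m]≡n (d≤m i)))) (ℕₚ.^-distribˡ-+-* b (d i) t)
        instance
          d≢0 : NonZero (b ℕ.^ d i)
          d≢0 = b^≢0 b (d i)
          m≢0 : NonZero (b ℕ.^ m)
          m≢0 = b^≢0 b m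

        scale : ∀ x → x ℕ.* b ℕ.^ m ≡ x ℕ.* B ℕ.* b ℕ.^ d i
        scale x = ≡.trans (cong (x ℕ.*_) power-m) (arith x (b ℕ.^ d i) B)
          where
          arith : ∀ x D B → x ℕ.* (D ℕ.* B) ≡ x ℕ.* B ℕ.* D
          arith = ℕSolver.solve-∀

      -- The truncated coordinate is (v B + w) / b^m with w < B. The endpoints are multiples of B /
      -- b^m, so the tail `w` cannot affect the comparison.
      lower≤⇔ : lower i ℚ.≤ truncate b m ξ i ⇔ a i ℕ.≤ v
      lower≤⇔ = mk⇔
        (λ le → ℕₚ.≮⇒≥ λ v<a → ℕₚ.<⇒≱ (ℕₚ.<-≤-trans (ℕₚ.+-monoʳ-< (v ℕ.* B) (value< _ t))
            (ℕₚ.≤-trans (ℕₚ.≤-reflexive (ℕₚ.+-comm (v ℕ.* B) B)) (ℕₚ.*-monoˡ-≤ B v<a)))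
          (subst (a i ℕ.* B ℕ.≤_) value-m (ℕₚ.*-cancelʳ-≤ _ _ (b ℕ.^ d i) (subst (ℕ._≤ value (ξ i) m ℕ.* b ℕ.^ d i) (scale (a i))
            (Equivalence.to fraction-≤ (ℚₚ.≤-respˡ-≃ (scaled-invPow (a i) (d i)) (ℚₚ.≤-respʳ-≃ (truncate≃ m ξ i) le)))))))
        (λ a≤v → ℚₚ.≤-respˡ-≃ (ℚₚ.≃-sym (scaled-invPow (a i) (d i))) (ℚₚ.≤-respʳ-≃ (ℚₚ.≃-sym (truncate≃ m ξ i))
          (Equivalence.from fraction-≤ (subst (ℕ._≤ value (ξ i) m ℕ.* b ℕ.^ d i) (≡.sym (scale (a i))) (ℕₚ.*-monoˡ-≤ (b ℕ.^ d i)
            (subst (a i ℕ.* B ℕ.≤_) (≡.sym value-m) (ℕₚ.≤-trans (ℕₚ.*-monoˡ-≤ B a≤v) (ℕₚ.m≤m+n _ w))))))))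

      <upper⇔ : truncate b m ξ i ℚ.< upper i ⇔ v ℕ.≤ a i
      <upper⇔ = mk⇔
        (λ lt → ℕₚ.≮⇒≥ λ a<v → ℕₚ.<⇒≱ (subst (ℕ._< suc (a i) ℕ.* B) value-m
            (ℕₚ.*-cancelʳ-< (b ℕ.^ d i) _ _ (subst (value (ξ i) m ℕ.* b ℕ.^ d i ℕ.<_) (scale (suc (a i)))
              (Equivalence.to fraction-< (ℚₚ.<-respʳ-≃ (scaled-invPow (suc (a i)) (d i)) (ℚₚ.<-respˡ-≃ (truncate≃ m ξ i) lt))))))
          (ℕₚ.≤-trans (ℕₚ.*-monoˡ-≤ B a<v) (ℕₚ.m≤m+n _ w)))
        (λ v≤a → ℚₚ.<-respʳ-≃ (ℚₚ.≃-sym (scaled-invPow (suc (a i)) (d i))) (ℚₚ.<-respˡ-≃ (ℚₚ.≃-sym (truncate≃ m ξ i))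
          (Equivalence.from fraction-< (subst (value (ξ i) m ℕ.* b ℕ.^ d i ℕ.<_) (≡.sym (scale (suc (a i)))) (ℕₚ.*-monoˡ-< (b ℕ.^ d i)
            (subst (ℕ._< suc (a i) ℕ.* B) (≡.sym value-m) (ℕₚ.<-≤-trans (ℕₚ.+-monoʳ-< (v ℕ.* B) (value< _ t))
              (ℕₚ.≤-trans (ℕₚ.≤-reflexive (ℕₚ.+-comm (v ℕ.* B) B)) (ℕₚ.*-monoˡ-≤ B (s≤s v≤a))))))))))

    contains⇔digits : Contains (truncate b m ξ) ⇔ (∀ i j → ξ i (toℕ j) ≡ target i j)
    contains⇔digits = mk⇔
      (λ inside i j → ≡.trans (≡.sym (Finₚ.finToFun-funToFin (ξ i ∘ toℕ) j)) (cong (λ n → finToFun n j)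
        (Finₚ.toℕ-injective (≡.trans (≡.sym (value-funToFin (ξ i) (d i))) (≡.trans
          (ℕₚ.≤-antisym (Equivalence.to (<upper⇔ i) (proj₂ (inside i))) (Equivalence.to (lower≤⇔ i) (proj₁ (inside i))))
          (≡.sym (Finₚ.toℕ-fromℕ< (a< i))))))))
      (λ digits i → let v≡a = value≡a digits i in
        Equivalence.from (lower≤⇔ i) (ℕₚ.≤-reflexive (≡.sym v≡a)) , Equivalence.from (<upper⇔ i) (ℕₚ.≤-reflexive v≡a))
      where
      value≡a : (∀ i j → ξ i (toℕ j) ≡ target i j) → ∀ i → value (ξ i) (d i) ≡ a i
      value≡a digits i = ≡.trans (value-funToFin (ξ i) (d i)) (≡.trans (cong toℕ (≡.trans (funToFin-cong {d i} (digits i))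
        (Finₚ.funToFin-finToFin {d i} (fromℕ< (a< i))))) (Finₚ.toℕ-fromℕ< (a< i)))

-- Rounding the interval and assembling the nets

pad : ∀ {a} {A : Set a} {n} → A → Vector A n → ℕ → A
pad {n = zero}  z w _       = z
pad {n = suc n} z w zero    = w zero
pad {n = suc n} z w (suc j) = pad z (w ∘ suc) j

pad-toℕ : ∀ {a} {A : Set a} {n} (z : A) (w : Vector A n) j → pad z w (toℕ j) ≡ w j
pad-toℕ z w zero    = ≡.refl
pad-toℕ z w (suc j) = pad-toℕ z (w ∘ suc) j

≤-sumℕ : ∀ {n} (f : Vector ℕ n) i → f i ℕ.≤ sumℕ f
≤-sumℕ f zero    = ℕₚ.m≤m+n (f zero) _
≤-sumℕ f (suc i) = ℕₚ.≤-trans (≤-sumℕ (f ∘ suc) i) (ℕₚ.m≤n+m _ (f zero))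

-- The witness is the ceiling of d / e; with the divisor written `suc e`, the usual numerator d + e
-- - 1 becomes `d + e`.
round-up : ∀ e d → 1 ℕ.≤ e → ∃[ k ] d ℕ.≤ k ℕ.* e × k ℕ.* e ℕ.≤ d ℕ.+ ℕ.pred e
round-up (suc e) d _ = (d ℕ.+ e) DivMod./ suc e
  , ℕₚ.+-cancelˡ-≤ e _ _ (begin
      e ℕ.+ d                                                        ≡⟨ ℕₚ.+-comm e d ⟩
      d ℕ.+ e                                                        ≡⟨ DivMod.m≡m%n+[m/n]*n (d ℕ.+ e) (suc e) ⟩
      (d ℕ.+ e) DivMod.% suc e ℕ.+ (d ℕ.+ e) DivMod./ suc e ℕ.* suc e    ≤⟨ ℕₚ.+-monoˡ-≤ _ (ℕₚ.≤-pred (DivMod.m%n<n (d ℕ.+ e) (suc e))) ⟩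
      e ℕ.+ (d ℕ.+ e) DivMod./ suc e ℕ.* suc e                         ∎)
  , DivMod.m/n*n≤m (d ℕ.+ e) (suc e)
  where open ℕₚ.≤-Reasoning

open import Data.Nat using (_+_; _≤_; pred)

module Sequence
  {c ℓ} (q : ℕ) .{{_ : NonTrivial q}} (K F : Field c ℓ) (card : HasCardinality K q)
  (E : Extension K F) (g : ℕ) (genus : IsGenus E g) (s : ℕ) (P∞ : Place E) (P : Vector (Place E) s)
  (P∞∉P : ∀ i → ¬ _≈ₚ_ E P∞ (P i)) (P-distinct : ∀ i j → ¬ i ≡ j → ¬ _≈ₚ_ E (P i) (P j))
  (degree∞ : HasDegree E P∞ 1) (e : Vector ℕ s) (degree : ∀ i → HasDegree E (P i) (e i))
  (C : Fin s → ℕ → ℕ → Field.Carrier K) (construction : RefinedColumnwise E g P∞ P e C)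
  (choices : DigitalChoices q K s) (x : DigitSequence q s) (generates : Generates q K C choices x) where

  open Intervals q
  open ElementaryInterval

  weight : Vector ℕ s → ℕ
  weight k = sumℕ (λ i → k i ℕ.* e i)

  -- Multiplying out the power of q leaves an equation of naturals; it is stable, so surjectivity up
  -- to double negation suffices.
  block-count : ∀ k m (J : ElementaryInterval q s) (κ : Vector ℕ s) →
                (∀ i → d J i ≤ κ i ℕ.* e i) → g + weight κ ≤ m →
                q ℕ.^ sumℕ (d J) ℕ.* count q J (block q x k m) ≡ q ℕ.^ m
  block-count k m J κ d≤κe g+κ≤m = decidable-stable (_ ℕ.≟ _) (rows-surjective >>= λ surjective →
    return (count-outputs (d J)
      -- Surjectivity is known for κᵢ eᵢ rows and needed for the first dᵢ; the values prescribed on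
      -- the additional rows are set to 0.
      (λ w → let (a , rows) = surjective (λ i j → pad 0# (w i) (toℕ j)) in a , λ i j →
        trans (subst (λ r → K.sum (λ t → a t * C i r (toℕ t)) ≈ pad 0# (w i) r)
                     (Finₚ.toℕ-inject≤ j (d≤κe i)) (rows i (inject≤ j (d≤κe i))))
              (reflexive (pad-toℕ 0# (w i) j)))
      (λ i → Fin.finToFun (Fin.fromℕ< (a< J i))) (λ n → contains? J (block q x k m n))
      (λ n → contains⇔digits J d≤m (x (point n)))))
    where
    module K = Field K
    open Field K using (0#; _≈_; _*_; trans; reflexive)
    open Construction.Reduction E q card genus P∞ P P∞∉P P-distinct degree∞ e degree C construction κ g+κ≤m
    open DigitalMethod.Block q K card C choices x generates k m
    d≤m : ∀ i → d J i ≤ m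
    d≤m i = ℕₚ.≤-trans (d≤κe i) (ℕₚ.≤-trans (≤-sumℕ (λ i → κ i ℕ.* e i) i) (ℕₚ.≤-trans (ℕₚ.m≤n+m _ g) g+κ≤m))

  isUES : IsUESSequence q g e x
  isUES k m g<m = record
    { u≤m     = ℕₚ.<⇒≤ g<m
    ; inCube  = λ n → truncate-in-cube m (x (k ℕ.* q ℕ.^ m + toℕ n))
    ; uniform = uniform
    }
    where
    uniform : ∀ J → (∀ i → e i ∣ d J i) → invPow q (m ℕ.∸ g) ℚ.≤ vol J →
              (+ count q J (block q x k m) ℚ./ 1) ≃ (+ (q ℕ.^ m) ℚ./ 1) ℚ.* vol J
    uniform J e∣d large = ℚₚ.≃-sym (ℚₚ.≃-trans (ℚₚ.*-congˡ {+ (q ℕ.^ m) ℚ./ 1} (vol≃ J))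
      (ℚₚ.≃-trans (scaled-invPow (q ℕ.^ m) D) (fraction-≃ {D = q ℕ.^ D} {{b^≢0 q D}} (≡.trans (ℕₚ.*-identityʳ _)
        (≡.trans (≡.sym (block-count k m J (λ i → quotient (e∣d i)) (λ i → ℕₚ.≤-reflexive (d≡ i)) room))
          (ℕₚ.*-comm (q ℕ.^ D) _))))))
      where
      D = sumℕ (d J)
      d≡ : ∀ i → d J i ≡ quotient (e∣d i) ℕ.* e i
      d≡ i = Divisibility._∣_.equality (e∣d i)
      -- The volume bound says ∑ dᵢ ≤ m - g, and as eᵢ divides dᵢ the weight equals ∑ dᵢ without any
      -- rounding.
      room : g + weight (λ i → quotient (e∣d i)) ≤ m
      room = ℕₚ.≤-trans (ℕₚ.+-monoʳ-≤ g (ℕₚ.≤-trans (ℕₚ.≤-reflexive (≡.sym (ℕΣ.sum-cong-≗ {s} d≡)))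
               (invPow-reflects-≤ (ℚₚ.≤-respʳ-≃ (vol≃ J) large))))
             (ℕₚ.≤-reflexive (ℕₚ.m+[n∸m]≡n (ℕₚ.<⇒≤ g<m)))

  -- Rounding dᵢ up to a multiple of eᵢ costs at most eᵢ - 1.
  isTS : IsTSSequence q (g + sumℕ (λ i → pred (e i))) x
  isTS k m t<m = record
    { t≤m     = ℕₚ.<⇒≤ t<m
    ; inCube  = λ n → truncate-in-cube m (x (k ℕ.* q ℕ.^ m + toℕ n))
    ; uniform = uniform
    }
    where
    excess = sumℕ (λ i → pred (e i))
    t = g + excess
    t+[m∸t]≡m = ℕₚ.m+[n∸m]≡n (ℕₚ.<⇒≤ t<m)
    uniform : ∀ J → vol J ≃ invPow q (m ℕ.∸ t) → count q J (block q x k m) ≡ q ℕ.^ t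
    uniform J vol-J = ℕₚ.*-cancelˡ-≡ _ _ (q ℕ.^ D) {{b^≢0 q D}} (≡.trans
      (block-count k m J (λ i → proj₁ (rounded i)) (λ i → proj₁ (proj₂ (rounded i))) room)
      (≡.trans (cong (q ℕ.^_) (≡.sym t+[m∸t]≡m)) (≡.trans (ℕₚ.^-distribˡ-+-* q t _)
        (≡.trans (ℕₚ.*-comm (q ℕ.^ t) _) (cong (λ D → q ℕ.^ D ℕ.* q ℕ.^ t) (≡.sym D≡))))))
      where
      D = sumℕ (d J)
      rounded = λ i → round-up (e i) (d J i) (PlaceLemmas.degree-positive E q card (P i) (degree i))
      invPow-D = ℚₚ.≃-trans (ℚₚ.≃-sym (vol≃ J)) vol-J
      D≡ : D ≡ m ℕ.∸ t
      D≡ = ℕₚ.≤-antisym (invPow-reflects-≤ (ℚₚ.≤-reflexive (ℚₚ.≃-sym invPow-D)))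
                        (invPow-reflects-≤ (ℚₚ.≤-reflexive invPow-D))
      room : g + weight (λ i → proj₁ (rounded i)) ≤ m
      room = begin
        g + weight (λ i → proj₁ (rounded i))   ≤⟨ ℕₚ.+-monoʳ-≤ g (sumℕ-mono (λ i → proj₂ (proj₂ (rounded i)))) ⟩
        g + sumℕ (λ i → d J i + pred (e i))    ≡⟨ cong (g ℕ.+_) (ℕΣ.∑-distrib-+ (d J) _) ⟩
        g + (D + excess)                       ≡⟨ cong (λ D → g + (D + excess)) D≡ ⟩
        g + (m ℕ.∸ t + excess)                 ≡⟨ cong (g ℕ.+_) (ℕₚ.+-comm _ excess) ⟩
        g + (excess + (m ℕ.∸ t))               ≡⟨ ℕₚ.+-assoc g excess _ ⟨
        t + (m ℕ.∸ t)                          ≡⟨ t+[m∸t]≡m ⟩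
        m                                      ∎
        where open ℕₚ.≤-Reasoning

mainTheorem3 : ∀ {c ℓ} (q : ℕ) .{{_ : NonTrivial q}} → IsPrimePower q →
    (K F : Field c ℓ) → HasCardinality K q →
    (E : Extension K F) → IsFunctionField E → IsFullConstantField E →
    (g : ℕ) → IsGenus E g →
    (s : ℕ) → 1 ≤ s →
    (P∞ : Place E) (P : Vector (Place E) s) →
    (∀ i → ¬ _≈ₚ_ E P∞ (P i)) →
    (∀ i j → ¬ i ≡ j → ¬ _≈ₚ_ E (P i) (P j)) →
    HasDegree E P∞ 1 →
    (e : Vector ℕ s) → (∀ i → HasDegree E (P i) (e i)) →
    (C : Fin s → ℕ → ℕ → Field.Carrier K) → RefinedColumnwise E g P∞ P e C →
    (ch : DigitalChoices q K s) (x : DigitSequence q s) → Generates q K C ch x →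
    IsUESSequence q g e x × IsTSSequence q (g + sumℕ (λ i → pred (e i))) x
mainTheorem3 q _ K F card E _ _ g genus s _ P∞ P P∞∉P P-distinct degree∞ e degree C construction ch x generates =
  isUES , isTS
  where open Sequence q K F card E g genus s P∞ P P∞∉P P-distinct degree∞ e degree C construction ch x generates
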